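{- Assume $q>2$, let $A=\mathbb{F}_q[T]$ and let $C$ be the Carlitz module. Let $m,u\in A$ be monic polynomials such that at least one of them has positive degree. Then there exists a large Zsigmondy prime for $(u,m)$, except exactly in the following cases: (EC-I) $q=3$, $u=1$, and $m=(\wp-1)\wp$ for an arbitrary monic prime $\wp$ of degree one in $\mathbb{F}_3[T]$; (EC-II) $q=4$, $u=1$, and $m=(\wp-1)\wp$ for an arbitrary monic prime $\wp$ of degree one in $\mathbb{F}_4[T]$; (EC-III) $q=3$, $u=1$, and $m\in\{(T-1)T^2,\ T(T+1)^2,\ (T+1)(T+2)^2\}$; (EC-IV) $q=3$ and $u=m\in\{T,\ T+1,\ T+2\}$; (EC-V) $q=5$, $u=1$, and $m\in\{T(T+1),\ (T+1)(T+2),\ (T+2)(T+3),\ (T+3)(T+4),\ (T+4)T\}$; (EC-VI) $u=1$ and $m$ is a monic prime of degree one in $\mathbb{F}_q[T]$ (any $q>2$); (EC-VII) $q=3$, $u=1$, and $m\in\{T^2,\ (T+1)^2,\ (T+2)^2\}$; (EC-VIII) $q=4$, $u=1$, and $m\in\{T(T+w),\ T(T+w^2),\ (T+1)(T+w),\ (T+1)(T+w^2)\}$, where $\mathbb{F}_4=\mathbb{F}_2(w)$ with $w^2+w+1=0$; (EC-IX) $q=3$, $u=1$, and $m=T^3+2T$.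
   Context: $A=\mathbb{F}_q[T]$, $k=\mathbb{F}_q(T)$. The Carlitz module is the $\mathbb{F}_q$-algebra homomorphism $a\mapsto C_a$ from $A$ to the twisted polynomial ring $k\langle\tau\rangle$ (with $\tau(x)=x^q$) determined by $C_T=T+\tau$; thus $C_T(x)=Tx+x^q$ and $C_a(x)\in A[x]$ for every $a\in A$, with $C_{ab}(x)=C_a(C_b(x))$. For nonzero $m,u\in A$, a Zsigmondy prime for $(u,m)$ is a monic prime $\wp\in A$ such that $C_m(u)\equiv 0\pmod{\wp}$ and $C_n(u)\not\equiv 0\pmod{\wp}$ for every nonzero $n\in A$ with $\deg(n)<\deg(m)$. A large Zsigmondy prime for $(u,m)$ is a Zsigmondy prime $\wp$ for $(u,m)$ such that either $\deg(\wp)>\deg(m)$ or $\wp^2$ divides $C_m(u)$. -}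

module Defs where

open import Level using (0ℓ)
open import Data.Nat as ℕ using (ℕ; zero; suc; _∸_)
open import Data.Fin using (Fin)
open import Data.List using (List; []; _∷_; length; reverse)
open import Data.Maybe using (Maybe; just; nothing)
open import Data.Product using (Σ; ∃; _×_; _,_)
open import Data.Sum using (_⊎_)
open import Data.Empty using (⊥)
open import Relation.Nullary using (¬_; yes; no)
open import Relation.Binary using (DecidableEquality)
open import Relation.Binary.PropositionalEquality using (_≡_)
open import Algebra.Structures using (IsCommutativeRing)
open import Function.Bundles using (_↔_)

record FiniteField : Set₁ where
  infixl 7 _*_
  infixl 6 _+_
  field
    F      : Set
    _+_    : F → F → F
    _*_    : F → F → F
    -_     : F → F
    0# 1#  : F
    isCommutativeRing : IsCommutativeRing _≡_ _+_ _*_ -_ 0# 1#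
    0≢1    : ¬ (0# ≡ 1#)
    inverse : ∀ x → ¬ (x ≡ 0#) → Σ F λ y → x * y ≡ 1#
    _≟_    : DecidableEquality F
    card   : ℕ
    finite : F ↔ Fin card

-- The polynomial ring A = F[T]; polynomials are coefficient lists,
-- lowest degree first; equality is coefficientwise (trailing zeros ignored).

module Poly (𝔽 : FiniteField) where
  open FiniteField 𝔽

  Pol : Set
  Pol = List F

  coeff : Pol → ℕ → F
  coeff []       _       = 0#
  coeff (x ∷ _)  zero    = x
  coeff (_ ∷ xs) (suc i) = coeff xs i

  infix 4 _≈_
  _≈_ : Pol → Pol → Set
  p ≈ r = ∀ i → coeff p i ≡ coeff r i

  infixl 6 _⊕_ _⊖_
  infixl 7 _⊗_ _•_

  _⊕_ : Pol → Pol → Pol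
  []       ⊕ ys       = ys
  (x ∷ xs) ⊕ []       = x ∷ xs
  (x ∷ xs) ⊕ (y ∷ ys) = (x + y) ∷ (xs ⊕ ys)

  _•_ : F → Pol → Pol
  c • []       = []
  c • (x ∷ xs) = (c * x) ∷ (c • xs)

  ⊝_ : Pol → Pol
  ⊝ p = (- 1#) • p

  _⊖_ : Pol → Pol → Pol
  p ⊖ r = p ⊕ (⊝ r)

  _⊗_ : Pol → Pol → Pol
  []       ⊗ ys = []
  (x ∷ xs) ⊗ ys = (x • ys) ⊕ (0# ∷ (xs ⊗ ys))

  _^_ : Pol → ℕ → Pol
  p ^ zero  = 1# ∷ []
  p ^ suc n = p ⊗ (p ^ n)

  ‵ : F → Pol
  ‵ c = c ∷ []

  𝟙 : Pol
  𝟙 = ‵ 1#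

  T : Pol
  T = 0# ∷ 1# ∷ []

  private
    dropZeros : List F → List F
    dropZeros []       = []
    dropZeros (x ∷ xs) with x ≟ 0#
    ... | yes _ = dropZeros xs
    ... | no  _ = x ∷ xs

  trim : Pol → Pol
  trim p = reverse (dropZeros (reverse p))

  -- degree (deg of the zero polynomial is set to 0; it is only used
  -- for nonzero polynomials below)
  deg : Pol → ℕ
  deg p = length (trim p) ∸ 1

  leading : Pol → Maybe F
  leading p with reverse (trim p)
  ... | []    = nothing
  ... | x ∷ _ = just x

  Monic : Pol → Set
  Monic p = leading p ≡ just 1#

  IsZero : Pol → Set
  IsZero p = p ≈ []

  infix 4 _∣_
  _∣_ : Pol → Pol → Set
  a ∣ b = Σ Pol λ c → c ⊗ a ≈ b

  IsUnit : Pol → Set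
  IsUnit a = a ∣ 𝟙

  IsPrime : Pol → Set
  IsPrime p = ¬ IsZero p × ¬ IsUnit p
            × (∀ a b → p ∣ a ⊗ b → p ∣ a ⊎ p ∣ b)

  MonicPrime : Pol → Set
  MonicPrime p = Monic p × IsPrime p

  -- Carlitz module: C_T(x) = T x + x^q, and for a = Σ aᵢ Tⁱ,
  -- C_a = Σ aᵢ (C_T)ⁱ (the F_q-algebra homomorphism A → k⟨τ⟩).

  CT : Pol → Pol
  CT v = (T ⊗ v) ⊕ (v ^ card)

  CTiter : ℕ → Pol → Pol
  CTiter zero    v = v
  CTiter (suc i) v = CT (CTiter i v)

  carlitzFrom : ℕ → Pol → Pol → Pol
  carlitzFrom i []       u = []
  carlitzFrom i (x ∷ xs) u = (x • CTiter i u) ⊕ carlitzFrom (suc i) xs u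

  C : Pol → Pol → Pol
  C a u = carlitzFrom 0 a u

  Zsigmondy : Pol → Pol → Pol → Set
  Zsigmondy u m ℘ =
    MonicPrime ℘ × ℘ ∣ C m u
    × (∀ n → ¬ IsZero n → deg n ℕ.< deg m → ¬ (℘ ∣ C n u))

  LargeZsigmondy : Pol → Pol → Pol → Set
  LargeZsigmondy u m ℘ =
    Zsigmondy u m ℘ × (deg m ℕ.< deg ℘ ⊎ ℘ ⊗ ℘ ∣ C m u)

  2# 3# 4# : F
  2# = 1# + 1#
  3# = 2# + 1#
  4# = 3# + 1#

  T+ : F → Pol
  T+ c = T ⊕ ‵ c

  DegOneMonicPrime : Pol → Set
  DegOneMonicPrime p = MonicPrime p × deg p ≡ 1

  EC-I EC-II EC-III EC-IV EC-V EC-VI EC-VII EC-VIII EC-IX :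
    Pol → Pol → Set

  EC-I m u = card ≡ 3 × u ≈ 𝟙
    × ∃ λ ℘ → DegOneMonicPrime ℘ × m ≈ (℘ ⊖ 𝟙) ⊗ ℘

  EC-II m u = card ≡ 4 × u ≈ 𝟙
    × ∃ λ ℘ → DegOneMonicPrime ℘ × m ≈ (℘ ⊖ 𝟙) ⊗ ℘

  EC-III m u = card ≡ 3 × u ≈ 𝟙
    × (m ≈ (T ⊖ 𝟙) ⊗ (T ^ 2)
       ⊎ m ≈ T ⊗ (T+ 1# ^ 2)
       ⊎ m ≈ T+ 1# ⊗ (T+ 2# ^ 2))

  EC-IV m u = card ≡ 3 × u ≈ m
    × (m ≈ T ⊎ m ≈ T+ 1# ⊎ m ≈ T+ 2#)

  EC-V m u = card ≡ 5 × u ≈ 𝟙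
    × (m ≈ T ⊗ T+ 1#
       ⊎ m ≈ T+ 1# ⊗ T+ 2#
       ⊎ m ≈ T+ 2# ⊗ T+ 3#
       ⊎ m ≈ T+ 3# ⊗ T+ 4#
       ⊎ m ≈ T+ 4# ⊗ T)

  EC-VI m u = u ≈ 𝟙 × DegOneMonicPrime m

  EC-VII m u = card ≡ 3 × u ≈ 𝟙
    × (m ≈ T ^ 2 ⊎ m ≈ T+ 1# ^ 2 ⊎ m ≈ T+ 2# ^ 2)

  EC-VIII m u = card ≡ 4 × u ≈ 𝟙
    × ∃ λ w → (w * w + w + 1# ≡ 0#)
      × (m ≈ T ⊗ T+ w
         ⊎ m ≈ T ⊗ T+ (w * w)
         ⊎ m ≈ T+ 1# ⊗ T+ w
         ⊎ m ≈ T+ 1# ⊗ T+ (w * w))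

  EC-IX m u = card ≡ 3 × u ≈ 𝟙
    × m ≈ (T ^ 3) ⊕ (2# • T)

  Exceptional : Pol → Pol → Set
  Exceptional m u =
    EC-I m u ⊎ EC-II m u ⊎ EC-III m u ⊎ EC-IV m u ⊎ EC-V m u
    ⊎ EC-VI m u ⊎ EC-VII m u ⊎ EC-VIII m u ⊎ EC-IX m u

{-# OPTIONS --safe #-}
module Submission where

-- Let Q be the quotient of C_m(u) by the least common multiple of the C_{m/π}(u), π a prime divisor of m.  Modulo a
-- prime ℘ | Q with m = a ℘^k and ℘ ∤ a, the order of u in the Carlitz module is exactly a, so a divides ℘ - 1.  If
-- k = 0 then ℘ is a Zsigmondy prime and deg ℘ ≥ deg m, with equality only for ℘ = m + 1; if k > 0 then ℘² ∤ Q.  Hence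
-- without a large Zsigmondy prime Q divides (m + 1) R, where R is a product of distinct primes ℘ with k > 0, so
-- deg Q ≤ 2 deg m.  Inclusion-exclusion gives deg Q = deg u · φ(m), or (φ(m) - μ(m)) / q if u = 1, where φ(m) is the
-- number of units modulo m, and φ(m) ≥ (q - 1)^(deg m) leaves only q ≤ 6 with deg m ≤ 4, besides deg m ≤ 1.  There,
-- a | ℘ - 1 restricts R enough to leave exactly the exceptional cases, for which C_m(u) is factored explicitly.

open import Level using (0ℓ)
open import Algebra.Bundles using (CommutativeMonoid; CommutativeRing)
import Algebra.Definitions.RawMonoid
import Algebra.Properties.CommutativeMonoid.Sum
import Algebra.Properties.Monoid.Mult
import Algebra.Properties.Ring
import Algebra.Properties.Semiring.Mult
import Algebra.Solver.Ring
open import Algebra.Solver.Ring.AlmostCommutativeRing using (_-Raw-AlmostCommutative⟶_; fromCommutativeRing)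
open import Algebra.Structures using (IsCommutativeRing)
open import Data.Bool using (Bool; true; false; _∧_; _∨_) renaming (T to True)
open import Data.Fin using (Fin; zero; suc; toℕ; remQuot; punchIn; inject≤; combine)
open import Data.Fin.Patterns using (0F; 1F; 2F; 3F; 4F)
import Data.Fin.Properties as FinP
import Data.Integer as ℤ
import Data.Integer.Properties as ℤP
open import Data.List using (List; []; _∷_; _∷ʳ_; length; reverse)
open import Data.List.Membership.Propositional using (_∈_)
import Data.List.Properties as ListP
open import Data.List.Relation.Unary.All using (All; []; _∷_)
open import Data.List.Relation.Unary.Any using (here; there)
open import Data.List.Reverse using (Reverse; reverseView; _∶_∶ʳ_) renaming ([] to []ʳ)
open import Data.Maybe using (Maybe; just; nothing)
open import Data.Maybe.Properties using (just-injective)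
open import Data.Nat as ℕ using (ℕ; zero; suc; pred; _≤_; _<_; z≤n; s≤s; _<ᵇ_; _≡ᵇ_)
import Data.Nat.ListAction as ℕL
import Data.Nat.Properties as ℕP
import Data.Nat.Solver
open import Data.Product using (Σ; ∃; ∃₂; _×_; _,_; proj₁; proj₂; uncurry)
open import Data.Sum using (_⊎_; inj₁; inj₂; [_,_]′)
open import Data.Unit using (⊤; tt)
open import Data.Vec.Functional using (removeAt)
open import Data.Vec.N-ary using (N-ary; Eq; Eqʰ; curryⁿ)
open import Function.Bundles using (_⇔_; mk⇔; Inverse; mk↔ₛ′)
open import Relation.Binary using (tri<; tri≈; tri>)
open import Relation.Binary.PropositionalEquality using
    (_≡_; refl; sym; trans; cong; cong₂; subst; module ≡-Reasoning)
open import Relation.Binary.PropositionalEquality.Properties using (subst-injective)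
import Relation.Binary.Reasoning.Setoid
import Relation.Binary.Reflection
open import Relation.Nullary using (¬_; Dec; yes; no; contradiction)
import Relation.Nullary.Decidable as Dec

open import Defs

-- The field is given through its cardinality q alone; neither its characteristic nor the shape of q
-- is at hand. Additivity of the q-th power, Fermat's theorem modulo a prime ℘ and C_℘(v) ≡ v modulo
-- ℘ are therefore obtained by counting roots, and q = 6 has to be treated like any other
-- cardinality. The condition q > 2 gives v^q ≡ 0 and hence C_a(v) ≡ a v modulo v^3. For a prime ρ
-- of m and w = C_(m/ρ)(u) this means C_m(u) = w (ρ + w^2 s), and Q divides the second factor. So a
-- prime of Q that divides w also divides ρ, which pins down the order of u; and for ρ = ℘ that
-- factor is ℘ modulo ℘^2, so ℘ divides Q only once. Q plays the role of a cyclotomic value. As a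
-- quotient by a least common multiple it lies in A from the start, and its degree is found one
-- prime of m at a time, because coprime indices π, ρ satisfy gcd(C_(gπs)(u), C_(gρs)(u)) |
-- C_(gs)(u). The choice R = m already settles almost every case; R is sharpened only for the few
-- degree patterns that remain.

private module NS = Data.Nat.Solver.+-*-Solver

-- A ring solver with integer coefficients.

module IntegerSolver (R : CommutativeRing 0ℓ 0ℓ) where
  open CommutativeRing R hiding (refl; sym; trans)
  private module ≈ = CommutativeRing R using (refl; sym; trans)
  open ℤ using (ℤ; +_; -[1+_])
  open Algebra.Properties.Ring ring
  open Algebra.Properties.Semiring.Mult semiring using (×-homo-+; ×1-homo-*) renaming (_×_ to _×ℕ_)
  open Relation.Binary.Reasoning.Setoid setoid

  private
    -- The separate clause for 1 and the addition of 1 on the right make the numerals compute to 1,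
    -- 1 + 1, (1 + 1) + 1, the form in which `2#`, `3#`, ... are defined.
    nat : ℕ → Carrier
    nat zero = 0#
    nat (suc zero) = 1#
    nat (suc (suc n)) = nat (suc n) + 1#

    ⟦_⟧ : ℤ → Carrier
    ⟦ + n ⟧ = nat n
    ⟦ -[1+ n ] ⟧ = - nat (suc n)

    ⟦⟧-× : ∀ n → ⟦ + n ⟧ ≈ n ×ℕ 1#
    ⟦⟧-× zero = ≈.refl
    ⟦⟧-× (suc zero) = ≈.sym (+-identityʳ 1#)
    ⟦⟧-× (suc (suc n)) = ≈.trans (+-comm _ 1#) (+-congˡ (⟦⟧-× (suc n)))

    ⟦⟧-suc : ∀ n → ⟦ + suc n ⟧ ≈ 1# + ⟦ + n ⟧
    ⟦⟧-suc zero = ≈.sym (+-identityʳ 1#)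
    ⟦⟧-suc (suc n) = +-comm _ 1#

    ⟦⟧-+ : ∀ m n → ⟦ + (m ℕ.+ n) ⟧ ≈ ⟦ + m ⟧ + ⟦ + n ⟧
    ⟦⟧-+ m n = begin
      ⟦ + (m ℕ.+ n) ⟧      ≈⟨ ⟦⟧-× (m ℕ.+ n) ⟩
      (m ℕ.+ n) ×ℕ 1#       ≈⟨ ×-homo-+ 1# m n ⟩
      m ×ℕ 1# + n ×ℕ 1#      ≈⟨ +-cong (⟦⟧-× m) (⟦⟧-× n) ⟨
      ⟦ + m ⟧ + ⟦ + n ⟧    ∎

    ⟦⟧-* : ∀ m n → ⟦ + (m ℕ.* n) ⟧ ≈ ⟦ + m ⟧ * ⟦ + n ⟧
    ⟦⟧-* m n = begin
      ⟦ + (m ℕ.* n) ⟧        ≈⟨ ⟦⟧-× (m ℕ.* n) ⟩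
      (m ℕ.* n) ×ℕ 1#         ≈⟨ ×1-homo-* m n ⟩
      (m ×ℕ 1#) * (n ×ℕ 1#)    ≈⟨ *-cong (⟦⟧-× m) (⟦⟧-× n) ⟨
      ⟦ + m ⟧ * ⟦ + n ⟧      ∎

    cancel-suc : ∀ a b → a - b ≈ (1# + a) - (1# + b)
    cancel-suc a b = ≈.sym (begin
      (1# + a) - (1# + b)          ≈⟨ +-congˡ (-‿anti-homo-+ 1# b) ⟩
      (1# + a) + (- b - 1#)        ≈⟨ +-cong (+-comm 1# a) (+-comm (- b) (- 1#)) ⟩
      (a + 1#) + (- 1# - b)        ≈⟨ +-assoc a 1# _ ⟩
      a + (1# + (- 1# - b))        ≈⟨ +-congˡ (+-assoc 1# (- 1#) (- b)) ⟨
      a + ((1# - 1#) - b)          ≈⟨ +-congˡ (+-congʳ (-‿inverseʳ 1#)) ⟩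
      a + (0# - b)                 ≈⟨ +-congˡ (+-identityˡ (- b)) ⟩
      a - b                        ∎)

    ⟦⟧-⊖ : ∀ m n → ⟦ m ℤ.⊖ n ⟧ ≈ ⟦ + m ⟧ - ⟦ + n ⟧
    ⟦⟧-⊖ m zero = ≈.sym (≈.trans (+-congˡ -0#≈0#) (+-identityʳ _))
    ⟦⟧-⊖ zero (suc n) = ≈.sym (+-identityˡ _)
    ⟦⟧-⊖ (suc m) (suc n) = begin
      ⟦ suc m ℤ.⊖ suc n ⟧               ≡⟨ cong ⟦_⟧ (ℤP.[1+m]⊖[1+n]≡m⊖n m n) ⟩
      ⟦ m ℤ.⊖ n ⟧                       ≈⟨ ⟦⟧-⊖ m n ⟩
      ⟦ + m ⟧ - ⟦ + n ⟧                 ≈⟨ cancel-suc _ _ ⟩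
      (1# + ⟦ + m ⟧) - (1# + ⟦ + n ⟧)   ≈⟨ +-cong (⟦⟧-suc m) (-‿cong (⟦⟧-suc n)) ⟨
      ⟦ + suc m ⟧ - ⟦ + suc n ⟧         ∎

    -‿homo′ : ∀ i → ⟦ ℤ.- i ⟧ ≈ - ⟦ i ⟧
    -‿homo′ (+ zero) = ≈.sym -0#≈0#
    -‿homo′ (+ suc n) = ≈.refl
    -‿homo′ -[1+ n ] = ≈.sym (-‿involutive _)

    +-homo′ : ∀ i j → ⟦ i ℤ.+ j ⟧ ≈ ⟦ i ⟧ + ⟦ j ⟧
    +-homo′ (+ m) (+ n) = ⟦⟧-+ m n
    +-homo′ (+ m) -[1+ n ] = ⟦⟧-⊖ m (suc n)
    +-homo′ -[1+ m ] (+ n) = ≈.trans (⟦⟧-⊖ n (suc m)) (+-comm _ _)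
    +-homo′ -[1+ m ] -[1+ n ] = begin
      - ⟦ + suc (suc (m ℕ.+ n)) ⟧           ≡⟨ cong (λ k → - ⟦ + suc k ⟧) (sym (ℕP.+-suc m n)) ⟩
      - ⟦ + (suc m ℕ.+ suc n) ⟧             ≈⟨ -‿cong (⟦⟧-+ (suc m) (suc n)) ⟩
      - (⟦ + suc m ⟧ + ⟦ + suc n ⟧)         ≈⟨ -‿+-comm _ _ ⟨
      - ⟦ + suc m ⟧ - ⟦ + suc n ⟧           ∎

    *-homo⁺ : ∀ m j → ⟦ + m ℤ.* j ⟧ ≈ ⟦ + m ⟧ * ⟦ j ⟧
    *-homo⁺ m (+ n) = ≈.trans (reflexive (cong ⟦_⟧ (sym (ℤP.pos-* m n)))) (⟦⟧-* m n)
    *-homo⁺ m -[1+ n ] = begin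
      ⟦ + m ℤ.* (ℤ.- + suc n) ⟧    ≡⟨ cong ⟦_⟧ (ℤP.neg-distribʳ-* (+ m) (+ suc n)) ⟨
      ⟦ ℤ.- (+ m ℤ.* + suc n) ⟧    ≈⟨ -‿homo′ (+ m ℤ.* + suc n) ⟩
      - ⟦ + m ℤ.* + suc n ⟧        ≈⟨ -‿cong (*-homo⁺ m (+ suc n)) ⟩
      - (⟦ + m ⟧ * ⟦ + suc n ⟧)    ≈⟨ -‿distribʳ-* _ _ ⟩
      ⟦ + m ⟧ * - ⟦ + suc n ⟧      ∎

    *-homo′ : ∀ i j → ⟦ i ℤ.* j ⟧ ≈ ⟦ i ⟧ * ⟦ j ⟧
    *-homo′ (+ m) j = *-homo⁺ m j
    *-homo′ -[1+ m ] j = begin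
      ⟦ (ℤ.- + suc m) ℤ.* j ⟧      ≡⟨ cong ⟦_⟧ (ℤP.neg-distribˡ-* (+ suc m) j) ⟨
      ⟦ ℤ.- (+ suc m ℤ.* j) ⟧      ≈⟨ -‿homo′ (+ suc m ℤ.* j) ⟩
      - ⟦ + suc m ℤ.* j ⟧          ≈⟨ -‿cong (*-homo⁺ (suc m) j) ⟩
      - (⟦ + suc m ⟧ * ⟦ j ⟧)      ≈⟨ -‿distribˡ-* _ _ ⟩
      - ⟦ + suc m ⟧ * ⟦ j ⟧        ∎

    morphism : CommutativeRing.rawRing ℤP.+-*-commutativeRing
               -Raw-AlmostCommutative⟶ fromCommutativeRing R
    morphism = record
      { ⟦_⟧ = ⟦_⟧ ; +-homo = +-homo′ ; *-homo = *-homo′ ; -‿homo = -‿homo′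
      ; 0-homo = ≈.refl ; 1-homo = ≈.refl }

    _coeff≟_ : ∀ i j → Maybe (⟦ i ⟧ ≈ ⟦ j ⟧)
    i coeff≟ j with i ℤP.≟ j
    ... | yes refl = just ≈.refl
    ... | no _ = nothing

  private
    module Solver = Algebra.Solver.Ring _ _ morphism _coeff≟_
    module Tactic = Relation.Binary.Reflection setoid Solver.var Solver.⟦_⟧ Solver.⟦_⟧↓ Solver.correct

  open Solver public using (_:=_; _:+_; _:*_; _:-_; :-_)

  num : ∀ {n} → ℕ → Solver.Polynomial n
  num k = Solver.con (+ k)

  -- Opaque, because the proof terms that the solver produces are large and with-abstraction normalises them.
  opaque
    solve : ∀ n (f : N-ary n (Solver.Polynomial n) (Solver.Polynomial n × Solver.Polynomial n)) →
      Eqʰ n _≈_ (curryⁿ Solver.⟦ proj₁ (Tactic.close n f) ⟧↓) (curryⁿ Solver.⟦ proj₂ (Tactic.close n f) ⟧↓) →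
      Eq n _≈_ (curryⁿ Solver.⟦ proj₁ (Tactic.close n f) ⟧) (curryⁿ Solver.⟦ proj₂ (Tactic.close n f) ⟧)
    solve = Tactic.solve

-- The polynomial ring A over the field.

module FieldRing (𝔽 : FiniteField) where
  open FiniteField 𝔽 public using (F; 0#; 1#; isCommutativeRing)
  open FiniteField 𝔽 using (inverse) renaming (_*_ to _*F_)

  𝔽ring : CommutativeRing 0ℓ 0ℓ
  𝔽ring = record { isCommutativeRing = isCommutativeRing }

  module K where
    open CommutativeRing 𝔽ring public hiding (refl; sym; trans; isCommutativeRing; 0#; 1#)
    open Algebra.Properties.Ring ring public
    open IntegerSolver 𝔽ring public

  nonzero-* : ∀ {x y : F} → ¬ x ≡ 0# → ¬ y ≡ 0# → ¬ x *F y ≡ 0#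
  nonzero-* {x} {y} x≢0 y≢0 xy≡0 with inverse x x≢0
  ... | z , xz≡1 = y≢0 (begin
    y              ≡⟨ K.*-identityˡ y ⟨
    1# K.* y       ≡⟨ cong (K._* y) xz≡1 ⟨
    x K.* z K.* y  ≡⟨ solve 3 (λ x z y → x :* z :* y := z :* (x :* y)) refl x z y ⟩
    z K.* (x K.* y) ≡⟨ cong (z K.*_) xy≡0 ⟩
    z K.* 0#       ≡⟨ K.zeroʳ z ⟩
    0#             ∎)
    where open ≡-Reasoning
          open K using (solve; _:=_; _:*_)

module CoefficientLists (𝔽 : FiniteField) where
  open FieldRing 𝔽 public
  open FiniteField 𝔽 using (_+_; _*_; -_)
  open Poly 𝔽 renaming (_≈_ to _≈ᶜ_; _∣_ to _∣ᶜ_)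

  infix 4 _≈_
  -- The bare coefficientwise equality unfolds to a function type from which `p` and `r` cannot be
  -- inferred; the record keeps them visible.
  record _≈_ (p r : Pol) : Set where
    constructor coeffwise
    field at : p ≈ᶜ r
  open _≈_ public

  ≈-refl : ∀ {p} → p ≈ p
  at ≈-refl i = refl

  ≈-sym : ∀ {p r} → p ≈ r → r ≈ p
  at (≈-sym e) i = sym (at e i)

  ≈-trans : ∀ {p r s} → p ≈ r → r ≈ s → p ≈ s
  at (≈-trans e f) i = trans (at e i) (at f i)

  ∷-cong : ∀ {x y p r} → x ≡ y → p ≈ r → (x ∷ p) ≈ (y ∷ r)
  at (∷-cong x≡y e) zero    = x≡y
  at (∷-cong x≡y e) (suc i) = at e i

  0∷[]≈[] : ∀ {p} → p ≈ [] → (0# ∷ p) ≈ []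
  at (0∷[]≈[] e) zero    = refl
  at (0∷[]≈[] e) (suc i) = at e i

  coeff-⊕ : ∀ p r i → coeff (p ⊕ r) i ≡ coeff p i + coeff r i
  coeff-⊕ []       r        i       = sym (K.+-identityˡ _)
  coeff-⊕ (x ∷ p)  []       i       = sym (K.+-identityʳ _)
  coeff-⊕ (x ∷ p)  (y ∷ r)  zero    = refl
  coeff-⊕ (x ∷ p)  (y ∷ r)  (suc i) = coeff-⊕ p r i

  coeff-• : ∀ c p i → coeff (c • p) i ≡ c * coeff p i
  coeff-• c []      i       = sym (K.zeroʳ c)
  coeff-• c (x ∷ p) zero    = refl
  coeff-• c (x ∷ p) (suc i) = coeff-• c p i

  coeff-⊝ : ∀ p i → coeff (⊝ p) i ≡ - coeff p i
  coeff-⊝ p i = trans (coeff-• _ p i) (K.-1*x≈-x _)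

  coeff-⊖ : ∀ p r i → coeff (p ⊖ r) i ≡ coeff p i + - coeff r i
  coeff-⊖ p r i = trans (coeff-⊕ p (⊝ r) i) (cong (coeff p i +_) (coeff-⊝ r i))

  ⊕-cong : ∀ {p p′ r r′} → p ≈ p′ → r ≈ r′ → (p ⊕ r) ≈ (p′ ⊕ r′)
  at (⊕-cong {p} {p′} {r} {r′} e f) i = begin
    coeff (p ⊕ r) i          ≡⟨ coeff-⊕ p r i ⟩
    coeff p i + coeff r i    ≡⟨ cong₂ _+_ (at e i) (at f i) ⟩
    coeff p′ i + coeff r′ i  ≡⟨ coeff-⊕ p′ r′ i ⟨
    coeff (p′ ⊕ r′) i        ∎
    where open ≡-Reasoning

  •-cong : ∀ {c d p r} → c ≡ d → p ≈ r → (c • p) ≈ (d • r)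
  at (•-cong {c} {d} {p} {r} e f) i =
    trans (coeff-• c p i) (trans (cong₂ _*_ e (at f i)) (sym (coeff-• d r i)))

  ⊕-comm : ∀ p r → (p ⊕ r) ≈ (r ⊕ p)
  at (⊕-comm p r) i = trans (coeff-⊕ p r i) (trans (K.+-comm _ _) (sym (coeff-⊕ r p i)))

  ⊕-assoc : ∀ p r s → ((p ⊕ r) ⊕ s) ≈ (p ⊕ (r ⊕ s))
  at (⊕-assoc p r s) i = begin
    coeff ((p ⊕ r) ⊕ s) i                 ≡⟨ coeff-⊕ (p ⊕ r) s i ⟩
    coeff (p ⊕ r) i + coeff s i           ≡⟨ cong (_+ coeff s i) (coeff-⊕ p r i) ⟩
    coeff p i + coeff r i + coeff s i     ≡⟨ K.+-assoc _ _ _ ⟩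
    coeff p i + (coeff r i + coeff s i)   ≡⟨ cong (coeff p i +_) (coeff-⊕ r s i) ⟨
    coeff p i + coeff (r ⊕ s) i           ≡⟨ coeff-⊕ p (r ⊕ s) i ⟨
    coeff (p ⊕ (r ⊕ s)) i                 ∎
    where open ≡-Reasoning

  ⊕-identityʳ : ∀ p → (p ⊕ []) ≈ p
  at (⊕-identityʳ p) i = trans (coeff-⊕ p [] i) (K.+-identityʳ _)

  ⊝-cong : ∀ {p r} → p ≈ r → (⊝ p) ≈ (⊝ r)
  ⊝-cong = •-cong refl

  ⊝-inverseʳ : ∀ p → (p ⊕ (⊝ p)) ≈ []
  at (⊝-inverseʳ p) i = trans (coeff-⊖ p p i) (K.-‿inverseʳ _)

  ⊝-inverseˡ : ∀ p → ((⊝ p) ⊕ p) ≈ []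
  ⊝-inverseˡ p = ≈-trans (⊕-comm (⊝ p) p) (⊝-inverseʳ p)

  •-distrib-⊕ : ∀ c p r → (c • (p ⊕ r)) ≈ ((c • p) ⊕ (c • r))
  at (•-distrib-⊕ c p r) i = begin
    coeff (c • (p ⊕ r)) i               ≡⟨ coeff-• c (p ⊕ r) i ⟩
    c * coeff (p ⊕ r) i                 ≡⟨ cong (c *_) (coeff-⊕ p r i) ⟩
    c * (coeff p i + coeff r i)         ≡⟨ K.distribˡ c _ _ ⟩
    c * coeff p i + c * coeff r i       ≡⟨ cong₂ _+_ (coeff-• c p i) (coeff-• c r i) ⟨
    coeff (c • p) i + coeff (c • r) i   ≡⟨ coeff-⊕ (c • p) (c • r) i ⟨
    coeff ((c • p) ⊕ (c • r)) i         ∎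
    where open ≡-Reasoning

  +-distrib-• : ∀ c d p → ((c + d) • p) ≈ ((c • p) ⊕ (d • p))
  at (+-distrib-• c d p) i = begin
    coeff ((c + d) • p) i               ≡⟨ coeff-• (c + d) p i ⟩
    (c + d) * coeff p i                 ≡⟨ K.distribʳ _ c d ⟩
    c * coeff p i + d * coeff p i       ≡⟨ cong₂ _+_ (coeff-• c p i) (coeff-• d p i) ⟨
    coeff (c • p) i + coeff (d • p) i   ≡⟨ coeff-⊕ (c • p) (d • p) i ⟨
    coeff ((c • p) ⊕ (d • p)) i         ∎
    where open ≡-Reasoning

  *-assoc-• : ∀ c d p → ((c * d) • p) ≈ (c • (d • p))
  at (*-assoc-• c d p) i = begin
    coeff ((c * d) • p) i   ≡⟨ coeff-• (c * d) p i ⟩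
    c * d * coeff p i       ≡⟨ K.*-assoc c d _ ⟩
    c * (d * coeff p i)     ≡⟨ cong (c *_) (coeff-• d p i) ⟨
    c * coeff (d • p) i     ≡⟨ coeff-• c (d • p) i ⟨
    coeff (c • (d • p)) i   ∎
    where open ≡-Reasoning

  1-• : ∀ p → (1# • p) ≈ p
  at (1-• p) i = trans (coeff-• 1# p i) (K.*-identityˡ _)

  0-• : ∀ p → (0# • p) ≈ []
  at (0-• p) i = trans (coeff-• 0# p i) (K.zeroˡ _)

  private
    ⊕-interchange : ∀ a b c d → ((a ⊕ b) ⊕ (c ⊕ d)) ≈ ((a ⊕ c) ⊕ (b ⊕ d))
    ⊕-interchange a b c d =
      ≈-trans (⊕-assoc a b (c ⊕ d)) (≈-trans (⊕-cong (≈-refl {a}) lemma) (≈-sym (⊕-assoc a c (b ⊕ d))))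
      where
      lemma : (b ⊕ (c ⊕ d)) ≈ (c ⊕ (b ⊕ d))
      lemma = ≈-trans (≈-sym (⊕-assoc b c d)) (≈-trans (⊕-cong (⊕-comm b c) (≈-refl {d})) (⊕-assoc c b d))

  ⊗-congʳ : ∀ p {r s} → r ≈ s → (p ⊗ r) ≈ (p ⊗ s)
  ⊗-congʳ []      e = ≈-refl
  ⊗-congʳ (x ∷ p) e = ⊕-cong (•-cong refl e) (∷-cong refl (⊗-congʳ p e))

  ⊗-zeroʳ : ∀ p → (p ⊗ []) ≈ []
  ⊗-zeroʳ []      = ≈-refl
  ⊗-zeroʳ (x ∷ p) = 0∷[]≈[] (⊗-zeroʳ p)

  -- The mirror image of the defining clause of the product; commutativity is then a plain
  -- induction.
  ⊗-∷ʳ : ∀ p y r → (p ⊗ (y ∷ r)) ≈ ((y • p) ⊕ (0# ∷ (p ⊗ r)))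
  ⊗-∷ʳ []      y r = ≈-sym (0∷[]≈[] ≈-refl)
  ⊗-∷ʳ (x ∷ p) y r = ∷-cong (cong (_+ 0#) (K.*-comm x y))
    (≈-trans (⊕-cong (≈-refl {x • r}) (⊗-∷ʳ p y r))
    (≈-trans (≈-sym (⊕-assoc (x • r) (y • p) _))
    (≈-trans (⊕-cong (⊕-comm (x • r) (y • p)) ≈-refl)
             (⊕-assoc (y • p) (x • r) _))))

  ⊗-comm : ∀ p r → (p ⊗ r) ≈ (r ⊗ p)
  ⊗-comm []      r = ≈-sym (⊗-zeroʳ r)
  ⊗-comm (x ∷ p) r = ≈-trans
    (⊕-cong (≈-refl {x • r}) (∷-cong refl (⊗-comm p r))) (≈-sym (⊗-∷ʳ r x p))

  ⊗-cong : ∀ {p p′ r r′} → p ≈ p′ → r ≈ r′ → (p ⊗ r) ≈ (p′ ⊗ r′)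
  ⊗-cong {p} {p′} {r} {r′} e f = ≈-trans (⊗-congʳ p f)
    (≈-trans (⊗-comm p r′) (≈-trans (⊗-congʳ r′ e) (⊗-comm r′ p′)))

  ⊗-distribˡ : ∀ p r s → (p ⊗ (r ⊕ s)) ≈ ((p ⊗ r) ⊕ (p ⊗ s))
  ⊗-distribˡ []      r s = ≈-refl
  ⊗-distribˡ (x ∷ p) r s = ≈-trans
    (⊕-cong (•-distrib-⊕ x r s)
            (≈-trans (∷-cong (sym (K.+-identityʳ 0#)) (⊗-distribˡ p r s)) ≈-refl))
    (⊕-interchange (x • r) (x • s) (0# ∷ (p ⊗ r)) (0# ∷ (p ⊗ s)))

  ⊗-distribʳ : ∀ p r s → ((r ⊕ s) ⊗ p) ≈ ((r ⊗ p) ⊕ (s ⊗ p))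
  ⊗-distribʳ p r s = ≈-trans (⊗-comm (r ⊕ s) p)
    (≈-trans (⊗-distribˡ p r s) (⊕-cong (⊗-comm p r) (⊗-comm p s)))

  •-⊗-assoc : ∀ c p r → ((c • p) ⊗ r) ≈ (c • (p ⊗ r))
  •-⊗-assoc c []      r = ≈-refl
  •-⊗-assoc c (x ∷ p) r = ≈-trans
    (⊕-cong (*-assoc-• c x r) (∷-cong (sym (K.zeroʳ c)) (•-⊗-assoc c p r)))
    (≈-sym (•-distrib-⊕ c (x • r) (0# ∷ (p ⊗ r))))

  shift-⊗ : ∀ p r → ((0# ∷ p) ⊗ r) ≈ (0# ∷ (p ⊗ r))
  shift-⊗ p r = ⊕-cong (0-• r) (≈-refl {0# ∷ (p ⊗ r)})

  ⊗-assoc : ∀ p r s → ((p ⊗ r) ⊗ s) ≈ (p ⊗ (r ⊗ s))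
  ⊗-assoc []      r s = ≈-refl
  ⊗-assoc (x ∷ p) r s = ≈-trans (⊗-distribʳ s (x • r) (0# ∷ (p ⊗ r)))
    (⊕-cong (•-⊗-assoc x r s) (≈-trans (shift-⊗ (p ⊗ r) s) (∷-cong refl (⊗-assoc p r s))))

  ‵-⊗ : ∀ c p → (‵ c ⊗ p) ≈ (c • p)
  ‵-⊗ c p = ≈-trans (⊕-cong (≈-refl {c • p}) (0∷[]≈[] (≈-refl {[]}))) (⊕-identityʳ (c • p))

  ⊗-identityˡ : ∀ p → (𝟙 ⊗ p) ≈ p
  ⊗-identityˡ p = ≈-trans (‵-⊗ 1# p) (1-• p)

  T-⊗ : ∀ p → (T ⊗ p) ≈ (0# ∷ p)
  T-⊗ p = ≈-trans (shift-⊗ 𝟙 p) (∷-cong refl (⊗-identityˡ p))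

  ∷-split : ∀ c p → (c ∷ p) ≈ (‵ c ⊕ (T ⊗ p))
  ∷-split c p = ≈-sym (≈-trans (⊕-cong (≈-refl {‵ c}) (T-⊗ p)) (∷-cong (K.+-identityʳ c) ≈-refl))

  isCommutativeRing-Pol : IsCommutativeRing _≈_ _⊕_ _⊗_ ⊝_ [] 𝟙
  isCommutativeRing-Pol = record
    { isRing = record
      { +-isAbelianGroup = record
        { isGroup = record
          { isMonoid = record
            { isSemigroup = record
              { isMagma = record
                { isEquivalence = record
                  { refl = ≈-refl ; sym = ≈-sym ; trans = ≈-trans }
                ; ∙-cong = ⊕-cong }
              ; assoc = ⊕-assoc }
            ; identity = (λ p → ≈-refl) , ⊕-identityʳ }
          ; inverse = ⊝-inverseˡ , ⊝-inverseʳ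
          ; ⁻¹-cong = ⊝-cong }
        ; comm = ⊕-comm }
      ; *-cong = ⊗-cong
      ; *-assoc = ⊗-assoc
      ; *-identity = ⊗-identityˡ , λ p → ≈-trans (⊗-comm p 𝟙) (⊗-identityˡ p)
      ; distrib = ⊗-distribˡ , ⊗-distribʳ }
    ; *-comm = ⊗-comm }

module PolynomialRing (𝔽 : FiniteField) where
  open FieldRing 𝔽 public
  open FiniteField 𝔽 using (_+_; _*_; -_)
  private
    module D = Poly 𝔽
    module L = CoefficientLists 𝔽
  open D public using (Pol; coeff; ‵; 𝟙; T)
  open L public using (_≈_; coeffwise; at; ≈-refl; ≈-sym; ≈-trans; ∷-cong; 0∷[]≈[])

  infixl 6 _⊕_ _⊖_
  infixl 7 _⊗_ _•_

  -- Opaque copies of the operations: unification then treats them as injective.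
  opaque
    _⊕_ _⊗_ : Pol → Pol → Pol
    _⊕_ = D._⊕_
    _⊗_ = D._⊗_

    ⊝_ : Pol → Pol
    ⊝_ = D.⊝_

    _•_ : F → Pol → Pol
    _•_ = D._•_

  _⊖_ : Pol → Pol → Pol
  p ⊖ r = p ⊕ (⊝ r)

  opaque
    unfolding _⊕_ _⊗_ ⊝_ _•_

    ⊕-def : ∀ p r → p ⊕ r ≡ p D.⊕ r
    ⊕-def p r = refl

    ⊗-def : ∀ p r → p ⊗ r ≡ p D.⊗ r
    ⊗-def p r = refl

    •-def : ∀ c p → c • p ≡ c D.• p
    •-def c p = refl

    isCommutativeRing-A : IsCommutativeRing _≈_ _⊕_ _⊗_ ⊝_ [] 𝟙
    isCommutativeRing-A = L.isCommutativeRing-Pol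

    coeff-⊕ : ∀ p r i → coeff (p ⊕ r) i ≡ coeff p i + coeff r i
    coeff-⊕ = L.coeff-⊕

    coeff-• : ∀ c p i → coeff (c • p) i ≡ c * coeff p i
    coeff-• = L.coeff-•

    coeff-⊖ : ∀ p r i → coeff (p ⊖ r) i ≡ coeff p i + - coeff r i
    coeff-⊖ = L.coeff-⊖

    ‵-⊗ : ∀ c p → ‵ c ⊗ p ≈ c • p
    ‵-⊗ = L.‵-⊗

    T-⊗ : ∀ p → T ⊗ p ≈ 0# ∷ p
    T-⊗ = L.T-⊗

    ∷-split : ∀ c p → c ∷ p ≈ ‵ c ⊕ T ⊗ p
    ∷-split = L.∷-split

    ∷-⊗ : ∀ c p r → (c ∷ p) ⊗ r ≈ c • r ⊕ (0# ∷ p ⊗ r)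
    ∷-⊗ c p r = ≈-refl

  polynomialRing : CommutativeRing 0ℓ 0ℓ
  polynomialRing = record { isCommutativeRing = isCommutativeRing-A }

  module A where
    open CommutativeRing polynomialRing public
    open Algebra.Properties.Ring ring public
    open IntegerSolver polynomialRing public

  module ≈-Reasoning = Relation.Binary.Reasoning.Setoid A.setoid

  ⊕-cong : ∀ {p p′ r r′} → p ≈ p′ → r ≈ r′ → p ⊕ r ≈ p′ ⊕ r′
  ⊕-cong = A.+-cong

  ⊕-congˡ : ∀ {p r r′} → r ≈ r′ → p ⊕ r ≈ p ⊕ r′
  ⊕-congˡ = A.+-cong ≈-refl

  ⊕-congʳ : ∀ {p p′ r} → p ≈ p′ → p ⊕ r ≈ p′ ⊕ r
  ⊕-congʳ e = A.+-cong e ≈-refl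

  ⊗-cong : ∀ {p p′ r r′} → p ≈ p′ → r ≈ r′ → p ⊗ r ≈ p′ ⊗ r′
  ⊗-cong = A.*-cong

  ⊗-congˡ : ∀ {p r r′} → r ≈ r′ → p ⊗ r ≈ p ⊗ r′
  ⊗-congˡ = A.*-cong ≈-refl

  ⊗-congʳ : ∀ {p p′ r} → p ≈ p′ → p ⊗ r ≈ p′ ⊗ r
  ⊗-congʳ e = A.*-cong e ≈-refl

  ⊖-cong : ∀ {p p′ r r′} → p ≈ p′ → r ≈ r′ → p ⊖ r ≈ p′ ⊖ r′
  ⊖-cong e f = A.+-cong e (A.-‿cong f)

  •-cong : ∀ {c d p r} → c ≡ d → p ≈ r → c • p ≈ d • r
  at (•-cong {c} {d} {p} {r} e f) i =
    trans (coeff-• c p i) (trans (cong₂ _*_ e (at f i)) (sym (coeff-• d r i)))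

  *-assoc-• : ∀ c d p → (c * d) • p ≈ c • (d • p)
  at (*-assoc-• c d p) i = begin
    coeff ((c * d) • p) i   ≡⟨ coeff-• (c * d) p i ⟩
    c * d * coeff p i       ≡⟨ K.*-assoc c d _ ⟩
    c * (d * coeff p i)     ≡⟨ cong (c *_) (coeff-• d p i) ⟨
    c * coeff (d • p) i     ≡⟨ coeff-• c (d • p) i ⟨
    coeff (c • (d • p)) i   ∎
    where open ≡-Reasoning

  1-• : ∀ p → 1# • p ≈ p
  at (1-• p) i = trans (coeff-• 1# p i) (K.*-identityˡ _)

-- Divisibility, degrees, division with remainder and greatest common divisors.

module Divisibility (𝔽 : FiniteField) where
  open PolynomialRing 𝔽 public
  open FiniteField 𝔽 using (_+_; _*_; -_; _≟_; inverse; 0≢1)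
  open A using (solve; _:=_; _:+_; _:*_; _:-_; :-_)

  infix 4 _∣_
  record _∣_ (a b : Pol) : Set where
    constructor divides
    field
      quotient : Pol
      equality : quotient ⊗ a ≈ b
  open _∣_ public

  ∣-refl : ∀ {a} → a ∣ a
  ∣-refl {a} = divides 𝟙 (A.*-identityˡ a)

  ∣-reflexive : ∀ {a b} → a ≈ b → a ∣ b
  ∣-reflexive {a} e = divides 𝟙 (≈-trans (A.*-identityˡ a) e)

  ∣-trans : ∀ {a b c} → a ∣ b → b ∣ c → a ∣ c
  ∣-trans {a} (divides s e) (divides t f) =
    divides (t ⊗ s) (≈-trans (A.*-assoc t s a) (≈-trans (⊗-congˡ e) f))

  ∣-respʳ : ∀ {a b c} → b ≈ c → a ∣ b → a ∣ c
  ∣-respʳ e (divides s f) = divides s (≈-trans f e)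

  ∣-respˡ : ∀ {a b c} → a ≈ b → a ∣ c → b ∣ c
  ∣-respˡ e (divides s f) = divides s (≈-trans (⊗-congˡ (≈-sym e)) f)

  ∣-zero : ∀ {a} → a ∣ []
  ∣-zero {a} = divides [] (A.zeroˡ a)

  ∣-⊕ : ∀ {a b c} → a ∣ b → a ∣ c → a ∣ b ⊕ c
  ∣-⊕ {a} (divides s e) (divides t f) =
    divides (s ⊕ t) (≈-trans (A.distribʳ a s t) (A.+-cong e f))

  ∣-⊗ˡ : ∀ {a b} c → a ∣ b → a ∣ c ⊗ b
  ∣-⊗ˡ {a} c (divides s e) = divides (c ⊗ s) (≈-trans (A.*-assoc c s a) (⊗-congˡ e))

  ∣-⊗ʳ : ∀ {a b} c → a ∣ b → a ∣ b ⊗ c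
  ∣-⊗ʳ {a} {b} c d = ∣-respʳ (A.*-comm c b) (∣-⊗ˡ c d)

  ∣-⊝ : ∀ {a b} → a ∣ b → a ∣ ⊝ b
  ∣-⊝ {a} (divides s e) = divides (⊝ s) (≈-trans (≈-sym (A.-‿distribˡ-* s a)) (A.-‿cong e))

  ∣-⊖ : ∀ {a b c} → a ∣ b → a ∣ c → a ∣ b ⊖ c
  ∣-⊖ d e = ∣-⊕ d (∣-⊝ e)

  ⊖⊕-cancel : ∀ b c → (b ⊖ c) ⊕ c ≈ b
  ⊖⊕-cancel = solve 2 (λ b c → (b :- c) :+ c := b) ≈-refl

  ∣-⊖-cancel : ∀ {a b c} → a ∣ b ⊖ c → a ∣ c → a ∣ b
  ∣-⊖-cancel {b = b} {c} d e = ∣-respʳ (⊖⊕-cancel b c) (∣-⊕ d e)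

  ∣-⊕-cancelʳ : ∀ {a b c} → a ∣ b ⊕ c → a ∣ b → a ∣ c
  ∣-⊕-cancelʳ {b = b} {c} d e =
    ∣-respʳ (solve 2 (λ b c → (b :+ c) :- b := c) ≈-refl b c) (∣-⊖ d e)

  ∣-⊖-sym : ∀ {a} b c → a ∣ b ⊖ c → a ∣ c ⊖ b
  ∣-⊖-sym b c d = ∣-respʳ (solve 2 (λ b c → :- (b :- c) := c :- b) ≈-refl b c) (∣-⊝ d)

  ∣-⊖-trans : ∀ {a} b c e → a ∣ b ⊖ c → a ∣ c ⊖ e → a ∣ b ⊖ e
  ∣-⊖-trans b c e d d′ =
    ∣-respʳ (solve 3 (λ b c e → (b :- c) :+ (c :- e) := b :- e) ≈-refl b c e) (∣-⊕ d d′)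

  ⊗-mono-∣ : ∀ {a b c d} → a ∣ b → c ∣ d → a ⊗ c ∣ b ⊗ d
  ⊗-mono-∣ {a} {c = c} (divides s e) (divides t f) = divides (s ⊗ t)
    (≈-trans (solve 4 (λ s t a c → s :* t :* (a :* c) := s :* a :* (t :* c)) ≈-refl s t a c) (A.*-cong e f))

  ≈⇒∣⊖ : ∀ {a b c} → b ≈ c → a ∣ b ⊖ c
  ≈⇒∣⊖ {c = c} e = ∣-respʳ (≈-sym (≈-trans (⊕-congʳ e) (A.-‿inverseʳ c))) ∣-zero

  -- Bezout form, since the coefficients `s` and `t` are later made to act through the Carlitz
  -- module (`coprime-C`).
  Coprime : Pol → Pol → Set
  Coprime a b = ∃₂ λ s t → s ⊗ a ⊕ t ⊗ b ≈ 𝟙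

  Coprime-sym : ∀ {a b} → Coprime a b → Coprime b a
  Coprime-sym (s , t , e) = t , s , ≈-trans (A.+-comm _ _) e

  coprime-∣ : ∀ {a b c} → Coprime a c → c ∣ a ⊗ b → c ∣ b
  coprime-∣ {a} {b} {c} (s , t , e) d = ∣-respʳ eq (∣-⊕ (∣-⊗ˡ s d) (∣-⊗ˡ (t ⊗ b) (∣-refl {c})))
    where
    eq : s ⊗ (a ⊗ b) ⊕ t ⊗ b ⊗ c ≈ b
    eq = ≈-trans
      (solve 5 (λ s t a b c → s :* (a :* b) :+ t :* b :* c := (s :* a :+ t :* c) :* b) ≈-refl s t a b c)
      (≈-trans (⊗-congʳ e) (A.*-identityˡ b))

  Below : ℕ → Pol → Set
  Below n p = ∀ i → n ≤ i → coeff p i ≡ 0#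

  -- Degree as a relation, which the zero polynomial satisfies for no `n`; the conventional degree 0
  -- of zero in the statement then causes no case distinctions.
  record Deg (n : ℕ) (p : Pol) : Set where
    constructor mkDeg
    field
      lead≢0 : ¬ coeff p n ≡ 0#
      above  : Below (suc n) p

  record Mon (n : ℕ) (p : Pol) : Set where
    constructor mkMon
    field
      lead≡1 : coeff p n ≡ 1#
      above  : Below (suc n) p

  Mon⇒Deg : ∀ {n p} → Mon n p → Deg n p
  Mon⇒Deg (mkMon l a) = mkDeg (λ z → 0≢1 (trans (sym z) l)) a

  below-resp : ∀ {n p r} → p ≈ r → Below n p → Below n r
  below-resp e b i le = trans (sym (at e i)) (b i le)

  deg-resp : ∀ {n p r} → p ≈ r → Deg n p → Deg n r
  deg-resp e (mkDeg l a) = mkDeg (λ z → l (trans (at e _) z)) (below-resp e a)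

  mon-resp : ∀ {n p r} → p ≈ r → Mon n p → Mon n r
  mon-resp e (mkMon l a) = mkMon (trans (sym (at e _)) l) (below-resp e a)

  below-mono : ∀ {m n} p → m ≤ n → Below m p → Below n p
  below-mono p m≤n b i le = b i (ℕP.≤-trans m≤n le)

  below-⊕ : ∀ {n} p r → Below n p → Below n r → Below n (p ⊕ r)
  below-⊕ p r b c i le = trans (coeff-⊕ p r i)
    (trans (cong₂ _+_ (b i le) (c i le)) (K.+-identityˡ 0#))

  below-• : ∀ {n} c p → Below n p → Below n (c • p)
  below-• c p b i le = trans (coeff-• c p i) (trans (cong (c *_) (b i le)) (K.zeroʳ c))

  below-∷ : ∀ {n} x p → Below n p → Below (suc n) (x ∷ p)
  below-∷ x p b (suc i) (s≤s le) = b i le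

  below-tail : ∀ {n} x p → Below (suc n) (x ∷ p) → Below n p
  below-tail x p b i le = b (suc i) (s≤s le)

  below-length : ∀ p → Below (length p) p
  below-length []      i       le       = refl
  below-length (x ∷ p) (suc i) (s≤s le) = below-length p i le

  below-0 : ∀ {p} → Below 0 p → p ≈ []
  at (below-0 b) i = b i z≤n

  below-1 : ∀ {p} → Below 1 p → p ≈ ‵ (coeff p 0)
  at (below-1 b) zero    = refl
  at (below-1 b) (suc i) = b (suc i) (s≤s z≤n)

  deg⇒≉[] : ∀ {n p} → Deg n p → ¬ p ≈ []
  deg⇒≉[] (mkDeg l a) e = l (at e _)

  deg≤ : ∀ {m n p} → Deg m p → Below (suc n) p → m ≤ n
  deg≤ {m} {n} (mkDeg l _) b with m ℕP.≤? n
  ... | yes m≤n = m≤n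
  ... | no m≰n  = contradiction (b m (ℕP.≰⇒> m≰n)) l

  opaque
    deg-unique : ∀ {m n p} → Deg m p → Deg n p → m ≡ n
    deg-unique d e = ℕP.≤-antisym (deg≤ d (Deg.above e)) (deg≤ e (Deg.above d))

  opaque
    zero-or-deg : ∀ p → p ≈ [] ⊎ ∃ λ n → Deg n p
    zero-or-deg [] = inj₁ ≈-refl
    zero-or-deg (x ∷ p) with zero-or-deg p
    ... | inj₂ (n , mkDeg l a) = inj₂ (suc n , mkDeg l (below-∷ x p a))
    ... | inj₁ e with x ≟ 0#
    ...   | yes refl = inj₁ (0∷[]≈[] e)
    ...   | no x≢0   = inj₂ (0 , mkDeg x≢0 (below-∷ x p (λ i _ → at e i)))

  opaque
    ≉[]⇒deg : ∀ {p} → ¬ p ≈ [] → ∃ λ n → Deg n p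
    ≉[]⇒deg {p} p≉[] with zero-or-deg p
    ... | inj₁ e = contradiction e p≉[]
    ... | inj₂ d = d

  zero? : ∀ p → Dec (p ≈ [])
  zero? p with zero-or-deg p
  ... | inj₁ e       = yes e
  ... | inj₂ (n , d) = no (deg⇒≉[] d)

  mon-⊕ : ∀ {n} p r → Mon n p → Below n r → Mon n (p ⊕ r)
  mon-⊕ {n} p r (mkMon l a) b = mkMon
    (trans (coeff-⊕ p r n) (trans (cong₂ _+_ l (b n ℕP.≤-refl)) (K.+-identityʳ 1#)))
    (below-⊕ p r a (below-mono r (ℕP.n≤1+n n) b))

  mon-⊕ʳ : ∀ {n} p r → Below n p → Mon n r → Mon n (p ⊕ r)
  mon-⊕ʳ p r b m = mon-resp (A.+-comm r p) (mon-⊕ r p m b)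

  coeff-⊗-const : ∀ {p} r → Below 1 p → p ⊗ r ≈ coeff p 0 • r
  coeff-⊗-const {p} r b = ≈-trans (⊗-congʳ (below-1 b)) (‵-⊗ (coeff p 0) r)

  coeff-⊗-suc : ∀ x p r i → coeff ((x ∷ p) ⊗ r) (suc i) ≡ x * coeff r (suc i) + coeff (p ⊗ r) i
  coeff-⊗-suc x p r i = trans (at (∷-⊗ x p r) (suc i)) (trans (coeff-⊕ (x • r) (0# ∷ p ⊗ r) (suc i))
    (cong (_+ coeff (p ⊗ r) i) (coeff-• x r (suc i))))

  below-⊗ : ∀ m n p r → Below (suc m) p → Below (suc n) r → Below (suc (m ℕ.+ n)) (p ⊗ r)
  below-⊗ m n [] r b c i le = at (A.zeroˡ r) i
  below-⊗ zero n (x ∷ p) r b c = below-resp (≈-sym (coeff-⊗-const r b)) (below-• x r c)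
  below-⊗ (suc m) n (x ∷ p) r b c (suc i) (s≤s le) = trans (coeff-⊗-suc x p r i)
    (trans (cong₂ _+_
      (trans (cong (x *_) (c (suc i) (s≤s (ℕP.≤-trans (ℕP.m≤n+m n m) (ℕP.≤-trans (ℕP.n≤1+n _) le)))))
             (K.zeroʳ x))
      (below-⊗ m n p r (below-tail x p b) c i le)) (K.+-identityˡ 0#))

  coeff-⊗-top : ∀ m n p r → Below (suc m) p → Below (suc n) r →
                coeff (p ⊗ r) (m ℕ.+ n) ≡ coeff p m * coeff r n
  coeff-⊗-top m n [] r b c = trans (at (A.zeroˡ r) (m ℕ.+ n)) (sym (K.zeroˡ _))
  coeff-⊗-top zero n (x ∷ p) r b c = trans (at (coeff-⊗-const r b) n) (coeff-• x r n)
  coeff-⊗-top (suc m) n (x ∷ p) r b c = trans (coeff-⊗-suc x p r (m ℕ.+ n))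
    (trans (cong₂ _+_
      (trans (cong (x *_) (c (suc (m ℕ.+ n)) (s≤s (ℕP.m≤n+m n m)))) (K.zeroʳ x))
      (coeff-⊗-top m n p r (below-tail x p b) c)) (K.+-identityˡ _))

  opaque
    deg-⊗ : ∀ {m n p r} → Deg m p → Deg n r → Deg (m ℕ.+ n) (p ⊗ r)
    deg-⊗ {m} {n} {p} {r} (mkDeg l a) (mkDeg l′ a′) = mkDeg
      (λ z → nonzero-* l l′ (trans (sym (coeff-⊗-top m n p r a a′)) z)) (below-⊗ m n p r a a′)

  opaque
    mon-⊗ : ∀ {m n p r} → Mon m p → Mon n r → Mon (m ℕ.+ n) (p ⊗ r)
    mon-⊗ {m} {n} {p} {r} (mkMon l a) (mkMon l′ a′) = mkMon
      (trans (coeff-⊗-top m n p r a a′) (trans (cong₂ _*_ l l′) (K.*-identityˡ 1#))) (below-⊗ m n p r a a′)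

  mon-𝟙 : Mon 0 𝟙
  mon-𝟙 = mkMon refl (below-length 𝟙)

  mon-0 : ∀ {p} → Mon 0 p → p ≈ 𝟙
  mon-0 (mkMon l a) = ≈-trans (below-1 a) (∷-cong l ≈-refl)

  ⊗-≉[] : ∀ {p r} → ¬ p ≈ [] → ¬ r ≈ [] → ¬ p ⊗ r ≈ []
  ⊗-≉[] p≉ r≉ with ≉[]⇒deg p≉ | ≉[]⇒deg r≉
  ... | _ , d | _ , e = deg⇒≉[] (deg-⊗ d e)

  ⊗-integral : ∀ p r → p ⊗ r ≈ [] → p ≈ [] ⊎ r ≈ []
  ⊗-integral p r e with zero? p | zero? r
  ... | yes p≈ | _      = inj₁ p≈
  ... | no _   | yes r≈ = inj₂ r≈
  ... | no p≉  | no r≉  = contradiction e (⊗-≉[] p≉ r≉)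

  ⊖-≈[] : ∀ {p r} → p ⊖ r ≈ [] → p ≈ r
  ⊖-≈[] {p} {r} e = ≈-trans (≈-sym (⊖⊕-cancel p r)) (≈-trans (⊕-congʳ e) (A.+-identityˡ r))

  ≈-⊖ : ∀ {p r} → p ≈ r → p ⊖ r ≈ []
  ≈-⊖ {p} {r} e = ≈-trans (⊕-congʳ e) (A.-‿inverseʳ r)

  ⊗-cancelˡ : ∀ {a p r} → ¬ a ≈ [] → a ⊗ p ≈ a ⊗ r → p ≈ r
  ⊗-cancelˡ {a} {p} {r} a≉ e with ⊗-integral a (p ⊖ r)
    (≈-trans (solve 3 (λ a p r → a :* (p :- r) := a :* p :- a :* r) ≈-refl a p r) (≈-⊖ e))
  ... | inj₁ a≈ = contradiction a≈ a≉
  ... | inj₂ f  = ⊖-≈[] f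

  ⊗-cancelʳ : ∀ {a p r} → ¬ a ≈ [] → p ⊗ a ≈ r ⊗ a → p ≈ r
  ⊗-cancelʳ {a} {p} {r} a≉ e =
    ⊗-cancelˡ a≉ (≈-trans (A.*-comm a p) (≈-trans e (A.*-comm r a)))

  ∣-cancelʳ : ∀ {a b c} → ¬ c ≈ [] → a ⊗ c ∣ b ⊗ c → a ∣ b
  ∣-cancelʳ {a} {b} {c} c≉ (divides s e) = divides s (⊗-cancelʳ c≉ (≈-trans (A.*-assoc s a c) e))

  opaque
    ∣⇒deg≤ : ∀ {a b m n} → a ∣ b → Deg m a → Deg n b → m ≤ n
    ∣⇒deg≤ {a} {b} (divides s e) d d′ with zero? s
    ... | yes s≈ = contradiction (≈-trans (≈-sym e) (≈-trans (⊗-congʳ s≈) (A.zeroˡ a))) (deg⇒≉[] d′)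
    ... | no s≉ with ≉[]⇒deg s≉
    ...   | k , ds = subst (_ ≤_) (deg-unique (deg-resp e (deg-⊗ ds d)) d′) (ℕP.m≤n+m _ k)

  ∣-≉[] : ∀ {a b} → a ∣ b → ¬ b ≈ [] → ¬ a ≈ []
  ∣-≉[] (divides s e) b≉ a≈ = b≉ (≈-trans (≈-sym e) (≈-trans (⊗-congˡ a≈) (A.zeroʳ s)))

  ∣-small : ∀ {a b n} → a ∣ b → Deg n a → Below n b → b ≈ []
  ∣-small {b = b} d da bel with zero-or-deg b
  ... | inj₁ e = e
  ... | inj₂ (k , db) with deg≤ db (below-mono b (ℕP.n≤1+n _) bel)
  ... | _ = contradiction (ℕP.≤-trans (ℕP.≰⇒> (λ n≤k → Deg.lead≢0 db (bel k n≤k))) (∣⇒deg≤ d da db))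
      (ℕP.<-irrefl refl)

  -- The leading terms cancel in `b ⊖ a`, which is divisible by `a` but has smaller degree, so it
  -- vanishes.
  mon-∣-≈ : ∀ {n a b} → Mon n a → Mon n b → a ∣ b → a ≈ b
  mon-∣-≈ {n} {a} {b} (mkMon l al) (mkMon l′ al′) d = ≈-sym
      (⊖-≈[] (∣-small (∣-⊖ d (∣-refl {a})) (Mon⇒Deg (mkMon l al)) bel))
    where
    bel : Below n (b ⊖ a)
    bel i le with ℕP.m≤n⇒m<n∨m≡n le
    ... | inj₁ lt   = trans (coeff-⊖ b a i) (trans (cong₂ (λ x y → x + - y) (al′ i lt) (al i lt)) (K.-‿inverseʳ 0#))
    ... | inj₂ refl = trans (coeff-⊖ b a i) (trans (cong₂ (λ x y → x + - y) l′ l) (K.-‿inverseʳ 1#))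

  opaque
    make-monic : ∀ {n p} → Deg n p → ∃ λ c → ¬ c ≡ 0# × Mon n (c • p)
    make-monic {n} {p} (mkDeg l a) with inverse _ l
    ... | c , e = c , (λ { refl → 0≢1 (trans (sym (K.zeroʳ _)) e) }) ,
      mkMon (trans (coeff-• c p n) (trans (K.*-comm c _) e)) (below-• c p a)

  •-∣ : ∀ {c} p → ¬ c ≡ 0# → c • p ∣ p
  •-∣ {c} p c≢0 with inverse c c≢0
  ... | d , e = divides (‵ d) (≈-trans (‵-⊗ d (c • p)) (≈-trans (≈-sym (*-assoc-• d c p))
                 (≈-trans (•-cong (trans (K.*-comm d c) e) ≈-refl) (1-• p))))

  ∣-• : ∀ {a b} c → a ∣ b → a ∣ c • b
  ∣-• {b = b} c d = ∣-respʳ (‵-⊗ c b) (∣-⊗ˡ (‵ c) d)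

  opaque
    deg-0-∣𝟙 : ∀ {p} → Deg 0 p → p ∣ 𝟙
    deg-0-∣𝟙 {p} d with make-monic d
    ... | c , _ , m = ∣-respʳ (mon-0 m) (∣-• c (∣-refl {p}))

  opaque
    -- Induction on the coefficient list of the dividend: if `a` leaves the remainder `r`, then
    -- `x ∷ a` leaves `x ∷ r` up to one multiple `c • b`, chosen to kill the coefficient at `n`; `z`
    -- inverts the leading coefficient of `b`.
    divMod : ∀ {n b} → Deg n b → ∀ a → ∃₂ λ s r → a ≈ s ⊗ b ⊕ r × Below n r
    divMod {n} {b} d [] = [] , [] , ≈-sym (≈-trans (A.+-identityʳ _) (A.zeroˡ b)) , λ _ _ → refl
    divMod {n} {b} d@(mkDeg l al) (x ∷ a) with divMod d a | inverse _ l
    ... | s , r , e , bel | z , bz = c ∷ s , (x ∷ r) ⊖ (c • b) , eq , bel′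
      where
      t c : F
      t = coeff (x ∷ r) n
      c = t * z
      eq : x ∷ a ≈ (c ∷ s) ⊗ b ⊕ ((x ∷ r) ⊖ (c • b))
      eq = begin
        x ∷ a                                              ≈⟨ coeffwise split ⟩
        (0# ∷ s ⊗ b) ⊕ (x ∷ r)
          ≈⟨ solve 3 (λ u v w → u :+ v := w :+ u :+ (v :- w)) ≈-refl (0# ∷ s ⊗ b) (x ∷ r) (c • b) ⟩
        (c • b) ⊕ (0# ∷ s ⊗ b) ⊕ ((x ∷ r) ⊖ (c • b))       ≈⟨ ⊕-congʳ (∷-⊗ c s b) ⟨
        (c ∷ s) ⊗ b ⊕ ((x ∷ r) ⊖ (c • b))                  ∎
        where
        open ≈-Reasoning
        split : ∀ i → coeff (x ∷ a) i ≡ coeff ((0# ∷ s ⊗ b) ⊕ (x ∷ r)) i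
        split zero    = sym (trans (coeff-⊕ (0# ∷ s ⊗ b) (x ∷ r) 0) (K.+-identityˡ x))
        split (suc i) = trans (at e i) (trans (coeff-⊕ (s ⊗ b) r i)
          (sym (coeff-⊕ (0# ∷ s ⊗ b) (x ∷ r) (suc i))))
      bel′ : Below n ((x ∷ r) ⊖ (c • b))
      bel′ i le with ℕP.m≤n⇒m<n∨m≡n le
      ... | inj₁ lt = trans (coeff-⊖ (x ∷ r) (c • b) i)
        (trans (cong₂ (λ u v → u + - v) (below-∷ x r bel i lt) (below-• c b al i lt)) (K.-‿inverseʳ 0#))
      ... | inj₂ refl = begin
        coeff ((x ∷ r) ⊖ (c • b)) n            ≡⟨ coeff-⊖ (x ∷ r) (c • b) n ⟩
        t + - coeff (c • b) n                  ≡⟨ cong (λ u → t + - u) (coeff-• c b n) ⟩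
        t + - (t * z * coeff b n)
          ≡⟨ cong (λ u → t + - u) (K.solve 3 (λ t z y → t K.:* z K.:* y K.:= t K.:* (y K.:* z)) refl t z (coeff b n))
              ⟩
        t + - (t * (coeff b n * z))            ≡⟨ cong (λ u → t + - (t * u)) bz ⟩
        t + - (t * 1#)                         ≡⟨ cong (λ u → t + - u) (K.*-identityʳ t) ⟩
        t + - t                                ≡⟨ K.-‿inverseʳ t ⟩
        0#                                     ∎
        where open ≡-Reasoning

  infix 4 _∣?_
  opaque
    _∣?_ : ∀ a b → Dec (a ∣ b)
    a ∣? b with zero-or-deg a
    ... | inj₁ a≈ with zero? b
    ...   | yes b≈ = yes (∣-respʳ (≈-sym b≈) ∣-zero)
    ...   | no b≉  = no λ d → ∣-≉[] d b≉ a≈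
    a ∣? b | inj₂ (n , d) with divMod d b
    ...   | s , r , e , bel with zero? r
    ...     | yes r≈ = yes (divides s (≈-sym (≈-trans e (≈-trans (⊕-congˡ r≈) (A.+-identityʳ _)))))
    ...     | no r≉  = no λ div → r≉ (∣-small (∣-⊕-cancelʳ (∣-respʳ e div) (∣-⊗ˡ s (∣-refl {a}))) d bel)

  record GCD (a b : Pol) : Set where
    constructor mkGCD
    field
      gcd    : Pol
      gcd∣ˡ  : gcd ∣ a
      gcd∣ʳ  : gcd ∣ b
      s t    : Pol
      bezout : s ⊗ a ⊕ t ⊗ b ≈ gcd

    greatest : ∀ {d} → d ∣ a → d ∣ b → d ∣ gcd
    greatest u v = ∣-respʳ bezout (∣-⊕ (∣-⊗ˡ s u) (∣-⊗ˡ t v))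

  private
    gcd-below : ∀ n a b → Below n b → GCD a b
    gcd-zero : ∀ {a b} → b ≈ [] → GCD a b
    gcd-zero {a} {b} e = mkGCD a ∣-refl (∣-respʳ (≈-sym e) ∣-zero) 𝟙 []
      (≈-trans (≈-trans (⊕-congˡ (A.zeroˡ b)) (A.+-identityʳ _)) (A.*-identityˡ a))
    gcd-below zero a b bel = gcd-zero (below-0 bel)
    gcd-below (suc n) a b bel with zero-or-deg b
    ... | inj₁ e = gcd-zero e
    ... | inj₂ (k , d) with divMod d a
    ...   | u , r , e , belr with gcd-below n b r (below-mono r (deg≤ d bel) belr)
    ...     | mkGCD g g∣b g∣r s t bz = mkGCD g
              (∣-respʳ (≈-sym e) (∣-⊕ (∣-⊗ˡ u g∣b) g∣r)) g∣b t (s ⊖ t ⊗ u)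
              (≈-trans (⊕-congʳ (⊗-congˡ e))
              (≈-trans (solve 5 (λ s t u b r → t :* (u :* b :+ r) :+ (s :- t :* u) :* b := s :* b :+ t :* r) ≈-refl s
                  t u b r) bz))

  opaque
    gcd-of : ∀ a b → GCD a b
    gcd-of a b = gcd-below (length b) a b (below-length b)

-- Prime polynomials.

module Primes (𝔽 : FiniteField) where
  open Divisibility 𝔽 public
  open FiniteField 𝔽 using (_≟_; finite)
  private module D = Poly 𝔽

  private
    reverse-∷ʳ : ∀ (xs : Pol) x → reverse (xs ∷ʳ x) ≡ x ∷ reverse xs
    reverse-∷ʳ xs x = ListP.reverse-++ xs (x ∷ [])

    trim-zero : ∀ xs → D.trim (xs ∷ʳ 0#) ≡ D.trim xs
    trim-zero xs rewrite reverse-∷ʳ xs 0# with 0# ≟ 0#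
    ... | yes _ = refl
    ... | no 0≢0 = contradiction refl 0≢0

    trim-nonzero : ∀ xs {x} → ¬ x ≡ 0# → D.trim (xs ∷ʳ x) ≡ xs ∷ʳ x
    trim-nonzero xs {x} x≢0 rewrite reverse-∷ʳ xs x with x ≟ 0#
    ... | yes x≡0 = contradiction x≡0 x≢0
    ... | no _ = trans (ListP.unfold-reverse x (reverse xs)) (cong (_∷ʳ x) (ListP.reverse-involutive xs))

    ∷ʳ-zero : ∀ xs → xs ∷ʳ 0# ≈ xs
    ∷ʳ-zero []       = 0∷[]≈[] ≈-refl
    ∷ʳ-zero (x ∷ xs) = ∷-cong refl (∷ʳ-zero xs)

    coeff-∷ʳ : ∀ xs x → coeff (xs ∷ʳ x) (length xs) ≡ x
    coeff-∷ʳ []       x = refl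
    coeff-∷ʳ (_ ∷ xs) x = coeff-∷ʳ xs x

    deg-∷ʳ : ∀ xs {x} → ¬ x ≡ 0# → Deg (length xs) (xs ∷ʳ x)
    deg-∷ʳ xs {x} x≢0 = mkDeg (λ z → x≢0 (trans (sym (coeff-∷ʳ xs x)) z))
      (subst (λ k → Below k (xs ∷ʳ x)) (trans (ListP.length-++ xs) (ℕP.+-comm _ 1)) (below-length (xs ∷ʳ x)))

    leading-trim : ∀ {p x xs} → reverse (D.trim p) ≡ x ∷ xs → D.leading p ≡ just x
    leading-trim {p} e with reverse (D.trim p)
    leading-trim {p} refl | x ∷ _ = refl

    leading-cong : ∀ p r → D.trim p ≡ D.trim r → D.leading p ≡ D.leading r
    leading-cong p r e with reverse (D.trim p) | reverse (D.trim r) | cong reverse e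
    ... | []    | .[]      | refl = refl
    ... | y ∷ _ | .(y ∷ _) | refl = refl

    -- The induction runs from the end of the list, where `trim` removes its zeros.
    trim-deg : ∀ {n p} → Reverse p → Deg n p → D.deg p ≡ n × D.leading p ≡ just (coeff p n)
    trim-deg []ʳ d = contradiction refl (Deg.lead≢0 d)
    trim-deg (xs ∶ rs ∶ʳ x) d with x ≟ 0#
    ... | yes refl with trim-deg rs (deg-resp (∷ʳ-zero xs) d)
    ...   | e , l = trans (cong (λ k → length k ℕ.∸ 1) (trim-zero xs)) e ,
            trans (leading-cong (xs ∷ʳ 0#) xs (trim-zero xs)) (trans l (cong just (sym (at (∷ʳ-zero xs) _))))
    trim-deg {n} (xs ∶ rs ∶ʳ x) d | no x≢0 with deg-unique d (deg-∷ʳ xs x≢0)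
    ... | refl = trans (cong (λ k → length k ℕ.∸ 1) (trim-nonzero xs x≢0))
                   (trans (cong (ℕ._∸ 1) (trans (ListP.length-++ xs) (ℕP.+-comm _ 1))) refl) ,
                 trans (leading-trim {xs ∷ʳ x} (trans (cong reverse (trim-nonzero xs x≢0)) (reverse-∷ʳ xs x)))
                   (cong just (sym (coeff-∷ʳ xs x)))

    leading-zero : ∀ {p} → Reverse p → p ≈ [] → ¬ D.Monic p
    leading-zero []ʳ e ()
    leading-zero (xs ∶ rs ∶ʳ x) e m with x ≟ 0#
    ... | no x≢0 = deg⇒≉[] (deg-∷ʳ xs x≢0) e
    ... | yes refl = leading-zero rs (≈-trans (≈-sym (∷ʳ-zero xs)) e)
        (trans (sym (leading-cong (xs ∷ʳ 0#) xs (trim-zero xs))) m)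

  Deg⇒deg : ∀ {n p} → Deg n p → D.deg p ≡ n
  Deg⇒deg {p = p} d = proj₁ (trim-deg (reverseView p) d)

  Mon⇒deg : ∀ {n p} → Mon n p → D.deg p ≡ n
  Mon⇒deg m = Deg⇒deg (Mon⇒Deg m)

  Mon⇒Monic : ∀ {n p} → Mon n p → D.Monic p
  Mon⇒Monic {p = p} m = trans (proj₂ (trim-deg (reverseView p) (Mon⇒Deg m))) (cong just (Mon.lead≡1 m))

  Monic⇒Mon : ∀ {p} → D.Monic p → Mon (D.deg p) p
  Monic⇒Mon {p} m with zero-or-deg p
  ... | inj₁ e = contradiction m (leading-zero (reverseView p) e)
  ... | inj₂ (n , d) with trim-deg (reverseView p) d
  ...   | e , l with trans (sym l) m
  ...     | l≡1 = subst (λ k → Mon k p) (sym e) (mkMon (just-injective l≡1) (Deg.above d))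

  to∣ : ∀ a b → a D.∣ b → a ∣ b
  to∣ a b (c , e) = divides c (≈-trans (A.reflexive (⊗-def c a)) (coeffwise {p = c D.⊗ a} {r = b} e))

  from∣ : ∀ {a b} → a ∣ b → a D.∣ b
  from∣ {a} (divides c e) = c , λ i → trans (cong (λ p → coeff p i) (sym (⊗-def c a))) (at e i)

  record Prime (n : ℕ) (π : Pol) : Set where
    constructor mkPrime
    field
      monic      : Mon n π
      positive   : 0 < n
      euclid     : ∀ a b → π ∣ a ⊗ b → π ∣ a ⊎ π ∣ b

    ≉[] : ¬ π ≈ []
    ≉[] = deg⇒≉[] (Mon⇒Deg monic)

    ∤𝟙 : ¬ π ∣ 𝟙
    ∤𝟙 d = ℕP.<⇒≱ positive (∣⇒deg≤ d (Mon⇒Deg monic) (Mon⇒Deg mon-𝟙))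

    ∤small : ∀ {a} → Below n a → π ∣ a → a ≈ []
    ∤small b d = ∣-small d (Mon⇒Deg monic) b

  coprime-or-∣-const : ∀ {n p a} → Mon n p → (g : GCD p a) → Deg 0 (GCD.gcd g) → Coprime a p
  coprime-or-∣-const {p = p} {a} m g d with deg-0-∣𝟙 d
  ... | divides u e = u ⊗ GCD.t g , u ⊗ GCD.s g ,
    ≈-trans (A.solve 5 (λ u s t a p → u A.:* t A.:* a A.:+ u A.:* s A.:* p A.:= u A.:* (s A.:* p A.:+ t A.:* a))
        ≈-refl u (GCD.s g) (GCD.t g) a p)
    (≈-trans (⊗-congˡ (GCD.bezout g)) e)

  private
    full-divisor : ∀ {n p g} → Mon n p → g ∣ p → Deg n g → p ∣ g
    full-divisor {n} {p} {g} m (divides h e) d with zero-or-deg h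
    ... | inj₁ h≈ = contradiction (≈-trans (≈-sym e) (≈-trans (⊗-congʳ h≈) (A.zeroˡ g))) (deg⇒≉[] (Mon⇒Deg m))
    ... | inj₂ (k , dh) with ℕP.+-cancelʳ-≡ n k 0 (deg-unique (deg-resp e (deg-⊗ dh d)) (Mon⇒Deg m))
    ...   | refl with deg-0-∣𝟙 dh
    ...     | divides h′ e′ = divides h′ (≈-trans (⊗-congˡ (≈-sym e))
                (≈-trans (≈-sym (A.*-assoc h′ h g)) (≈-trans (⊗-congʳ e′) (A.*-identityˡ g))))

  opaque
    -- Write π = h g with g = gcd(π, a). If g is not constant, Euclid's lemma makes π divide g,
    -- hence `a`, or h, which has smaller degree. So g is constant and the Bezout identity can be
    -- scaled to 1.
    prime-coprime : ∀ {n π a} → Prime n π → ¬ π ∣ a → Coprime a π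
    prime-coprime {n} {π} {a} P π∤a with gcd-of π a
    ... | g with ≉[]⇒deg (∣-≉[] (GCD.gcd∣ˡ g) (Prime.≉[] P))
    ...   | zero , d = coprime-or-∣-const (Prime.monic P) g d
    ...   | suc j , d with Prime.euclid P (quotient (GCD.gcd∣ˡ g)) (GCD.gcd g)
        (∣-reflexive (≈-sym (equality (GCD.gcd∣ˡ g))))
    ...     | inj₂ π∣g = contradiction (∣-trans π∣g (GCD.gcd∣ʳ g)) π∤a
    ...     | inj₁ π∣h = contradiction (∣⇒deg≤ π∣h (Mon⇒Deg (Prime.monic P)) dh) (ℕP.<⇒≱ lt)
      where
      h : Pol
      h = quotient (GCD.gcd∣ˡ g)
      dh′ : ∃ λ k → Deg k h
      dh′ = ≉[]⇒deg (λ h≈ → Prime.≉[] P (≈-trans (≈-sym (equality (GCD.gcd∣ˡ g)))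
          (≈-trans (⊗-congʳ h≈) (A.zeroˡ (GCD.gcd g)))))
      dh : Deg (proj₁ dh′) h
      dh = proj₂ dh′
      lt : proj₁ dh′ < n
      lt = subst (proj₁ dh′ <_) (deg-unique (deg-resp (equality (GCD.gcd∣ˡ g)) (deg-⊗ dh d))
          (Mon⇒Deg (Prime.monic P)))
             (ℕP.m<m+n (proj₁ dh′) (s≤s z≤n))

  to-Prime : ∀ {π} → D.MonicPrime π → Prime (D.deg π) π
  to-Prime {π} (m , nz , nu , eu) = record
    { monic = Monic⇒Mon m
    ; positive = pos (Monic⇒Mon m)
    ; euclid = λ a b d → [ (λ x → inj₁ (to∣ π a x)) , (λ x → inj₂ (to∣ π b x)) ]′
        (eu a b (from∣ (∣-respʳ (A.reflexive (⊗-def a b)) d))) }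
    where
    pos : ∀ {k} → Mon k π → 0 < k
    pos {zero} m = contradiction (from∣ (deg-0-∣𝟙 (Mon⇒Deg m))) nu
    pos {suc k} m = s≤s z≤n

  from-Prime : ∀ {n π} → Prime n π → D.MonicPrime π
  from-Prime {n} {π} P = Mon⇒Monic monic , (λ z → ≉[] (coeffwise z)) , (λ u → ∤𝟙 (to∣ π 𝟙 u)) ,
    λ a b d → [ (λ x → inj₁ (from∣ x)) , (λ x → inj₂ (from∣ x)) ]′
      (euclid a b (∣-respʳ (A.reflexive (sym (⊗-def a b))) (to∣ π (a D.⊗ b) d)))
    where open Prime P

  private
    anyF? : {P : F → Set} → (∀ x → Dec (P x)) → Dec (∃ P)
    anyF? {P} P? = Dec.map′
      (λ { (i , p) → Inverse.from finite i , p })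
      (λ { (x , p) → Inverse.to finite x , subst P (sym (Inverse.strictlyInverseʳ finite x)) p })
      (FinP.any? (λ i → P? (Inverse.from finite i)))

    search : ∀ n (P : Pol → Set) → (∀ l → Dec (P l)) → Dec (∃ λ l → length l ≡ n × P l)
    search zero P P? = Dec.map′ (λ p → [] , refl , p) (λ { ([] , _ , p) → p }) (P? [])
    search (suc n) P P? = Dec.map′
      (λ { (x , l , e , p) → x ∷ l , cong suc e , p })
      (λ { (x ∷ l , e , p) → x , l , ℕP.suc-injective e , p })
      (anyF? (λ x → search n (λ l → P (x ∷ l)) (λ l → P? (x ∷ l))))

    pad : ℕ → Pol → Pol
    pad zero    p       = []
    pad (suc n) []      = 0# ∷ pad n []
    pad (suc n) (x ∷ p) = x ∷ pad n p

    length-pad : ∀ n p → length (pad n p) ≡ n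
    length-pad zero    p       = refl
    length-pad (suc n) []      = cong suc (length-pad n [])
    length-pad (suc n) (x ∷ p) = cong suc (length-pad n p)

    pad-≈ : ∀ n p → Below n p → pad n p ≈ p
    pad-≈ zero    p       b = ≈-sym (below-0 b)
    pad-≈ (suc n) []      b = 0∷[]≈[] (pad-≈ n [] (λ _ _ → refl))
    pad-≈ (suc n) (x ∷ p) b = ∷-cong refl (pad-≈ n p (below-tail x p b))

    Proper : Pol → Pol → Set
    Proper p l = (∃ λ k → Deg (suc k) l) × l ∣ p

    proper? : ∀ p l → Dec (Proper p l)
    proper? p l with zero-or-deg l
    ... | inj₁ e = no λ { ((_ , d) , _) → deg⇒≉[] d e }
    ... | inj₂ (zero , d) = no λ { ((_ , d′) , _) → contradiction (deg-unique d d′) λ () }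
    ... | inj₂ (suc k , d) = Dec.map′ (λ x → (k , d) , x) proj₂ (l ∣? p)

    -- The coefficient lists of length `suc n` represent all polynomials of degree at most `n`, so a
    -- finite search decides whether `p` has a proper divisor. A divisor found has smaller degree
    -- and the recursion continues with it (`N` is fuel). If there is none, gcd(π, a) is constant or
    -- associated to π for every `a`, which is Euclid's lemma for the monic multiple π of `p`.
    prime-divisor′ : ∀ N n {p} → n ≤ N → Deg (suc n) p → ∃₂ λ k π → Prime k π × π ∣ p
    prime-divisor′ N n {p} n≤N d with search (suc n) (Proper p) (proper? p)
    ... | yes (l , len , (k , dl) , l∣p) = step N n≤N
      where
      k≤n : suc k ≤ n
      k≤n = deg≤ dl (subst (λ j → Below j l) len (below-length l))
      step : ∀ N → n ≤ N → ∃₂ λ k π → Prime k π × π ∣ p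
      step zero n≤0 = contradiction (ℕP.≤-trans k≤n n≤0) λ ()
      step (suc N) n≤N with prime-divisor′ N k (ℕ.s≤s⁻¹ (ℕP.≤-trans k≤n n≤N)) dl
      ... | j , π , P , π∣l = j , π , P , ∣-trans π∣l l∣p
    ... | no none with make-monic d
    ...   | c , c≢0 , m = suc n , π , mkPrime m (s≤s z≤n) eu , π∣p
      where
      π = c • p
      π∣p : π ∣ p
      π∣p = •-∣ p c≢0
      eu : ∀ a b → π ∣ a ⊗ b → π ∣ a ⊎ π ∣ b
      eu a b π∣ab with gcd-of π a
      ... | g with ≉[]⇒deg (∣-≉[] (GCD.gcd∣ˡ g) (deg⇒≉[] (Mon⇒Deg m)))
      ...   | zero , dg = inj₂ (coprime-∣ (coprime-or-∣-const m g dg) π∣ab)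
      ...   | suc j , dg with ℕP.m≤n⇒m<n∨m≡n (∣⇒deg≤ (GCD.gcd∣ˡ g) dg (Mon⇒Deg m))
      ...     | inj₂ refl = inj₁ (∣-trans (full-divisor m (GCD.gcd∣ˡ g) dg) (GCD.gcd∣ʳ g))
      ...     | inj₁ j<n = contradiction
                  (pad (suc n) (GCD.gcd g) , length-pad (suc n) (GCD.gcd g) ,
                   (j , deg-resp (≈-sym eq) dg) , ∣-respˡ (≈-sym eq) (∣-trans (GCD.gcd∣ˡ g) π∣p)) none
        where
        eq = pad-≈ (suc n) (GCD.gcd g) (below-mono (GCD.gcd g) j<n (Deg.above dg))

  opaque
    prime-divisor : ∀ {n p} → Deg n p → 0 < n → ∃₂ λ k π → Prime k π × π ∣ p
    prime-divisor {suc n} d _ = prime-divisor′ n n ℕP.≤-refl d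

  opaque
    -- Let ρ = q π. If ρ does not divide π, it divides q, and cancelling ρ makes π a unit. Otherwise
    -- the degrees agree and both are monic.
    prime-∣-prime : ∀ {m n π ρ} → Prime m π → Prime n ρ → π ∣ ρ → π ≈ ρ
    prime-∣-prime {m} {n} {π} {ρ} P R d with ρ ∣? π
    ... | no ρ∤π = contradiction (coprime-∣ (prime-coprime R ρ∤π)
        (∣-reflexive (A.sym (≈-trans (A.*-comm π _) (equality d)))))
          λ ρ∣q → Prime.∤𝟙 P (lemma ρ∣q)
      where
      lemma : ρ ∣ quotient d → π ∣ 𝟙
      lemma (divides r e) = divides r (⊗-cancelʳ (Prime.≉[] R) (≈-trans (A.*-assoc r π ρ)
        (≈-trans (⊗-congˡ (A.*-comm π ρ)) (≈-trans (≈-sym (A.*-assoc r ρ π))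
        (≈-trans (⊗-congʳ e) (≈-trans (equality d) (≈-sym (A.*-identityˡ ρ))))))))
    ... | yes ρ∣π with ℕP.≤-antisym (∣⇒deg≤ d (Mon⇒Deg (Prime.monic P)) (Mon⇒Deg (Prime.monic R)))
                                       (∣⇒deg≤ ρ∣π (Mon⇒Deg (Prime.monic R)) (Mon⇒Deg (Prime.monic P)))
    ...   | refl = mon-∣-≈ (Prime.monic P) (Prime.monic R) d

-- Sums and products over all field elements.

module FermatLittle (𝔽 : FiniteField) where
  open FieldRing 𝔽
  open FiniteField 𝔽 using (_+_; _*_; -_; _≟_; inverse; finite; card; 0≢1)

  open Algebra.Definitions.RawMonoid K.*-rawMonoid public using () renaming (_×_ to pow)
  open Algebra.Definitions.RawMonoid K.+-rawMonoid public using () renaming (_×_ to multiple)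

  element : Fin card → F
  element = Inverse.from finite

  private
    module Sum (M : CommutativeMonoid 0ℓ 0ℓ) where
      open CommutativeMonoid M using (Carrier; _≈_; reflexive)
      open Algebra.Properties.CommutativeMonoid.Sum M public

      sum-bijection : ∀ (f : F → Carrier) (g h : F → F) → (∀ x → g (h x) ≡ x) → (∀ x → h (g x) ≡ x) →
                      sum (λ i → f (element i)) ≈ sum (λ i → f (g (element i)))
      sum-bijection f g h gh hg = CommutativeMonoid.trans M
        (sum-permute (λ i → f (element i)) (mk↔ₛ′ (conj g) (conj h) (conj-inv g h gh) (conj-inv h g hg)))
        (reflexive (sum-cong-≗ (λ i → cong f (Inverse.strictlyInverseʳ finite (g (element i))))))
        where
        conj : (F → F) → Fin card → Fin card
        conj g i = Inverse.to finite (g (element i))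
        conj-inv : ∀ g h → (∀ x → g (h x) ≡ x) → ∀ i → conj g (conj h i) ≡ i
        conj-inv g h gh i = trans
          (cong (λ x → Inverse.to finite (g x)) (Inverse.strictlyInverseʳ finite (h (element i))))
          (trans (cong (Inverse.to finite) (gh (element i))) (Inverse.strictlyInverseˡ finite i))

    module Σ⁺ = Sum K.+-commutativeMonoid
    module Π  = Sum K.*-commutativeMonoid

  -- Translation by 1 permutes the field, so the sum s of all elements equals s +
  -- `multiple card 1#`.
  multiple-card : multiple card 1# ≡ 0#
  multiple-card = begin
    multiple card 1#              ≡⟨ Σ⁺.sum-replicate card ⟨
    Σ⁺.sum {card} (λ _ → 1#)  ≡⟨ K.+-identityˡ _ ⟨
    0# + Σ⁺.sum {card} (λ _ → 1#)  ≡⟨ cong (_+ Σ⁺.sum {card} (λ _ → 1#)) (K.-‿inverseˡ s) ⟨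
    - s + s + Σ⁺.sum {card} (λ _ → 1#) ≡⟨ K.+-assoc _ _ _ ⟩
    - s + (s + Σ⁺.sum {card} (λ _ → 1#)) ≡⟨ cong (- s +_) (Σ⁺.∑-distrib-+ element (λ _ → 1#)) ⟨
    - s + Σ⁺.sum (λ i → element i + 1#)  ≡⟨ cong (- s +_) (Σ⁺.sum-bijection (λ x → x) (_+ 1#) (_+ - 1#)
        (λ x → trans (K.+-assoc x (- 1#) 1#) (trans (cong (x +_) (K.-‿inverseˡ 1#)) (K.+-identityʳ x)))
        (λ x → trans (K.+-assoc x 1# (- 1#)) (trans (cong (x +_) (K.-‿inverseʳ 1#)) (K.+-identityʳ x)))) ⟨
    - s + s                ≡⟨ K.-‿inverseˡ s ⟩
    0#                     ∎
    where
    open ≡-Reasoning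
    s = Σ⁺.sum element

  private
    ∏-except : ∀ n a (i : Fin n) (f : Fin n → F) → f i ≡ 1# → (∀ j → ¬ j ≡ i → f j ≡ a) →
               a * Π.sum f ≡ pow n a
    ∏-except (suc n) a i f fi f≢ = begin
      a * Π.sum f                               ≡⟨ cong (a *_) (Π.sum-remove {i = i} f) ⟩
      a * (f i * Π.sum (removeAt f i))
        ≡⟨ cong (a *_) (trans (cong (_* Π.sum (removeAt f i)) fi) (K.*-identityˡ _)) ⟩
      a * Π.sum (removeAt f i)
        ≡⟨ cong (a *_) (Π.sum-cong-≗ (λ j → f≢ (punchIn i j) (FinP.punchInᵢ≢i i j))) ⟩
      a * Π.sum {n} (λ _ → a)                   ≡⟨ cong (a *_) (Π.sum-replicate n) ⟩
      a * pow n a                               ∎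
      where open ≡-Reasoning

    -- A product over the nonzero elements becomes one over the whole field, with the factor 1 at 0;
    -- it can then be reindexed by bijections of `F`.
    unless0 : F → F → F
    unless0 a x with x ≟ 0#
    ... | yes _ = 1#
    ... | no  _ = a

    unless0-0 : ∀ a {x} → x ≡ 0# → unless0 a x ≡ 1#
    unless0-0 a {x} x≡0 with x ≟ 0#
    ... | yes _  = refl
    ... | no x≢0 = contradiction x≡0 x≢0

    unless0-≢ : ∀ a {x} → ¬ x ≡ 0# → unless0 a x ≡ a
    unless0-≢ a {x} x≢0 with x ≟ 0#
    ... | yes x≡0 = contradiction x≡0 x≢0
    ... | no _    = refl

    unless0-* : ∀ {a} → ¬ a ≡ 0# → ∀ x → unless0 (a * x) (a * x) ≡ unless0 a x * unless0 x x
    unless0-* {a} a≢0 x with x ≟ 0#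
    ... | yes refl = trans (unless0-0 (a * 0#) (K.zeroʳ a)) (sym (K.*-identityˡ 1#))
    ... | no x≢0   = unless0-≢ (a * x) (nonzero-* a≢0 x≢0)

    ∏-≢0 : ∀ n (f : Fin n → F) → (∀ i → ¬ f i ≡ 0#) → ¬ Π.sum f ≡ 0#
    ∏-≢0 zero f f≢0 e = 0≢1 (sym e)
    ∏-≢0 (suc n) f f≢0 e = nonzero-* (f≢0 zero) (∏-≢0 n (λ i → f (suc i)) (λ i → f≢0 (suc i))) e

    unless0-self : ∀ x → ¬ unless0 x x ≡ 0#
    unless0-self x with x ≟ 0#
    ... | yes _  = λ e → 0≢1 (sym e)
    ... | no x≢0 = x≢0

  *-cancelʳ-nonzero : ∀ {a b c} → ¬ c ≡ 0# → a * c ≡ b * c → a ≡ b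
  *-cancelʳ-nonzero {a} {b} {c} c≢0 e with inverse c c≢0
  ... | d , cd = begin
    a              ≡⟨ K.*-identityʳ a ⟨
    a * 1#         ≡⟨ cong (a *_) cd ⟨
    a * (c * d)    ≡⟨ K.*-assoc a c d ⟨
    a * c * d      ≡⟨ cong (_* d) e ⟩
    b * c * d      ≡⟨ K.*-assoc b c d ⟩
    b * (c * d)    ≡⟨ cong (b *_) cd ⟩
    b * 1#         ≡⟨ K.*-identityʳ b ⟩
    b              ∎
    where open ≡-Reasoning

  private
    pow-0 : ∀ n → Fin n → pow n 0# ≡ 0#
    pow-0 (suc n) i = K.zeroˡ _

  -- Multiplication by a permutes the nonzero elements, so their product P satisfies P = a^(card-1) P.
  fermat : ∀ a → pow card a ≡ a
  fermat a with a ≟ 0#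
  ... | yes refl = pow-0 card (Inverse.to finite 0#)
  ... | no a≢0 with inverse a a≢0
  ...   | b , ab = begin
    pow card a         ≡⟨ ∏-except card a (Inverse.to finite 0#) (λ i → unless0 a (element i))
                            (unless0-0 a (Inverse.strictlyInverseʳ finite 0#))
                            (λ j j≢ → unless0-≢ a (λ e → j≢ (trans (sym (Inverse.strictlyInverseˡ finite j))
                                (cong (Inverse.to finite) e)))) ⟨
    a * Π.sum (λ i → unless0 a (element i))   ≡⟨ cong (a *_) one ⟩
    a * 1#             ≡⟨ K.*-identityʳ a ⟩
    a                  ∎
    where
    open ≡-Reasoning
    all = Π.sum (λ i → unless0 (element i) (element i))
    one : Π.sum (λ i → unless0 a (element i)) ≡ 1#
    one = *-cancelʳ-nonzero (∏-≢0 card _ (λ i → unless0-self (element i))) (begin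
      Π.sum (λ i → unless0 a (element i)) * all
        ≡⟨ Π.∑-distrib-+ (λ i → unless0 a (element i)) (λ i → unless0 (element i) (element i)) ⟨
      Π.sum (λ i → unless0 a (element i) * unless0 (element i) (element i))
        ≡⟨ Π.sum-cong-≗ (λ i → unless0-* a≢0 (element i)) ⟨
      Π.sum (λ i → unless0 (a * element i) (a * element i))
        ≡⟨ Π.sum-bijection (λ x → unless0 x x) (a *_) (b *_)
             (λ x → trans (sym (K.*-assoc a b x)) (trans (cong (_* x) ab) (K.*-identityˡ x)))
             (λ x → trans (sym (K.*-assoc b a x)) (trans (cong (_* x) (trans (K.*-comm b a) ab)) (K.*-identityˡ x))) ⟨
      all
        ≡⟨ K.*-identityˡ all ⟨
      1# * all ∎)

-- Root counting and the additivity of the q-th power.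

module Frobenius (𝔽 : FiniteField) where
  open Primes 𝔽 public
  open FermatLittle 𝔽 public
  open FiniteField 𝔽 using (finite; card; _*_)
  open A using (solve; _:=_; _:+_; _:*_; _:-_; :-_)

  infixr 8 _^_
  _^_ : Pol → ℕ → Pol
  p ^ zero  = 𝟙
  p ^ suc n = p ⊗ p ^ n

  ^-cong : ∀ {p r} n → p ≈ r → p ^ n ≈ r ^ n
  ^-cong zero    e = ≈-refl
  ^-cong (suc n) e = ⊗-cong e (^-cong n e)

  ⊗-^ : ∀ p r n → (p ⊗ r) ^ n ≈ p ^ n ⊗ r ^ n
  ⊗-^ p r zero    = ≈-sym (A.*-identityˡ 𝟙)
  ⊗-^ p r (suc n) = ≈-trans (⊗-congˡ (⊗-^ p r n))
    (solve 4 (λ p r u v → p :* r :* (u :* v) := p :* u :* (r :* v)) ≈-refl p r (p ^ n) (r ^ n))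

  𝟙-^ : ∀ n → 𝟙 ^ n ≈ 𝟙
  𝟙-^ zero    = ≈-refl
  𝟙-^ (suc n) = ≈-trans (A.*-identityˡ _) (𝟙-^ n)

  ^-+ : ∀ p m n → p ^ (m ℕ.+ n) ≈ p ^ m ⊗ p ^ n
  ^-+ p zero    n = ≈-sym (A.*-identityˡ _)
  ^-+ p (suc m) n = ≈-trans (⊗-congˡ (^-+ p m n)) (≈-sym (A.*-assoc p _ _))

  ^-* : ∀ p m n → (p ^ m) ^ n ≈ p ^ (n ℕ.* m)
  ^-* p m zero    = ≈-refl
  ^-* p m (suc n) = ≈-trans (⊗-congˡ (^-* p m n)) (≈-sym (^-+ p m (n ℕ.* m)))

  ‵-* : ∀ a b → ‵ (a * b) ≈ ‵ a ⊗ ‵ b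
  ‵-* a b = ≈-sym (≈-trans (‵-⊗ a (‵ b)) (coeffwise λ
    { zero → coeff-• a (‵ b) 0
    ; (suc i) → trans (coeff-• a (‵ b) (suc i)) (K.zeroʳ a) }))

  ‵-pow : ∀ a n → ‵ a ^ n ≈ ‵ (pow n a)
  ‵-pow a zero    = ≈-refl
  ‵-pow a (suc n) = ≈-trans (⊗-congˡ (‵-pow a n)) (≈-sym (‵-* a (pow n a)))

  ‵-^card : ∀ a → ‵ a ^ card ≈ ‵ a
  ‵-^card a = ≈-trans (‵-pow a card) (A.reflexive (cong ‵ (fermat a)))

  -- PolyFun k c f: the function f is given by a polynomial of degree at most k over A with k-th coefficient c.
  PolyFun : ℕ → Pol → (Pol → Pol) → Set
  PolyFun zero    c f = ∀ x → f x ≈ c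
  PolyFun (suc k) c f = ∀ a → Σ (Pol → Pol) λ g → PolyFun k c g × (∀ x → f x ⊖ f a ≈ (x ⊖ a) ⊗ g x)

  polyFun-resp : ∀ k {c c′ f f′} → c ≈ c′ → (∀ x → f x ≈ f′ x) → PolyFun k c f → PolyFun k c′ f′
  polyFun-resp zero    e h P x = ≈-trans (≈-sym (h x)) (≈-trans (P x) e)
  polyFun-resp (suc k) {f = f} e h P a with P a
  ... | g , Q , eq = g , polyFun-resp k e (λ x → ≈-refl) Q ,
    λ x → ≈-trans (⊖-cong (≈-sym (h x)) (≈-sym (h a))) (eq x)

  polyFun-⊕ : ∀ k {c c′ f f′} → PolyFun k c f → PolyFun k c′ f′ → PolyFun k (c ⊕ c′) (λ x → f x ⊕ f′ x)
  polyFun-⊕ zero    P P′ x = ⊕-cong (P x) (P′ x)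
  polyFun-⊕ (suc k) {f = f} {f′} P P′ a with P a | P′ a
  ... | g , Q , eq | g′ , Q′ , eq′ = (λ x → g x ⊕ g′ x) , polyFun-⊕ k Q Q′ , λ x →
    ≈-trans (solve 4 (λ u v w z → (u :+ v) :- (w :+ z) := (u :- w) :+ (v :- z)) ≈-refl (f x) (f′ x) (f a) (f′ a))
    (≈-trans (⊕-cong (eq x) (eq′ x)) (≈-sym (A.distribˡ (x ⊖ a) (g x) (g′ x))))

  polyFun-⊗ : ∀ k s {c f} → PolyFun k c f → PolyFun k (s ⊗ c) (λ x → s ⊗ f x)
  polyFun-⊗ zero    s P x = ⊗-congˡ (P x)
  polyFun-⊗ (suc k) s {f = f} P a with P a
  ... | g , Q , eq = (λ x → s ⊗ g x) , polyFun-⊗ k s Q , λ x →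
    ≈-trans (solve 3 (λ s u v → s :* u :- s :* v := s :* (u :- v)) ≈-refl s (f x) (f a))
    (≈-trans (⊗-congˡ (eq x)) (solve 3 (λ s u v → s :* (u :* v) := u :* (s :* v)) ≈-refl s (x ⊖ a) (g x)))

  polyFun-raise : ∀ k {c f} → PolyFun k c f → PolyFun (suc k) [] f
  polyFun-raise zero {c} {f} P a = (λ _ → []) , (λ _ → ≈-refl) , λ x →
    ≈-trans (≈-⊖ (≈-trans (P x) (≈-sym (P a)))) (≈-sym (A.zeroʳ _))
  polyFun-raise (suc k) P a with P a
  ... | g , Q , eq = g , polyFun-raise k Q , eq

  polyFun-const : ∀ k c → PolyFun (suc k) [] (λ _ → c)
  polyFun-const zero    c = polyFun-raise 0 (λ _ → ≈-refl {c})
  polyFun-const (suc k) c = polyFun-raise (suc k) (polyFun-const k c)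

  polyFun-x⊗ : ∀ k {c f} → PolyFun k c f → PolyFun (suc k) c (λ x → x ⊗ f x)
  polyFun-x⊗ zero {c} {f} P a = f , P , λ x →
    ≈-trans (⊕-congˡ (A.-‿cong (⊗-congˡ (≈-trans (P a) (≈-sym (P x))))))
      (solve 3 (λ x a u → x :* u :- a :* u := (x :- a) :* u) ≈-refl x a (f x))
  polyFun-x⊗ (suc k) {c} {f} P a with P a
  ... | g , Q , eq = (λ x → f x ⊕ a ⊗ g x) ,
    polyFun-resp (suc k) (A.+-identityʳ c) (λ _ → ≈-refl) (polyFun-⊕ (suc k) P (polyFun-raise k (polyFun-⊗ k a Q))) ,
    λ x → ≈-trans (solve 4 (λ x a u v → x :* u :- a :* v := (x :- a) :* u :+ a :* (u :- v)) ≈-refl x a (f x) (f a))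
      (≈-trans (⊕-congˡ (⊗-congˡ (eq x)))
        (solve 4 (λ d a u w → d :* u :+ a :* (d :* w) := d :* (u :+ a :* w)) ≈-refl (x ⊖ a) a (f x) (g x)))

  polyFun-^ : ∀ n → PolyFun n 𝟙 (_^ n)
  polyFun-^ zero    = λ _ → ≈-refl
  polyFun-^ (suc n) = polyFun-x⊗ n (polyFun-^ n)

  -- The leading terms cancel: with Δ the difference for the exponent n + 1, the next one is x Δ + b
  -- Δ + b x^(n+1). The top coefficient is left unspecified, since only the degree matters for
  -- counting roots.
  polyFun-Δ : ∀ n b → ∃ λ c → PolyFun n c (λ x → (x ⊕ b) ^ suc n ⊖ x ^ suc n)
  polyFun-Δ zero b = b , λ x →
    ≈-trans (⊖-cong (A.*-identityʳ _) (A.*-identityʳ _)) (solve 2 (λ x b → (x :+ b) :- x := b) ≈-refl x b)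
  polyFun-Δ (suc n) b with polyFun-Δ n b
  ... | c , P = _ , polyFun-resp (suc n) ≈-refl
    (λ x → solve 4 (λ x b u v → x :* (u :- v) :+ b :* (u :- v) :+ b :* v := (x :+ b) :* u :- x :* v)
             ≈-refl x b ((x ⊕ b) ^ suc n) (x ^ suc n))
    (polyFun-⊕ (suc n) (polyFun-⊕ (suc n) (polyFun-x⊗ n P) (polyFun-raise n (polyFun-⊗ n b P)))
       (polyFun-⊗ (suc n) b (polyFun-^ (suc n))))

  -- The hypothesis on z holds for primes and for z = [].
  lagrange : ∀ {z} → (∀ a b → z ∣ a ⊗ b → z ∣ a ⊎ z ∣ b) → ∀ k {c f} → PolyFun k c f →
             (r : Fin (suc k) → Pol) → (∀ i j → z ∣ r i ⊖ r j → i ≡ j) → (∀ i → z ∣ f (r i)) →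
             (∀ x → z ∣ f x) × z ∣ c
  lagrange eu zero P r inj roots = (λ x → ∣-respʳ (≈-sym (P x)) z∣c) , z∣c
    where z∣c = ∣-respʳ (P (r zero)) (roots zero)
  lagrange {z} eu (suc k) {c} {f} P r inj roots with P (r zero)
  ... | g , Q , eq = (λ x → ∣-⊖-cancel (∣-respʳ (≈-sym (eq x)) (∣-⊗ˡ (x ⊖ r zero) (proj₁ ih x))) (roots zero)) , proj₂
      ih
    where
    groots : ∀ i → z ∣ g (r (suc i))
    groots i with eu _ _ (∣-respʳ (eq (r (suc i))) (∣-⊖ (roots (suc i)) (roots zero)))
    ... | inj₂ d = d
    ... | inj₁ d = contradiction (inj (suc i) zero d) λ ()
    ih = lagrange eu k Q (λ i → r (suc i)) (λ i j d → FinP.suc-injective (inj (suc i) (suc j) d)) groots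

  []∣⇒≈[] : ∀ {p} → [] ∣ p → p ≈ []
  []∣⇒≈[] (divides s e) = ≈-trans (≈-sym e) (A.zeroʳ s)

  ‵-injective : ∀ {a b} → ‵ a ≈ ‵ b → a ≡ b
  ‵-injective e = at e 0

  element-injective : ∀ {i j} → element i ≡ element j → i ≡ j
  element-injective e = trans (sym (Inverse.strictlyInverseˡ finite _))
    (trans (cong (Inverse.to finite) e) (Inverse.strictlyInverseˡ finite _))

  private
    -- For b ≠ 0 the function x ↦ (x + b)^q - x^q - b^q has degree at most q - 1, but by Fermat's
    -- theorem it vanishes at the q distinct points c b with c in the field. `lagrange` with modulus
    -- 0 then shows that it vanishes everywhere.
    frobenius-⊕′ : ∀ n → suc (suc n) ≡ card → ∀ a b → (a ⊕ b) ^ card ≈ a ^ card ⊕ b ^ card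
    frobenius-⊕′ n n≡ a b with zero? b
    ... | yes b≈ = ≈-trans (^-cong card (≈-trans (⊕-congˡ b≈) (A.+-identityʳ a)))
                   (≈-sym (≈-trans (⊕-congˡ (≈-trans (^-cong card b≈) 0^card)) (A.+-identityʳ _)))
      where
      0^card : [] ^ card ≈ []
      0^card = subst (λ N → [] ^ N ≈ []) n≡ (A.zeroˡ _)
    ... | no b≉ = ⊖-≈[] (≈-trans
        (solve 3 (λ u v w → u :- (v :+ w) := u :- v :+ :- w) ≈-refl ((a ⊕ b) ^ card) (a ^ card) (b ^ card))
        ([]∣⇒≈[] (proj₁ (lagrange eu (suc n)
          (polyFun-⊕ (suc n) Δ (polyFun-const n (⊝ (b ^ card))))
          (λ i → ‵ (e i) ⊗ b) inj roots) a)))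
      where
      e : Fin (suc (suc n)) → F
      e i = element (subst Fin n≡ i)
      Δ : PolyFun (suc n) (proj₁ (polyFun-Δ (suc n) b)) (λ x → (x ⊕ b) ^ card ⊖ x ^ card)
      Δ = subst (λ N → PolyFun (suc n) (proj₁ (polyFun-Δ (suc n) b)) (λ x → (x ⊕ b) ^ N ⊖ x ^ N)) n≡
            (proj₂ (polyFun-Δ (suc n) b))
      eu : ∀ a b → [] ∣ a ⊗ b → [] ∣ a ⊎ [] ∣ b
      eu a b d with ⊗-integral a b ([]∣⇒≈[] d)
      ... | inj₁ e = inj₁ (∣-reflexive (≈-sym e))
      ... | inj₂ e = inj₂ (∣-reflexive (≈-sym e))
      inj : ∀ i j → [] ∣ ‵ (e i) ⊗ b ⊖ ‵ (e j) ⊗ b → i ≡ j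
      inj i j d = subst-injective n≡ (element-injective (‵-injective (⊗-cancelʳ b≉ (⊖-≈[] ([]∣⇒≈[] d)))))
      scaled : ∀ c → (‵ c ⊗ b) ^ card ≈ ‵ c ⊗ b ^ card
      scaled c = ≈-trans (⊗-^ (‵ c) b card) (⊗-congʳ (‵-^card c))
      ‵-+ : ∀ c → ‵ c ⊕ 𝟙 ≈ ‵ (c K.+ 1#)
      at (‵-+ c) zero = coeff-⊕ (‵ c) 𝟙 0
      at (‵-+ c) (suc i) = trans (coeff-⊕ (‵ c) 𝟙 (suc i)) (K.+-identityˡ 0#)
      roots : ∀ i → [] ∣ (‵ (e i) ⊗ b ⊕ b) ^ card ⊖ (‵ (e i) ⊗ b) ^ card ⊕ (⊝ (b ^ card))
      roots i = ∣-reflexive (≈-sym (begin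
        (‵ c ⊗ b ⊕ b) ^ card ⊖ (‵ c ⊗ b) ^ card ⊕ (⊝ (b ^ card))
          ≈⟨ ⊕-congʳ (⊖-cong (^-cong card (≈-trans
               (⊕-congˡ (≈-sym (A.*-identityˡ b))) (≈-trans (≈-sym (A.distribʳ b (‵ c) 𝟙)) (⊗-congʳ (‵-+ c)))))
                   (scaled c)) ⟩
        (‵ (c K.+ 1#) ⊗ b) ^ card ⊖ ‵ c ⊗ b ^ card ⊕ (⊝ (b ^ card))
          ≈⟨ ⊕-congʳ (⊕-congʳ (≈-trans (scaled (c K.+ 1#)) (⊗-congʳ (≈-sym (‵-+ c))))) ⟩
        (‵ c ⊕ 𝟙) ⊗ b ^ card ⊖ ‵ c ⊗ b ^ card ⊕ (⊝ (b ^ card))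
          ≈⟨ ⊕-congʳ (⊕-congʳ (≈-trans (A.distribʳ _ _ _) (⊕-congˡ (A.*-identityˡ _)))) ⟩
        ‵ c ⊗ b ^ card ⊕ b ^ card ⊖ ‵ c ⊗ b ^ card ⊕ (⊝ (b ^ card))
          ≈⟨ solve 2 (λ u v → u :+ v :- u :+ :- v := u :- u) ≈-refl (‵ c ⊗ b ^ card) (b ^ card) ⟩
        ‵ c ⊗ b ^ card ⊖ ‵ c ⊗ b ^ card
          ≈⟨ A.-‿inverseʳ _ ⟩
        [] ∎))
        where
        open ≈-Reasoning
        c = e i

  frobenius-⊕ : 2 < card → ∀ a b → (a ⊕ b) ^ card ≈ a ^ card ⊕ b ^ card
  frobenius-⊕ 2<card = frobenius-⊕′ (proj₁ n≡) (proj₂ n≡)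
    where
    2+ : ∀ {N} → 2 < N → ∃ λ n → suc (suc n) ≡ N
    2+ (s≤s (s≤s _)) = _ , refl
    n≡ = 2+ 2<card

-- The q-power map modulo a prime.

module Residues (𝔽 : FiniteField) (2<card : 2 < FiniteField.card 𝔽) where
  open Frobenius 𝔽 public
  open FiniteField 𝔽 using (card; 0≢1)
  open A using (solve; _:=_; _:+_; _:*_; _:-_; :-_)

  0<card : 0 < card
  0<card = ℕP.≤-trans (s≤s z≤n) 2<card

  -- The q^i-th power, as an iterate so that additivity and multiplicativity pass from the single
  -- q-th power by induction.
  frob : ℕ → Pol → Pol
  frob zero    p = p
  frob (suc i) p = frob i p ^ card

  frob-cong : ∀ i {p r} → p ≈ r → frob i p ≈ frob i r
  frob-cong zero    e = e
  frob-cong (suc i) e = ^-cong card (frob-cong i e)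

  frob-⊕ : ∀ i p r → frob i (p ⊕ r) ≈ frob i p ⊕ frob i r
  frob-⊕ zero    p r = ≈-refl
  frob-⊕ (suc i) p r = ≈-trans (^-cong card (frob-⊕ i p r)) (frobenius-⊕ 2<card (frob i p) (frob i r))

  frob-⊗ : ∀ i p r → frob i (p ⊗ r) ≈ frob i p ⊗ frob i r
  frob-⊗ zero    p r = ≈-refl
  frob-⊗ (suc i) p r = ≈-trans (^-cong card (frob-⊗ i p r)) (⊗-^ (frob i p) (frob i r) card)

  frob-‵ : ∀ i c → frob i (‵ c) ≈ ‵ c
  frob-‵ zero    c = ≈-refl
  frob-‵ (suc i) c = ≈-trans (^-cong card (frob-‵ i c)) (‵-^card c)

  []-^ : ∀ {n} → 0 < n → [] ^ n ≈ []
  []-^ (s≤s _) = A.zeroˡ _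

  frob-[] : ∀ i → frob i [] ≈ []
  frob-[] zero    = ≈-refl
  frob-[] (suc i) = ≈-trans (^-cong card (frob-[] i)) ([]-^ 0<card)

  frob-⊖ : ∀ i p r → frob i (p ⊖ r) ≈ frob i p ⊖ frob i r
  frob-⊖ i p r = ≈-trans (solve 2 (λ u v → u := (u :+ v) :- v) ≈-refl (frob i (p ⊖ r)) (frob i r))
    (⊕-congʳ (≈-trans (≈-sym (frob-⊕ i (p ⊖ r) r)) (frob-cong i (⊖⊕-cancel p r))))

  frob-+ : ∀ i j p → frob (i ℕ.+ j) p ≡ frob i (frob j p)
  frob-+ zero    j p = refl
  frob-+ (suc i) j p = cong (_^ card) (frob-+ i j p)

  frob-suc : ∀ i p → frob (suc i) p ≡ frob i (p ^ card)
  frob-suc zero    p = refl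
  frob-suc (suc i) p = cong (_^ card) (frob-suc i p)

  frob-^ : ∀ i p → frob i p ≈ p ^ (card ℕ.^ i)
  frob-^ zero    p = ≈-sym (A.*-identityʳ p)
  frob-^ (suc i) p = ≈-trans (^-cong card (frob-^ i p)) (^-* p (card ℕ.^ i) card)

  ∣-^ : ∀ {p n} → 0 < n → p ∣ p ^ n
  ∣-^ {p} {suc n} _ = ∣-⊗ʳ (p ^ n) ∣-refl

  θ : ℕ → Pol
  θ i = frob i T

  module _ {z : Pol} where
    -- The map is additive and multiplicative and fixes constants, so it is determined modulo z by
    -- the image of T.
    frob-fixes : ∀ i → z ∣ θ i ⊖ T → ∀ f → z ∣ frob i f ⊖ f
    frob-fixes i d [] = ≈⇒∣⊖ (frob-[] i)
    frob-fixes i d (c ∷ f) = ∣-respʳ (≈-sym eq) (∣-⊕ (∣-⊗ʳ (frob i f) d) (∣-⊗ˡ T (frob-fixes i d f)))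
      where
      eq : frob i (c ∷ f) ⊖ (c ∷ f) ≈ (θ i ⊖ T) ⊗ frob i f ⊕ T ⊗ (frob i f ⊖ f)
      eq = begin
        frob i (c ∷ f) ⊖ (c ∷ f)
          ≈⟨ ⊖-cong (≈-trans (frob-cong i (∷-split c f))
              (≈-trans (frob-⊕ i (‵ c) (T ⊗ f)) (⊕-cong (frob-‵ i c) (frob-⊗ i T f)))) (∷-split c f) ⟩
        (‵ c ⊕ θ i ⊗ frob i f) ⊖ (‵ c ⊕ T ⊗ f)
          ≈⟨ solve 5 (λ c x y t f → (c :+ x :* y) :- (c :+ t :* f) := (x :- t) :* y :+ t :* (y :- f)) ≈-refl (‵ c)
              (θ i) (frob i f) T f ⟩
        (θ i ⊖ T) ⊗ frob i f ⊕ T ⊗ (frob i f ⊖ f) ∎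
        where open ≈-Reasoning

  -- The digits of the index in base q serve as coefficients. For n = deg π these are pairwise
  -- incongruent residues modulo π.
  enumerate : ∀ n → Fin (card ℕ.^ n) → Pol
  enumerate zero    _ = []
  enumerate (suc n) k = element (proj₁ (remQuot {card} (card ℕ.^ n) k)) ∷ enumerate n
      (proj₂ (remQuot {card} (card ℕ.^ n) k))

  enumerate-injective : ∀ n i j → enumerate n i ≈ enumerate n j → i ≡ j
  enumerate-injective zero zero zero e = refl
  enumerate-injective (suc n) i j e = begin
    i                                             ≡⟨ FinP.combine-remQuot {card} (card ℕ.^ n) i ⟨
    uncurry combine (remQuot {card} (card ℕ.^ n) i)
      ≡⟨ cong₂ combine (element-injective (at e 0)) (enumerate-injective n _ _ (coeffwise (λ k → at e (suc k)))) ⟩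
    uncurry combine (remQuot {card} (card ℕ.^ n) j)   ≡⟨ FinP.combine-remQuot {card} (card ℕ.^ n) j ⟩
    j                                             ∎
    where open ≡-Reasoning

  below-enumerate : ∀ n k → Below n (enumerate n k)
  below-enumerate zero    k = λ _ _ → refl
  below-enumerate (suc n) k = below-∷ _ _ (below-enumerate n _)

  evaluate : Pol → Pol → Pol
  evaluate []      x = []
  evaluate (c ∷ f) x = ‵ c ⊕ x ⊗ evaluate f x

  evaluate-T : ∀ f → evaluate f T ≈ f
  evaluate-T []      = ≈-refl
  evaluate-T (c ∷ f) = ≈-trans (⊕-congˡ (⊗-congˡ (evaluate-T f))) (≈-sym (∷-split c f))

  frob-evaluate : ∀ i f x → frob i (evaluate f x) ≈ evaluate f (frob i x)
  frob-evaluate i []      x = frob-[] i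
  frob-evaluate i (c ∷ f) x = ≈-trans (frob-⊕ i (‵ c) _)
    (⊕-cong (frob-‵ i c) (≈-trans (frob-⊗ i x _) (⊗-congˡ (frob-evaluate i f x))))

  evaluate-zero : ∀ {f} → f ≈ [] → ∀ x → evaluate f x ≈ []
  evaluate-zero {[]}    e x = ≈-refl
  evaluate-zero {c ∷ f} e x = begin
    ‵ c ⊕ x ⊗ evaluate f x
      ≈⟨ ⊕-cong (≈-trans (A.reflexive (cong ‵ (at e 0))) (0∷[]≈[] ≈-refl))
          (⊗-congˡ (evaluate-zero {f} (coeffwise (λ i → at e (suc i))) x)) ⟩
    [] ⊕ x ⊗ []            ≈⟨ ≈-trans (A.+-identityˡ _) (A.zeroʳ x) ⟩
    []                     ∎
    where open ≈-Reasoning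

  polyFun-evaluate : ∀ {d f} → Mon d f → PolyFun d 𝟙 (evaluate f)
  polyFun-evaluate {zero} {[]} (mkMon l a) = contradiction l 0≢1
  polyFun-evaluate {zero} {c ∷ f} (mkMon l a) x =
    ≈-trans (⊕-cong (A.reflexive (cong ‵ l)) (⊗-congˡ (evaluate-zero {f} (below-0 (below-tail c f a)) x)))
      (≈-trans (⊕-congˡ (A.zeroʳ x)) (A.+-identityʳ 𝟙))
  polyFun-evaluate {suc d} {[]} (mkMon l a) = contradiction l 0≢1
  polyFun-evaluate {suc d} {c ∷ f} (mkMon l a) = polyFun-resp (suc d) (A.+-identityˡ 𝟙) (λ _ → ≈-refl)
    (polyFun-⊕ (suc d) (polyFun-const d (‵ c)) (polyFun-x⊗ d (polyFun-evaluate {d} {f} (mkMon l (below-tail c f a)))))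

  module _ {d π} (P : Prime d π) where
    open Prime P

    prime-∣-^ : ∀ n {p} → π ∣ p ^ n → π ∣ p
    prime-∣-^ zero    d = contradiction d ∤𝟙
    prime-∣-^ (suc n) {p} d with euclid p (p ^ n) d
    ... | inj₁ e = e
    ... | inj₂ e = prime-∣-^ n e

    prime-∣-frob : ∀ i {p} → π ∣ frob i p → π ∣ p
    prime-∣-frob zero    d = d
    prime-∣-frob (suc i) d = prime-∣-frob i (prime-∣-^ card d)

    incongruent : ∀ {p r} → Below d p → Below d r → π ∣ p ⊖ r → p ≈ r
    incongruent {p} {r} b c div = ⊖-≈[] (∤small (λ i le → trans (coeff-⊖ p r i)
      (trans (cong₂ (λ u v → u K.+ K.- v) (b i le) (c i le)) (K.-‿inverseʳ 0#))) div)

    private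
      1<card^ : ∀ i → 1 < card ℕ.^ suc i
      1<card^ i = ℕP.≤-trans (ℕP.<⇒≤ 2<card) (ℕP.≤-trans (ℕP.≤-reflexive (sym (ℕP.*-identityʳ card)))
        (ℕP.*-monoʳ-≤ card (ℕP.m^n>0 card {{ℕ.>-nonZero 0<card}} i)))

      -- x^N - x would have q^d pairwise incongruent roots modulo π, more than its degree N, so π
      -- would divide its leading coefficient 1.
      power-fixes-no : ∀ N → 1 < N → N < card ℕ.^ d → (∀ f → π ∣ f ^ N ⊖ f) → ∀ {A : Set} → A
      power-fixes-no (suc zero) (s≤s ()) _ _
      power-fixes-no (suc (suc n)) _ lt fix = contradiction (proj₂ (lagrange euclid (suc (suc n))
          (polyFun-resp (suc (suc n)) (A.+-identityʳ 𝟙)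
            (λ x → ⊕-congˡ (⊕-cong-⊝ x))
            (polyFun-⊕ (suc (suc n)) (polyFun-^ (suc (suc n)))
                (raise n (polyFun-⊗ 1 (⊝ 𝟙) (polyFun-x⊗ 0 {𝟙} (λ _ → ≈-refl))))))
          (λ i → enumerate d (inject≤ i lt))
          (λ i j div → FinP.inject≤-injective lt lt i j
              (enumerate-injective d _ _ (incongruent (below-enumerate d _) (below-enumerate d _) div)))
          (λ i → fix _))) ∤𝟙
        where
        ⊕-cong-⊝ : ∀ x → (⊝ 𝟙) ⊗ (x ⊗ 𝟙) ≈ ⊝ x
        ⊕-cong-⊝ x = ≈-trans (≈-sym (A.-‿distribˡ-* 𝟙 _)) (A.-‿cong (≈-trans (A.*-identityˡ _) (A.*-identityʳ x)))
        raise : ∀ n {c f} → PolyFun 1 c f → PolyFun (suc (suc n)) [] f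
        raise zero    P = polyFun-raise 1 P
        raise (suc n) P = polyFun-raise (suc (suc n)) (raise n P)

    -- If T were fixed by the q^i-th power modulo π, every residue would be, although q^i < q^d.
    θ-not-fixed : ∀ {i} → 0 < i → i < d → ¬ π ∣ θ i ⊖ T
    θ-not-fixed {suc i} _ i<d div = power-fixes-no (card ℕ.^ suc i) (1<card^ i)
      (ℕP.^-monoʳ-< card (ℕP.<⇒≤ 2<card) i<d)
      (λ f → ∣-respʳ (⊖-cong (frob-^ (suc i) f) ≈-refl) (frob-fixes (suc i) div f))

    -- T, T^q, ..., T^(q^d) are roots of π mod π, too many to be distinct.
    θ-fixed : π ∣ θ d ⊖ T
    θ-fixed with π ∣? θ d ⊖ T
    ... | yes div = div
    ... | no ¬div = contradiction (proj₂ (lagrange euclid d (polyFun-evaluate monic) (λ i → θ (toℕ i))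
          (λ i j div → FinP.toℕ-injective (distinct (toℕ i) (toℕ j) (ℕP.≤-pred (FinP.toℕ<n i))
              (ℕP.≤-pred (FinP.toℕ<n j)) div))
          (λ i → ∣-respʳ (≈-trans (frob-cong (toℕ i) (≈-sym (evaluate-T π))) (frob-evaluate (toℕ i) π T))
              (π∣frob (toℕ i))))) ∤𝟙
      where
      π∣frob : ∀ i → π ∣ frob i π
      π∣frob zero    = ∣-refl
      π∣frob (suc i) = ∣-trans (π∣frob i) (∣-^ 0<card)
      not-fixed : ∀ k → 0 < k → k ≤ d → ¬ π ∣ θ k ⊖ T
      not-fixed k 0<k k≤d with ℕP.m≤n⇒m<n∨m≡n k≤d
      ... | inj₁ k<d  = θ-not-fixed 0<k k<d
      ... | inj₂ refl = ¬div
      -- θ_j - θ_i is the q^i-th power of θ_(j-i) - T, so a coincidence among the roots already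
      -- shows up at the start of the sequence.
      apart : ∀ i j → i < j → j ≤ d → ¬ π ∣ θ j ⊖ θ i
      apart i j i<j j≤d div with ℕP.m≤n⇒∃[o]m+o≡n (ℕP.<⇒≤ i<j)
      ... | k , refl = not-fixed k (ℕP.n≢0⇒n>0 λ { refl → ℕP.<-irrefl (sym (ℕP.+-identityʳ i)) i<j })
        (ℕP.≤-trans (ℕP.m≤n+m k i) j≤d)
        (prime-∣-frob i (∣-respʳ (≈-trans (⊖-cong (A.reflexive (frob-+ i k T)) ≈-refl) (≈-sym (frob-⊖ i (θ k) T)))
            div))
      distinct : ∀ i j → i ≤ d → j ≤ d → π ∣ θ i ⊖ θ j → i ≡ j
      distinct i j i≤d j≤d div with ℕP.<-cmp i j
      ... | tri< i<j _ _ = contradiction (∣-⊖-sym (θ i) (θ j) div) (apart i j i<j j≤d)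
      ... | tri≈ _ e _   = e
      ... | tri> _ _ j<i = contradiction div (apart j i j<i i≤d)

    frob-fixed : ∀ v → π ∣ frob d v ⊖ v
    frob-fixed = frob-fixes d θ-fixed

-- The Carlitz module.

module Carlitz (𝔽 : FiniteField) (2<card : 2 < FiniteField.card 𝔽) where
  open Residues 𝔽 2<card public
  open FiniteField 𝔽 using (card; 0≢1)
  open A using (solve; _:=_; _:+_; _:*_; _:-_; :-_)
  private module D = Poly 𝔽

  CT : Pol → Pol
  CT v = T ⊗ v ⊕ v ^ card

  -- Horner form of the sum over iterates in the statement: C_(c + T a)(v) = c v + C_a(C_T(v)).
  C : Pol → Pol → Pol
  C []      v = []
  C (c ∷ a) v = ‵ c ⊗ v ⊕ C a (CT v)

  private
    ^-def : ∀ p n → p D.^ n ≡ p ^ n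
    ^-def p zero    = refl
    ^-def p (suc n) = trans (cong (p D.⊗_) (^-def p n)) (sym (⊗-def p _))

    CT-def : ∀ v → D.CT v ≡ CT v
    CT-def v = trans (cong₂ D._⊕_ (sym (⊗-def T v)) (^-def v card)) (sym (⊕-def _ _))

    CTiter-suc : ∀ i v → D.CTiter (suc i) v ≡ D.CTiter i (CT v)
    CTiter-suc zero    v = CT-def v
    CTiter-suc (suc i) v = cong D.CT (CTiter-suc i v)

    carlitzFrom-suc : ∀ i a v → D.carlitzFrom (suc i) a v ≡ D.carlitzFrom i a (CT v)
    carlitzFrom-suc i []      v = refl
    carlitzFrom-suc i (c ∷ a) v = cong₂ D._⊕_ (cong (c D.•_) (CTiter-suc i v)) (carlitzFrom-suc (suc i) a v)

  C-def : ∀ a v → D.C a v ≈ C a v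
  C-def []      v = ≈-refl
  C-def (c ∷ a) v = begin
    (c D.• v) D.⊕ D.carlitzFrom 1 a v    ≡⟨ cong₂ D._⊕_ (sym (•-def c v)) (carlitzFrom-suc 0 a v) ⟩
    (c • v) D.⊕ D.C a (CT v)             ≡⟨ ⊕-def _ _ ⟨
    c • v ⊕ D.C a (CT v)                 ≈⟨ ⊕-cong (≈-sym (‵-⊗ c v)) (C-def a (CT v)) ⟩
    ‵ c ⊗ v ⊕ C a (CT v)                 ∎
    where open ≈-Reasoning

  CT-cong : ∀ {v w} → v ≈ w → CT v ≈ CT w
  CT-cong e = ⊕-cong (⊗-congˡ e) (^-cong card e)

  C-congʳ : ∀ a {v w} → v ≈ w → C a v ≈ C a w
  C-congʳ []      e = ≈-refl
  C-congʳ (c ∷ a) e = ⊕-cong (⊗-congˡ e) (C-congʳ a (CT-cong e))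

  ‵0≈[] : ∀ {c} → c ≡ 0# → ‵ c ≈ []
  ‵0≈[] refl = 0∷[]≈[] ≈-refl

  tail-≈[] : ∀ {c a} → c ∷ a ≈ [] → a ≈ []
  at (tail-≈[] e) i = at e (suc i)

  C-zeroˡ : ∀ {a} v → a ≈ [] → C a v ≈ []
  C-zeroˡ {[]}    v e = ≈-refl
  C-zeroˡ {c ∷ a} v e = ≈-trans (⊕-cong (≈-trans (⊗-congʳ (‵0≈[] (at e 0))) (A.zeroˡ v))
      (C-zeroˡ (CT v) (tail-≈[] e)))
    (A.+-identityʳ [])

  C-congˡ : ∀ {a b} v → a ≈ b → C a v ≈ C b v
  C-congˡ {[]}    {b}     v e = ≈-sym (C-zeroˡ v (≈-sym e))
  C-congˡ {c ∷ a} {[]}    v e = C-zeroˡ v e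
  C-congˡ {c ∷ a} {d ∷ b} v e = ⊕-cong (⊗-congʳ (A.reflexive (cong ‵ (at e 0))))
      (C-congˡ {a} {b} (CT v) (coeffwise λ i → at e (suc i)))

  ∷-⊕-∷ : ∀ c d a b → (c ∷ a) ⊕ (d ∷ b) ≈ (c K.+ d) ∷ (a ⊕ b)
  at (∷-⊕-∷ c d a b) zero    = coeff-⊕ (c ∷ a) (d ∷ b) 0
  at (∷-⊕-∷ c d a b) (suc i) = trans (coeff-⊕ (c ∷ a) (d ∷ b) (suc i)) (sym (coeff-⊕ a b i))

  ‵-+ : ∀ c d → ‵ c ⊕ ‵ d ≈ ‵ (c K.+ d)
  ‵-+ c d = ≈-trans (∷-⊕-∷ c d [] []) (∷-cong refl (A.+-identityʳ []))

  •-∷ : ∀ c d a → c • (d ∷ a) ≈ (c K.* d) ∷ (c • a)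
  at (•-∷ c d a) zero    = coeff-• c (d ∷ a) 0
  at (•-∷ c d a) (suc i) = trans (coeff-• c (d ∷ a) (suc i)) (sym (coeff-• c a i))

  C-⊕ˡ : ∀ a b v → C (a ⊕ b) v ≈ C a v ⊕ C b v
  C-⊕ˡ []      b       v = ≈-trans (C-congˡ v (A.+-identityˡ b)) (≈-sym (A.+-identityˡ _))
  C-⊕ˡ (c ∷ a) []      v = ≈-trans (C-congˡ v (A.+-identityʳ (c ∷ a))) (≈-sym (A.+-identityʳ _))
  C-⊕ˡ (c ∷ a) (d ∷ b) v = begin
    C ((c ∷ a) ⊕ (d ∷ b)) v                                  ≈⟨ C-congˡ v (∷-⊕-∷ c d a b) ⟩
    ‵ (c K.+ d) ⊗ v ⊕ C (a ⊕ b) (CT v)                       ≈⟨ ⊕-cong (⊗-congʳ (≈-sym (‵-+ c d))) (C-⊕ˡ a b (CT v)) ⟩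
    (‵ c ⊕ ‵ d) ⊗ v ⊕ (C a (CT v) ⊕ C b (CT v))
      ≈⟨ solve 5 (λ c d v x y → (c :+ d) :* v :+ (x :+ y) := c :* v :+ x :+ (d :* v :+ y)) ≈-refl (‵ c) (‵ d) v _ _ ⟩
    (‵ c ⊗ v ⊕ C a (CT v)) ⊕ (‵ d ⊗ v ⊕ C b (CT v))          ∎
    where open ≈-Reasoning

  C-• : ∀ c a v → C (c • a) v ≈ ‵ c ⊗ C a v
  C-• c []      v = ≈-trans (C-zeroˡ v (≈-trans (≈-sym (‵-⊗ c [])) (A.zeroʳ _))) (≈-sym (A.zeroʳ _))
  C-• c (d ∷ a) v = begin
    C (c • (d ∷ a)) v                              ≈⟨ C-congˡ v (•-∷ c d a) ⟩
    ‵ (c K.* d) ⊗ v ⊕ C (c • a) (CT v)             ≈⟨ ⊕-cong (⊗-congʳ (‵-* c d)) (C-• c a (CT v)) ⟩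
    ‵ c ⊗ ‵ d ⊗ v ⊕ ‵ c ⊗ C a (CT v)
      ≈⟨ solve 4 (λ c d v x → c :* d :* v :+ c :* x := c :* (d :* v :+ x)) ≈-refl (‵ c) (‵ d) v _ ⟩
    ‵ c ⊗ (‵ d ⊗ v ⊕ C a (CT v))                   ∎
    where open ≈-Reasoning

  C-⊝ : ∀ a v → C (⊝ a) v ≈ ⊝ C a v
  C-⊝ a v = ≈-trans (solve 2 (λ x y → x := (x :+ y) :- y) ≈-refl (C (⊝ a) v) (C a v))
    (≈-trans (⊕-congʳ (≈-trans (≈-sym (C-⊕ˡ (⊝ a) a v)) (C-zeroˡ v (A.-‿inverseˡ a)))) (A.+-identityˡ _))

  C-⊖ˡ : ∀ a b v → C (a ⊖ b) v ≈ C a v ⊖ C b v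
  C-⊖ˡ a b v = ≈-trans (C-⊕ˡ a (⊝ b) v) (⊕-congˡ (C-⊝ b v))

  C-𝟙 : ∀ v → C 𝟙 v ≈ v
  C-𝟙 v = ≈-trans (A.+-identityʳ _) (A.*-identityˡ v)

  CT-⊕ : ∀ v w → CT (v ⊕ w) ≈ CT v ⊕ CT w
  CT-⊕ v w = ≈-trans (⊕-congˡ (frobenius-⊕ 2<card v w))
    (solve 5 (λ t v w x y → t :* (v :+ w) :+ (x :+ y) := t :* v :+ x :+ (t :* w :+ y)) ≈-refl T v w _ _)

  CT-‵ : ∀ c v → CT (‵ c ⊗ v) ≈ ‵ c ⊗ CT v
  CT-‵ c v = ≈-trans (⊕-congˡ (≈-trans (⊗-^ (‵ c) v card) (⊗-congʳ (‵-^card c))))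
    (solve 4 (λ t c v x → t :* (c :* v) :+ c :* x := c :* (t :* v :+ x)) ≈-refl T (‵ c) v _)

  CT-[] : CT [] ≈ []
  CT-[] = ≈-trans (⊕-cong (A.zeroʳ T) ([]-^ 0<card)) (A.+-identityʳ [])

  C-CT : ∀ a v → C a (CT v) ≈ CT (C a v)
  C-CT []      v = ≈-sym CT-[]
  C-CT (c ∷ a) v = ≈-trans (⊕-cong (≈-sym (CT-‵ c v)) (C-CT a (CT v))) (≈-sym (CT-⊕ _ _))

  C-⊗ : ∀ a b v → C (a ⊗ b) v ≈ C a (C b v)
  C-⊗ []      b v = C-zeroˡ v (A.zeroˡ b)
  C-⊗ (c ∷ a) b v = begin
    C ((c ∷ a) ⊗ b) v                     ≈⟨ C-congˡ v (∷-⊗ c a b) ⟩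
    C (c • b ⊕ (0# ∷ a ⊗ b)) v            ≈⟨ C-⊕ˡ (c • b) (0# ∷ a ⊗ b) v ⟩
    C (c • b) v ⊕ C (0# ∷ a ⊗ b) v
      ≈⟨ ⊕-cong (C-• c b v) (≈-trans (⊕-congʳ (≈-trans (⊗-congʳ (‵0≈[] refl)) (A.zeroˡ v))) (A.+-identityˡ _)) ⟩
    ‵ c ⊗ C b v ⊕ C (a ⊗ b) (CT v)        ≈⟨ ⊕-congˡ (≈-trans (C-⊗ a b (CT v)) (C-congʳ a (C-CT b v))) ⟩
    ‵ c ⊗ C b v ⊕ C a (CT (C b v))        ∎
    where open ≈-Reasoning

  ∣CT : ∀ v → v ∣ CT v
  ∣CT v = ∣-⊕ (∣-⊗ˡ T ∣-refl) (∣-^ 0<card)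

  ∣C : ∀ a v → v ∣ C a v
  ∣C []      v = ∣-zero
  ∣C (c ∷ a) v = ∣-⊕ (∣-⊗ˡ (‵ c) ∣-refl) (∣-trans (∣CT v) (∣C a (CT v)))

  C-∣ : ∀ {a b} v → a ∣ b → C a v ∣ C b v
  C-∣ {a} v (divides s e) = ∣-respʳ (≈-trans (≈-sym (C-⊗ s a v)) (C-congˡ v e)) (∣C s (C a v))

  -- This is where q > 2 is decisive: v^q is divisible by v^3, so C_T(v) ≡ T v modulo v^3.
  CT-linear : ∀ v → ∃ λ s → CT v ≈ v ⊗ (T ⊕ v ⊗ (v ⊗ s))
  CT-linear v = s , ≈-trans (⊕-congˡ (proj₂ power))
      (solve 3 (λ t v s → t :* v :+ v :* (v :* (v :* s)) := v :* (t :+ v :* (v :* s))) ≈-refl T v s)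
    where
    power : ∃ λ s → v ^ card ≈ v ⊗ (v ⊗ (v ⊗ s))
    power = lemma 2<card
      where
      lemma : ∀ {n} → 2 < n → ∃ λ s → v ^ n ≈ v ⊗ (v ⊗ (v ⊗ s))
      lemma {suc (suc (suc n))} _ = v ^ n , ≈-refl
      lemma {suc (suc zero)} (s≤s (s≤s ()))
      lemma {suc zero} (s≤s ())
    s = proj₁ power

  -- The congruence C_T(v) ≡ T v modulo v^3 is preserved under iteration and linear combination,
  -- which gives C_a(v) ≡ a v modulo v^3.
  C-linear : ∀ a v → ∃ λ s → C a v ≈ v ⊗ (a ⊕ v ⊗ (v ⊗ s))
  C-linear [] v = [] , ≈-sym (≈-trans (solve 1 (λ v → v :* (A.num 0 :+ v :* (v :* A.num 0)) := A.num 0) ≈-refl v)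
      ≈-refl)
  C-linear (c ∷ a) v with CT-linear v | C-linear a (CT v)
  ... | s , e | s′ , e′ = _ , (begin
    ‵ c ⊗ v ⊕ C a (CT v)                        ≈⟨ ⊕-congˡ e′ ⟩
    ‵ c ⊗ v ⊕ CT v ⊗ (a ⊕ CT v ⊗ (CT v ⊗ s′))   ≈⟨ ⊕-congˡ (⊗-cong e (⊕-congˡ (⊗-cong e (⊗-congʳ e)))) ⟩
    ‵ c ⊗ v ⊕ v ⊗ x ⊗ (a ⊕ v ⊗ x ⊗ (v ⊗ x ⊗ s′))  ≈⟨ solve 6 (λ c v t s a s′ →
        let x = t :+ v :* (v :* s) in
        c :* v :+ v :* x :* (a :+ v :* x :* (v :* x :* s′)) := v :*
            (c :+ t :* a :+ v :* (v :* (s :* a :+ x :* x :* x :* s′)))) ≈-refl (‵ c) v T s a s′ ⟩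
    v ⊗ (‵ c ⊕ T ⊗ a ⊕ v ⊗ (v ⊗ (s ⊗ a ⊕ x ⊗ x ⊗ x ⊗ s′)))  ≈⟨ ⊗-congˡ (⊕-congʳ (∷-split c a)) ⟨
    v ⊗ ((c ∷ a) ⊕ v ⊗ (v ⊗ (s ⊗ a ⊕ x ⊗ x ⊗ x ⊗ s′)))      ∎)
    where
    open ≈-Reasoning
    x = T ⊕ v ⊗ (v ⊗ s)

  mon-^ : ∀ {d p} n → Mon d p → Mon (n ℕ.* d) (p ^ n)
  mon-^ zero    m = mon-𝟙
  mon-^ (suc n) m = mon-⊗ m (mon-^ n m)

  mon-T : Mon 1 T
  mon-T = mkMon refl (below-length T)

  mon-CT : ∀ {d v} → 0 < d → Mon d v → Mon (card ℕ.* d) (CT v)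
  mon-CT {d} {v} 0<d m = mon-⊕ʳ (T ⊗ v) (v ^ card)
    (below-mono (T ⊗ v) lt (Mon.above (mon-⊗ mon-T m))) (mon-^ card m)
    where
    lt : suc (1 ℕ.+ d) ≤ card ℕ.* d
    lt = ℕP.≤-trans (ℕP.≤-trans (ℕP.+-monoˡ-≤ d (ℕP.+-mono-≤ 0<d 0<d)) (ℕP.≤-reflexive lemma)) (ℕP.*-monoˡ-≤ d 2<card)
      where
      lemma : d ℕ.+ d ℕ.+ d ≡ 3 ℕ.* d
      lemma = trans (ℕP.+-assoc d d d) (cong (λ x → d ℕ.+ (d ℕ.+ x)) (sym (ℕP.+-identityʳ d)))

  below-‵⊗ : ∀ c {n p} → Below n p → Below n (‵ c ⊗ p)
  below-‵⊗ c {p = p} b = below-resp (≈-sym (‵-⊗ c p)) (below-• c p b)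

  mon-C : ∀ {k d g v} → 0 < d → Mon k g → Mon d v → Mon (d ℕ.* card ℕ.^ k) (C g v)
  mon-C {zero} {d} {g} {v} 0<d mg mv = subst (λ n → Mon n (C g v)) (sym (ℕP.*-identityʳ d))
    (mon-resp (≈-sym (≈-trans (C-congˡ v (mon-0 mg)) (C-𝟙 v))) mv)
  mon-C {suc k} {g = []} 0<d (mkMon l a) mv = contradiction l 0≢1
  mon-C {suc k} {d} {c ∷ g} {v} 0<d (mkMon l a) mv = subst (λ n → Mon n (C (c ∷ g) v)) eq
    (mon-⊕ʳ (‵ c ⊗ v) (C g (CT v)) (below-mono (‵ c ⊗ v) lt (below-‵⊗ c (Mon.above mv)))
      (mon-C {k} {g = g} (ℕP.≤-trans 0<d d≤) (mkMon l (below-tail c g a)) (mon-CT 0<d mv)))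
    where
    eq : card ℕ.* d ℕ.* card ℕ.^ k ≡ d ℕ.* card ℕ.^ suc k
    eq = trans (cong (ℕ._* card ℕ.^ k) (ℕP.*-comm card d)) (ℕP.*-assoc d card (card ℕ.^ k))
    d≤ : d ≤ card ℕ.* d
    d≤ = ℕP.m≤n*m d card {{ℕ.>-nonZero 0<card}}
    d< : suc d ≤ card ℕ.* d
    d< = ℕP.≤-trans (ℕP.+-monoˡ-≤ d 0<d)
        (ℕP.≤-trans (ℕP.≤-reflexive (cong (d ℕ.+_) (sym (ℕP.+-identityʳ d)))) (ℕP.*-monoˡ-≤ d (ℕP.<⇒≤ 2<card)))
    lt : suc d ≤ card ℕ.* d ℕ.* card ℕ.^ k
    lt = ℕP.≤-trans d< (ℕP.m≤m*n (card ℕ.* d) (card ℕ.^ k) {{ℕ.>-nonZero (ℕP.m^n>0 card {{ℕ.>-nonZero 0<card}} k)}})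

  CT-𝟙 : CT 𝟙 ≈ T ⊕ 𝟙
  CT-𝟙 = ⊕-cong (A.*-identityʳ T) (𝟙-^ card)

  mon-T⊕ : ∀ c → Mon 1 (T ⊕ ‵ c)
  mon-T⊕ c = mon-⊕ T (‵ c) mon-T (below-length (‵ c))

  -- C_T(1) = T + 1 has degree only 1, so the multiplication of degrees by q sets in one step later
  -- than for a nonconstant argument.
  mon-C-𝟙 : ∀ {k g} → Mon (suc k) g → Mon (card ℕ.^ k) (C g 𝟙)
  mon-C-𝟙 {k} {[]} (mkMon l a) = contradiction l 0≢1
  mon-C-𝟙 {k} {c ∷ g} (mkMon l a) = mon-⊕ʳ (‵ c ⊗ 𝟙) (C g (CT 𝟙))
    (below-mono (‵ c ⊗ 𝟙) (ℕP.m^n>0 card {{ℕ.>-nonZero 0<card}} k) (below-‵⊗ c (below-length 𝟙)))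
    (subst (λ n → Mon n (C g (CT 𝟙))) (ℕP.*-identityˡ _)
      (mon-C {k} {g = g} (s≤s z≤n) (mkMon l (below-tail c g a)) (mon-resp (≈-sym CT-𝟙) (mon-T⊕ 1#))))

  -- C_f(v) = Σ α i f · v^(q^i)
  α : ℕ → Pol → Pol
  α i       []      = []
  α zero    (c ∷ f) = ‵ c ⊕ T ⊗ α zero f
  α (suc i) (c ∷ f) = θ (suc i) ⊗ α (suc i) f ⊕ α i f

  α-zero : ∀ f → α 0 f ≈ f
  α-zero []      = ≈-refl
  α-zero (c ∷ f) = ≈-trans (⊕-congˡ (⊗-congˡ (α-zero f))) (≈-sym (∷-split c f))

  -- This is the comparison of the coefficients of v^(q^(i+1)) in C_T(C_f(v)) = C_f(C_T(v)). It is
  -- proved by induction on `f` along the recursion for `α`.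
  α-recurrence : ∀ i f → (θ (suc i) ⊖ T) ⊗ α (suc i) f ≈ α i f ^ card ⊖ α i f
  α-recurrence i [] = ≈-trans (A.zeroʳ _) (≈-sym (≈-trans (⊖-cong ([]-^ 0<card) ≈-refl) (A.-‿inverseʳ [])))
  α-recurrence zero (c ∷ f) = begin
    (t′ ⊖ T) ⊗ (t′ ⊗ b ⊕ a)
      ≈⟨ solve 4 (λ t′ t a b → (t′ :- t) :* (t′ :* b :+ a) := t′ :* ((t′ :- t) :* b) :+ (t′ :- t) :* a) ≈-refl t′ T a
          b ⟩
    t′ ⊗ ((t′ ⊖ T) ⊗ b) ⊕ (t′ ⊖ T) ⊗ a           ≈⟨ ⊕-congʳ (⊗-congˡ (α-recurrence 0 f)) ⟩
    t′ ⊗ (a ^ card ⊖ a) ⊕ (t′ ⊖ T) ⊗ a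
      ≈⟨ solve 5 (λ t′ t a b c → t′ :* (b :- a) :+ (t′ :- t) :* a := (c :+ t′ :* b) :- (c :+ t :* a)) ≈-refl t′ T a
          (a ^ card) (‵ c) ⟩
    (‵ c ⊕ t′ ⊗ a ^ card) ⊖ (‵ c ⊕ T ⊗ a)
      ≈⟨ ⊖-cong (≈-trans (frobenius-⊕ 2<card (‵ c) (T ⊗ a)) (⊕-cong (‵-^card c) (⊗-^ T a card))) ≈-refl ⟨
    (‵ c ⊕ T ⊗ a) ^ card ⊖ (‵ c ⊕ T ⊗ a)         ∎
    where
    open ≈-Reasoning
    t′ = θ 1
    a = α 0 f
    b = α 1 f
  α-recurrence (suc i) (c ∷ f) = begin
    (t″ ⊖ T) ⊗ (t″ ⊗ α (suc (suc i)) f ⊕ b)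
      ≈⟨ solve 4 (λ t′ t a b → (t′ :- t) :* (t′ :* b :+ a) := t′ :* ((t′ :- t) :* b) :+ (t′ :- t) :* a) ≈-refl t″ T b
          (α (suc (suc i)) f) ⟩
    t″ ⊗ ((t″ ⊖ T) ⊗ α (suc (suc i)) f) ⊕ (t″ ⊖ T) ⊗ b ≈⟨ ⊕-congʳ (⊗-congˡ (α-recurrence (suc i) f)) ⟩
    t″ ⊗ (b ^ card ⊖ b) ⊕ (t″ ⊖ T) ⊗ b
      ≈⟨ solve 5 (λ t″ t′ t b b′ → t″ :* (b′ :- b) :+ (t″ :- t) :* b := t″ :* b′ :+ (t′ :- t) :* b :- t′ :* b) ≈-refl
          t″ t′ T b (b ^ card) ⟩
    t″ ⊗ b ^ card ⊕ (t′ ⊖ T) ⊗ b ⊖ t′ ⊗ b        ≈⟨ ⊕-congʳ (⊕-congˡ (α-recurrence i f)) ⟩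
    t″ ⊗ b ^ card ⊕ (a ^ card ⊖ a) ⊖ t′ ⊗ b
      ≈⟨ solve 4 (λ x y a z → x :+ (y :- a) :- z := (x :+ y) :- (z :+ a)) ≈-refl (t″ ⊗ b ^ card) (a ^ card) a (t′ ⊗ b)
          ⟩
    (t″ ⊗ b ^ card ⊕ a ^ card) ⊖ (t′ ⊗ b ⊕ a)
      ≈⟨ ⊖-cong (≈-trans (frobenius-⊕ 2<card (t′ ⊗ b) a) (⊕-congʳ (⊗-^ t′ b card))) ≈-refl ⟨
    (t′ ⊗ b ⊕ a) ^ card ⊖ (t′ ⊗ b ⊕ a)           ∎
    where
    open ≈-Reasoning
    t″ = θ (suc (suc i))
    t′ = θ (suc i)
    a = α i f
    b = α (suc i) f

  α-above : ∀ i f → Below i f → α i f ≈ []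
  α-above i []            b = ≈-refl
  α-above zero (c ∷ f)    b = ≈-trans (α-zero (c ∷ f)) (below-0 b)
  α-above (suc i) (c ∷ f) b = ≈-trans
    (⊕-cong (≈-trans (⊗-congˡ (α-above (suc i) f (below-mono f (ℕP.n≤1+n i) (below-tail c f b)))) (A.zeroʳ _))
            (α-above i f (below-tail c f b))) (A.+-identityʳ [])

  α-top : ∀ i f → Below (suc i) f → α i f ≈ ‵ (coeff f i)
  α-top i []            b = ≈-sym (‵0≈[] refl)
  α-top zero (c ∷ f)    b = ≈-trans (α-zero (c ∷ f)) (below-1 b)
  α-top (suc i) (c ∷ f) b = ≈-trans
    (⊕-cong (≈-trans (⊗-congˡ (α-above (suc i) f (below-tail c f b))) (A.zeroʳ _)) (α-top i f (below-tail c f b)))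
    (A.+-identityˡ _)

  expansion : ℕ → Pol → Pol → Pol
  expansion zero    f v = []
  expansion (suc n) f v = expansion n f v ⊕ α n f ⊗ frob n v

  -- Cutting the sums off after finitely many terms leaves one boundary term with the factor
  -- `α n f`, which vanishes once n exceeds the degree of `f`.
  expansion-∷ : ∀ n c f v → expansion (suc n) (c ∷ f) v ≈ ‵ c ⊗ v ⊕ expansion n f (CT v) ⊕ θ n ⊗ α n f ⊗ frob n v
  expansion-∷ zero c f v = solve 4 (λ c t a v → A.num 0 :+ (c :+ t :* a) :* v := c :* v :+ A.num 0 :+ t :* a :* v)
      ≈-refl (‵ c) T (α 0 f) v
  expansion-∷ (suc n) c f v = begin
    expansion (suc n) (c ∷ f) v ⊕ (t′ ⊗ a′ ⊕ a) ⊗ w′   ≈⟨ ⊕-congʳ (expansion-∷ n c f v) ⟩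
    ‵ c ⊗ v ⊕ e ⊕ t ⊗ a ⊗ w ⊕ (t′ ⊗ a′ ⊕ a) ⊗ w′
      ≈⟨ solve 8 (λ x e t a w t′ a′ w′ → x :+ e :+ t :* a :* w :+ (t′ :* a′ :+ a) :* w′ := x :+
          (e :+ a :* (t :* w :+ w′)) :+ t′ :* a′ :* w′) ≈-refl (‵ c ⊗ v) e t a w t′ a′ w′ ⟩
    ‵ c ⊗ v ⊕ (e ⊕ a ⊗ (t ⊗ w ⊕ w′)) ⊕ t′ ⊗ a′ ⊗ w′
      ≈⟨ ⊕-congʳ (⊕-congˡ (⊕-congˡ (⊗-congˡ
          (≈-trans (frob-⊕ n (T ⊗ v) (v ^ card)) (⊕-cong (frob-⊗ n T v) (A.reflexive (sym (frob-suc n v)))))))) ⟨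
    ‵ c ⊗ v ⊕ (e ⊕ a ⊗ frob n (CT v)) ⊕ t′ ⊗ a′ ⊗ w′   ∎
    where
    open ≈-Reasoning
    e = expansion n f (CT v)
    t = θ n
    t′ = θ (suc n)
    a = α n f
    a′ = α (suc n) f
    w = frob n v
    w′ = frob (suc n) v

  expansion-zero : ∀ n v → expansion n [] v ≈ []
  expansion-zero zero    v = ≈-refl
  expansion-zero (suc n) v = ≈-trans (⊕-cong (expansion-zero n v) (A.zeroˡ _)) (A.+-identityʳ [])

  C-expansion : ∀ n f v → Below n f → C f v ≈ expansion n f v
  C-expansion n       []      v b = ≈-sym (expansion-zero n v)
  C-expansion zero    (c ∷ f) v b = C-zeroˡ v (below-0 b)
  C-expansion (suc n) (c ∷ f) v b = ≈-sym (≈-trans (expansion-∷ n c f v) (≈-trans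
    (⊕-congˡ (≈-trans (⊗-congʳ (≈-trans (⊗-congˡ (α-above n f (below-tail c f b))) (A.zeroʳ _))) (A.zeroˡ _)))
    (≈-trans (A.+-identityʳ _) (⊕-congˡ (≈-sym (C-expansion n f (CT v) (below-tail c f b)))))))

  module _ {d π} (P : Prime d π) where
    open Prime P

    -- Starting from α_0 = π, the recurrence makes π divide (θ_(i+1) - T) α_(i+1), and below d the
    -- first factor is prime to π.
    prime-∣-α : ∀ i → i < d → π ∣ α i π
    prime-∣-α zero    i<d = ∣-reflexive (≈-sym (α-zero π))
    prime-∣-α (suc i) i<d with euclid _ _ (∣-respʳ (≈-sym (α-recurrence i π))
                                 (∣-⊖ (∣-trans ih (∣-^ 0<card)) ih))
      where ih = prime-∣-α i (ℕP.<-trans (ℕP.n<1+n i) i<d)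
    ... | inj₁ x = contradiction x (θ-not-fixed P (s≤s z≤n) i<d)
    ... | inj₂ x = x

    -- Modulo π only the top term v^(q^d) of C_π(v) survives, and the q^d-th power fixes every
    -- residue.
    C-prime : ∀ v → π ∣ C π v ⊖ v
    C-prime v = ∣-⊖-trans (C π v) (frob d v) v (∣-respʳ (≈-sym eq) (low d ℕP.≤-refl)) (frob-fixed P v)
      where
      low : ∀ i → i ≤ d → π ∣ expansion i π v
      low zero    _   = ∣-zero
      low (suc i) i<d = ∣-⊕ (low i (ℕP.<⇒≤ i<d)) (∣-⊗ʳ (frob i v) (prime-∣-α i i<d))
      eq : C π v ⊖ frob d v ≈ expansion d π v
      eq = ≈-trans (⊖-cong (≈-trans (C-expansion (suc d) π v (Mon.above monic))
              (⊕-congˡ (≈-trans (⊗-congʳ (≈-trans (α-top d π (Mon.above monic))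
                  (A.reflexive (cong ‵ (Mon.lead≡1 monic))))) (A.*-identityˡ _)))) ≈-refl)
            (solve 2 (λ x y → (x :+ y) :- y := x) ≈-refl (expansion d π v) (frob d v))

    C-prime-⊖-𝟙 : ∀ v → π ∣ C (π ⊖ 𝟙) v
    C-prime-⊖-𝟙 v = ∣-respʳ (≈-sym (≈-trans (C-⊖ˡ π 𝟙 v) (⊖-cong ≈-refl (C-𝟙 v)))) (C-prime v)

-- Least common multiples and degrees by inclusion-exclusion.

module InclusionExclusion where
  -- E Dg ds k e: e is the degree obtained from deg C_g(u) = Dg (deg g) by inclusion-exclusion
  -- over distinct primes of degrees ds, for m = g ∏S with deg g = k.
  E : (ℕ → ℕ) → List ℕ → ℕ → ℕ → Set
  E Dg []       k e = e ≡ Dg k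
  E Dg (d ∷ ds) k e = ∃₂ λ e₁ e₀ → E Dg ds (k ℕ.+ d) e₁ × E Dg ds k e₀ × e ℕ.+ e₀ ≡ e₁

module LeastCommonMultiples (𝔽 : FiniteField) where
  open Primes 𝔽
  open A using (solve; _:=_; _:+_; _:*_)

  -- The gcd and the product formula are kept beside the universal property, because the degree of
  -- the lcm is read off from them.
  record LCM (a b : Pol) : Set where
    field
      lcm   : Pol
      ∣lcmˡ : a ∣ lcm
      ∣lcmʳ : b ∣ lcm
      least : ∀ {t} → a ∣ t → b ∣ t → lcm ∣ t
      gcd   : Pol
      gcd∣ˡ : gcd ∣ a
      gcd∣ʳ : gcd ∣ b
      greatest : ∀ {d} → d ∣ a → d ∣ b → d ∣ gcd
      product : lcm ⊗ gcd ≈ a ⊗ b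

  lcm-of : ∀ a b → ¬ a ≈ [] → LCM a b
  lcm-of a b a≉ with gcd-of a b
  ... | G@(mkGCD g (divides h e) (divides h′ e′) s t bz) = record
    { lcm = h′ ⊗ a
    ; ∣lcmˡ = ∣-⊗ˡ h′ ∣-refl
    ; ∣lcmʳ = divides h (≈-trans (⊗-congˡ (≈-sym e′))
        (≈-trans (solve 3 (λ h h′ g → h :* (h′ :* g) := h′ :* (h :* g)) ≈-refl h h′ g) (⊗-congˡ e)))
    ; least = least
    ; gcd = g ; gcd∣ˡ = divides h e ; gcd∣ʳ = divides h′ e′ ; greatest = GCD.greatest G
    ; product = ≈-trans (solve 3 (λ h a g → h :* a :* g := a :* (h :* g)) ≈-refl h′ a g) (⊗-congˡ e′) }
    where
    g≉ : ¬ g ≈ []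
    g≉ = ∣-≉[] (divides h e) a≉
    least : ∀ {x} → a ∣ x → b ∣ x → h′ ⊗ a ∣ x
    least {x} (divides y f) (divides y′ f′) = divides (s ⊗ y′ ⊕ t ⊗ y) (⊗-cancelʳ g≉ (begin
      (s ⊗ y′ ⊕ t ⊗ y) ⊗ (h′ ⊗ a) ⊗ g
        ≈⟨ solve 7 (λ s t y y′ h a g → (s :* y′ :+ t :* y) :* (h :* a) :* g := s :* a :* (y′ :* (h :* g)) :+ t :*
            (h :* g) :* (y :* a)) ≈-refl s t y y′ h′ a g ⟩
      s ⊗ a ⊗ (y′ ⊗ (h′ ⊗ g)) ⊕ t ⊗ (h′ ⊗ g) ⊗ (y ⊗ a)
        ≈⟨ ⊕-cong (⊗-congˡ (≈-trans (⊗-congˡ e′) f′)) (⊗-cong (⊗-congˡ e′) f) ⟩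
      s ⊗ a ⊗ x ⊕ t ⊗ b ⊗ x
        ≈⟨ solve 3 (λ p r x → p :* x :+ r :* x := x :* (p :+ r)) ≈-refl (s ⊗ a) (t ⊗ b) x ⟩
      x ⊗ (s ⊗ a ⊕ t ⊗ b)                    ≈⟨ ⊗-congˡ bz ⟩
      x ⊗ g                                  ∎))
      where open ≈-Reasoning

  -- With x = h g, a = h′ g and t = w g, the hypothesis says that h divides w h′; since h and h′ are
  -- coprime, h divides w.
  cancel-gcd : ∀ {a x} → ¬ x ≈ [] → (G : GCD x a) →
               ∀ {t} → x ∣ t ⊗ quotient (GCD.gcd∣ʳ G) → GCD.gcd G ∣ t → x ∣ t
  cancel-gcd {a} {x} x≉ (mkGCD g (divides h e) (divides h′ e′) s t bz) {y} d (divides w f) =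
    ∣-respʳ f (∣-respˡ e (⊗-mono-∣ (coprime-∣ {b = w} cop d′) (∣-refl {g})))
    where
    g≉ : ¬ g ≈ []
    g≉ = ∣-≉[] (divides h e) x≉
    cop : Coprime h′ h
    cop = t , s , ⊗-cancelʳ g≉ (≈-trans
      (solve 5 (λ s t h h′ g → (t :* h′ :+ s :* h) :* g := s :* (h :* g) :+ t :* (h′ :* g)) ≈-refl s t h h′ g)
      (≈-trans (⊕-cong (⊗-congˡ e) (⊗-congˡ e′)) (≈-trans bz (≈-sym (A.*-identityˡ g)))))
    d′ : h ∣ h′ ⊗ w
    d′ = ∣-cancelʳ g≉ (∣-respˡ (≈-sym e) (∣-respʳ
      (≈-trans (⊗-congʳ (≈-sym f)) (solve 3 (λ w g h → w :* g :* h := h :* w :* g) ≈-refl w g h′)) d))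

  -- gcd(x, lcm(a, b)) divides lcm(gcd(x, a), gcd(x, b)), with gcds and lcms replaced by their universal properties.
  distributive : ∀ {a b x t} → ¬ x ≈ [] → (∀ {y} → a ∣ y → b ∣ y → x ∣ y) →
                 (∀ {y} → y ∣ x → y ∣ a → y ∣ t) → (∀ {y} → y ∣ x → y ∣ b → y ∣ t) → x ∣ t
  distributive {a} {b} {x} {t} x≉ div below-a below-b =
    -- As gcd(x, a) and gcd(x, b) divide t, the product t a₁ b₁ is a common multiple of `a` and `b`,
    -- hence a multiple of x. The cofactors b₁ and a₁ are then removed in turn.
    cancel-gcd x≉ G (cancel-gcd x≉ G′ (∣-respʳ (A.*-assoc t a₁ b₁ ⟨≈⟩ swap) (div a∣ b∣)) (∣-⊗ʳ a₁ g′∣t)) g∣t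
    where
    _⟨≈⟩_ = ≈-trans
    G = gcd-of x a
    G′ = gcd-of x b
    a₁ = quotient (GCD.gcd∣ʳ G)
    b₁ = quotient (GCD.gcd∣ʳ G′)
    g∣t = below-a (GCD.gcd∣ˡ G) (GCD.gcd∣ʳ G)
    g′∣t = below-b (GCD.gcd∣ˡ G′) (GCD.gcd∣ʳ G′)
    swap : t ⊗ (a₁ ⊗ b₁) ≈ t ⊗ a₁ ⊗ b₁
    swap = ≈-sym (A.*-assoc t a₁ b₁)
    a∣ : a ∣ t ⊗ a₁ ⊗ b₁
    a∣ = ∣-⊗ʳ b₁ (∣-respʳ (A.*-comm a₁ t) (∣-respˡ (equality (GCD.gcd∣ʳ G)) (⊗-mono-∣ (∣-refl {a₁}) g∣t)))
    b∣ : b ∣ t ⊗ a₁ ⊗ b₁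
    b∣ = ∣-respʳ (solve 3 (λ t a b → b :* t :* a := t :* a :* b) ≈-refl t a₁ b₁)
      (∣-⊗ʳ a₁ (∣-respˡ (equality (GCD.gcd∣ʳ G′)) (⊗-mono-∣ (∣-refl {b₁}) g′∣t)))

-- The primitive part Q of C_m(u) and its degree.

module PrimitivePart (𝔽 : FiniteField) (2<card : 2 < FiniteField.card 𝔽) where
  open Carlitz 𝔽 2<card public
  open LeastCommonMultiples 𝔽 public
  open InclusionExclusion public
  open A using (solve; _:=_; _:+_; _:*_)

  ∏ : List Pol → Pol
  ∏ []      = 𝟙
  ∏ (π ∷ S) = π ⊗ ∏ S

  AllCoprime : List Pol → Set
  AllCoprime []      = ⊤
  AllCoprime (π ∷ S) = All (Coprime π) S × AllCoprime S

  data Degrees : List ℕ → List Pol → Set where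
    []  : Degrees [] []
    _∷_ : ∀ {d ds π S} → Mon d π → Degrees ds S → Degrees (d ∷ ds) (π ∷ S)

  -- The quotient Q of C_m(u) by the least common multiple of the C_{m/π}(u), π | m prime.
  record Primitive (m u : Pol) (e : ℕ) : Set where
    field
      Q     : Pol
      Q-deg : Deg e Q
      Q∣    : Q ∣ C m u
      prim  : ∀ {d ρ h} → Prime d ρ → h ⊗ ρ ≈ m → Q ⊗ C h u ∣ C m u
      C≉    : ¬ C m u ≈ []

  Complete : List Pol → Pol → Set
  Complete S m = ∀ {d ρ} → Prime d ρ → ρ ∣ m → ∃ λ π → π ∈ S × ρ ≈ π

  module _ (u : Pol) (Dg : ℕ → ℕ) (mon-Cu : ∀ {k g} → Mon k g → Mon (Dg k) (C g u)) where

    -- t is a common multiple of the C_{m/π}(u), where m = g ∏S and π ranges over S.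
    CommonMultiple : List Pol → Pol → Pol → Set
    CommonMultiple []      g t = ⊤
    CommonMultiple (π ∷ S) g t = C (g ⊗ ∏ S) u ∣ t × CommonMultiple S (g ⊗ π) t

    cm-resp : ∀ S {g g′ t} → g ≈ g′ → CommonMultiple S g t → CommonMultiple S g′ t
    cm-resp []      e cm = tt
    cm-resp (π ∷ S) {g} {g′} e (d , cm) =
      ∣-respˡ (C-congˡ {g ⊗ ∏ S} {g′ ⊗ ∏ S} u (⊗-congʳ e)) d , cm-resp S (⊗-congʳ e) cm

    cm-∣ : ∀ S {g t t′} → t ∣ t′ → CommonMultiple S g t → CommonMultiple S g t′
    cm-∣ []      d cm = tt
    cm-∣ (π ∷ S) d (d′ , cm) = ∣-trans d′ d , cm-∣ S d cm

    cm-⊗ : ∀ S {g π t} → CommonMultiple S (g ⊗ π) t → CommonMultiple S g t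
    cm-⊗ []      cm = tt
    cm-⊗ (ρ ∷ S) {g} {π} (d , cm) =
      ∣-trans (C-∣ {g ⊗ ∏ S} {g ⊗ π ⊗ ∏ S} u (⊗-mono-∣ (∣-⊗ʳ π ∣-refl) ∣-refl)) d ,
      cm-⊗ S (cm-resp S (solve 3 (λ g π ρ → g :* π :* ρ := g :* ρ :* π) ≈-refl g π ρ) cm)

    ∏-∷ : ∀ g π S → g ⊗ π ⊗ ∏ S ≈ g ⊗ ∏ (π ∷ S)
    ∏-∷ g π S = A.*-assoc g π (∏ S)

    cm-C : ∀ S g → CommonMultiple S g (C (g ⊗ ∏ S) u)
    cm-C []      g = tt
    cm-C (π ∷ S) g = C-∣ {g ⊗ ∏ S} {g ⊗ ∏ (π ∷ S)} u (⊗-mono-∣ ∣-refl (∣-⊗ˡ π ∣-refl)) ,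
      cm-∣ S (∣-reflexive (C-congˡ {g ⊗ π ⊗ ∏ S} {g ⊗ ∏ (π ∷ S)} u (∏-∷ g π S))) (cm-C S (g ⊗ π))

    cm-∈ : ∀ {S g t π} → π ∈ S → CommonMultiple S g t → ∃ λ h → h ⊗ π ≈ g ⊗ ∏ S × C h u ∣ t
    cm-∈ {π ∷ S} {g} (here refl) (d , cm) = g ⊗ ∏ S ,
      solve 3 (λ g s π → g :* s :* π := g :* (π :* s)) ≈-refl g (∏ S) π , d
    cm-∈ {ρ ∷ S} {g} (there π∈) (d , cm) with cm-∈ π∈ cm
    ... | h , e , d′ = h , ≈-trans e (∏-∷ g ρ S) , d′

    mon-∏ : ∀ {ds S} → Degrees ds S → ∃ λ n → Mon n (∏ S)
    mon-∏ []       = 0 , mon-𝟙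
    mon-∏ (m ∷ ms) = _ , mon-⊗ m (proj₂ (mon-∏ ms))

    C≉[] : ∀ {k g ds S} → Mon k g → Degrees ds S → ¬ C (g ⊗ ∏ S) u ≈ []
    C≉[] m ms = deg⇒≉[] (Mon⇒Deg (mon-Cu (mon-⊗ m (proj₂ (mon-∏ ms)))))

    record Least (S : List Pol) (g : Pol) : Set where
      field
        L      : Pol
        common : CommonMultiple S g L
        least  : ∀ {t} → CommonMultiple S g t → L ∣ t

      divides-C : L ∣ C (g ⊗ ∏ S) u
      divides-C = least (cm-C S g)

      Q : Pol
      Q = quotient divides-C

      Q⊗L : Q ⊗ L ≈ C (g ⊗ ∏ S) u
      Q⊗L = equality divides-C

    least-lcm : ∀ {k g ds S} → Mon k g → Degrees ds S → Least S g
    least-LCM : ∀ {k g ds d π S} → Mon k g → Mon d π → (ms : Degrees ds S) →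
                (l : Least S (g ⊗ π)) → LCM (C (g ⊗ ∏ S) u) (Least.L l)
    least-LCM {g = g} {S = S} m mπ ms l = lcm-of _ _ (C≉[] m ms)

    least-lcm {S = []} m [] = record { L = 𝟙 ; common = tt ; least = λ _ → divides _ (A.*-identityʳ _) }
    least-lcm {g = g} {S = π ∷ S} m (mπ ∷ ms) = record
      { L = LCM.lcm M
      ; common = LCM.∣lcmˡ M , cm-∣ S (LCM.∣lcmʳ M) (Least.common l)
      ; least = λ { (d , cm) → LCM.least M d (Least.least l cm) } }
      where
      l = least-lcm (mon-⊗ m mπ) ms
      M = least-LCM m mπ ms l

    -- Bezout coefficients with a π + b ρ = 1 act through the Carlitz module: C_a and C_b combine
    -- the two values to C_(gs)(u).
    coprime-C : ∀ {g π ρ s x} → Coprime π ρ → x ∣ C (g ⊗ π ⊗ s) u → x ∣ C (g ⊗ ρ ⊗ s) u → x ∣ C (g ⊗ s) u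
    coprime-C {g} {π} {ρ} {s} {x} (a , b , e) d d′ = ∣-respʳ eq (∣-⊕ (∣-trans d (∣C a _)) (∣-trans d′ (∣C b _)))
      where
      eq : C a (C (g ⊗ π ⊗ s) u) ⊕ C b (C (g ⊗ ρ ⊗ s) u) ≈ C (g ⊗ s) u
      eq = begin
        C a (C (g ⊗ π ⊗ s) u) ⊕ C b (C (g ⊗ ρ ⊗ s) u)  ≈⟨ ⊕-cong (C-⊗ a _ u) (C-⊗ b _ u) ⟨
        C (a ⊗ (g ⊗ π ⊗ s)) u ⊕ C (b ⊗ (g ⊗ ρ ⊗ s)) u  ≈⟨ C-⊕ˡ _ _ u ⟨
        C (a ⊗ (g ⊗ π ⊗ s) ⊕ b ⊗ (g ⊗ ρ ⊗ s)) u
          ≈⟨ C-congˡ {a ⊗ (g ⊗ π ⊗ s) ⊕ b ⊗ (g ⊗ ρ ⊗ s)} {g ⊗ s} u (≈-trans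
           (solve 6 (λ a b g π ρ s → a :* (g :* π :* s) :+ b :* (g :* ρ :* s) := (a :* π :+ b :* ρ) :* (g :* s))
               ≈-refl a b g π ρ s)
           (≈-trans (⊗-congʳ e) (A.*-identityˡ _))) ⟩
        C (g ⊗ s) u                                    ∎
        where open ≈-Reasoning

    -- gcd(C_{m}(u), L(S, gπ)) divides L(S, g), where m = g ∏S.
    gcd-least : ∀ {k d g π x ds S} → Mon k g → Mon d π → Degrees ds S → ¬ x ≈ [] → All (Coprime π) S →
                x ∣ C (g ⊗ ∏ S) u → (∀ {t} → CommonMultiple S (g ⊗ π) t → x ∣ t) →
                ∀ {t} → CommonMultiple S g t → x ∣ t
    gcd-least m mπ []      x≉ cop xC xL {t} _ = xL tt
    gcd-least {g = g} {π} {x} {S = ρ ∷ S} m mπ (mρ ∷ ms) x≉ (c ∷ cop) xC xL {t} (d , cm)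
      -- For `ρ ∷ S` at gπ the least common multiple is that of C_(gπ∏S)(u) and the one for `S` at
      -- gπρ. The gcd with x distributes over the two: the first is handled by `coprime-C`, the
      -- second by induction with gρ in place of g.
      = distributive {a = C (g ⊗ π ⊗ ∏ S) u} {b = Least.L l} x≉
          (λ p r → xL (p , cm-∣ S r (Least.common l)))
          (λ {z} z∣x z∣a → ∣-trans (coprime-C {g} {π} {ρ} {∏ S} c z∣a (∣-trans z∣x xC′)) d)
          (λ {z} z∣x z∣y → gcd-least (mon-⊗ m mρ) mπ ms (∣-≉[] z∣x x≉) cop (∣-trans z∣x xC′)
             (λ cm′ → ∣-trans z∣y (Least.least l
                 (cm-resp S (solve 3 (λ g ρ π → g :* ρ :* π := g :* π :* ρ) ≈-refl g ρ π) cm′))) cm)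
      where
      xC′ : x ∣ C (g ⊗ ρ ⊗ ∏ S) u
      xC′ = ∣-respʳ (C-congˡ {g ⊗ ∏ (ρ ∷ S)} {g ⊗ ρ ⊗ ∏ S} u (≈-sym (∏-∷ g ρ S))) xC
      l : Least S (g ⊗ π ⊗ ρ)
      l = least-lcm (mon-⊗ (mon-⊗ m mπ) mρ) ms

    deg-∣∣ : ∀ {n a b} → a ∣ b → b ∣ a → Deg n a → Deg n b
    deg-∣∣ {n} {a} {b} d d′ da with ≉[]⇒deg {b}
        (λ b≈ → deg⇒≉[] da (≈-trans (≈-sym (equality d′)) (≈-trans (⊗-congˡ b≈) (A.zeroʳ _))))
    ... | k , db = subst (λ j → Deg j b) (ℕP.≤-antisym (∣⇒deg≤ d′ db da) (∣⇒deg≤ d da db)) db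

    -- The denominator for `π ∷ S` is the lcm of C_(g∏S)(u) and the denominator for `S` at gπ, and
    -- by `gcd-least` their gcd is the denominator for `S` at g. Taking degrees in lcm · gcd =
    -- product gives deg Q(π ∷ S, g) + deg Q(S, g) = deg Q(S, gπ).
    deg-Q : ∀ {k g ds S} (m : Mon k g) (ms : Degrees ds S) → AllCoprime S →
            ∃ λ e → Deg e (Least.Q (least-lcm m ms)) × E Dg ds k e
    deg-Q {k} {g} m [] _ = Dg k , deg-resp eq (Mon⇒Deg (mon-Cu m)) , refl
      where
      l = least-lcm m []
      eq : C g u ≈ Least.Q l
      eq = ≈-sym (≈-trans (≈-sym (A.*-identityʳ _)) (≈-trans (Least.Q⊗L l) (C-congˡ {g ⊗ 𝟙} {g} u (A.*-identityʳ g))))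
    deg-Q {k} {g} {S = π ∷ S} m (mπ ∷ ms) (cop , cops) with deg-Q (mon-⊗ m mπ) ms cops | deg-Q m ms cops
    ... | e₁ , dQ₁ , E₁ | e₀ , dQ₀ , E₀ = e , dQ , e₁ , e₀ , E₁ , E₀ , sum
      where
      l₁ = least-lcm (mon-⊗ m mπ) ms
      l₀ = least-lcm m ms
      l = least-lcm m (mπ ∷ ms)
      M = least-LCM m mπ ms l₁
      C₀ = C (g ⊗ ∏ S) u
      L₀∣gcd : Least.L l₀ ∣ LCM.gcd M
      L₀∣gcd = LCM.greatest M (Least.divides-C l₀) (Least.least l₀ (cm-⊗ S (Least.common l₁)))
      gcd∣L₀ : LCM.gcd M ∣ Least.L l₀
      gcd∣L₀ = gcd-least m mπ ms (∣-≉[] (LCM.gcd∣ˡ M) (C≉[] m ms)) cop (LCM.gcd∣ˡ M)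
        (λ cm → ∣-trans (LCM.gcd∣ʳ M) (Least.least l₁ cm)) (Least.common l₀)
      L₀≉ : ¬ Least.L l₀ ≈ []
      L₀≉ = ∣-≉[] (Least.divides-C l₀) (C≉[] m ms)
      L₁≉ : ¬ Least.L l₁ ≈ []
      L₁≉ = ∣-≉[] (Least.divides-C l₁) (C≉[] (mon-⊗ m mπ) ms)
      L≉ : ¬ Least.L l ≈ []
      L≉ = ∣-≉[] (Least.divides-C l) (C≉[] m (mπ ∷ ms))
      Q≉ : ¬ Least.Q l ≈ []
      Q≉ q≈ = C≉[] m (mπ ∷ ms) (≈-trans (≈-sym (Least.Q⊗L l)) (≈-trans (⊗-congʳ q≈) (A.zeroˡ _)))
      d₀ = ≉[]⇒deg L₀≉
      d₁ = ≉[]⇒deg L₁≉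
      dL = ≉[]⇒deg L≉
      e = proj₁ (≉[]⇒deg Q≉)
      dQ = proj₂ (≉[]⇒deg Q≉)
      lhs : proj₁ dL ℕ.+ proj₁ d₀ ≡ e₀ ℕ.+ proj₁ d₀ ℕ.+ proj₁ d₁
      lhs = deg-unique (deg-⊗ (proj₂ dL) (deg-∣∣ L₀∣gcd gcd∣L₀ (proj₂ d₀)))
        (deg-resp (≈-trans (⊗-congʳ (Least.Q⊗L l₀)) (≈-sym (LCM.product M)))
            (deg-⊗ (deg-⊗ dQ₀ (proj₂ d₀)) (proj₂ d₁)))
      rhs : e ℕ.+ proj₁ dL ≡ e₁ ℕ.+ proj₁ d₁
      rhs = deg-unique (deg-⊗ dQ (proj₂ dL)) (deg-resp
        (≈-trans (Least.Q⊗L l₁) (≈-trans (C-congˡ {g ⊗ π ⊗ ∏ S} {g ⊗ ∏ (π ∷ S)} u (∏-∷ g π S)) (≈-sym (Least.Q⊗L l))))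
        (deg-⊗ dQ₁ (proj₂ d₁)))
      dL≡ : proj₁ dL ≡ e₀ ℕ.+ proj₁ d₁
      dL≡ = ℕP.+-cancelʳ-≡ (proj₁ d₀) _ _ (trans lhs (trans (ℕP.+-assoc e₀ _ _)
        (trans (cong (e₀ ℕ.+_) (ℕP.+-comm (proj₁ d₀) _)) (sym (ℕP.+-assoc e₀ _ _)))))
      sum : e ℕ.+ e₀ ≡ e₁
      sum = ℕP.+-cancelʳ-≡ (proj₁ d₁) _ _ (trans (ℕP.+-assoc e e₀ _) (trans (cong (e ℕ.+_) (sym dL≡)) rhs))

    primitive-part : ∀ {m k g ds S} → Mon k g → Degrees ds S → AllCoprime S → Complete S m → m ≈ g ⊗ ∏ S →
                     ∃ λ e → E Dg ds k e × Primitive m u e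
    primitive-part {m} {k} {g} {ds} {S} mg ms cop complete m≈ with deg-Q mg ms cop
    ... | e , dQ , Ee = e , Ee , record
      { Q = Least.Q l ; Q-deg = dQ
      ; Q∣ = ∣-respʳ C≈ (divides (Least.L l) (≈-trans (A.*-comm _ _) (Least.Q⊗L l)))
      ; prim = prim
      ; C≉ = λ z → C≉[] mg ms (≈-trans C≈ z) }
      where
      l = least-lcm mg ms
      C≈ : C (g ⊗ ∏ S) u ≈ C m u
      C≈ = C-congˡ {g ⊗ ∏ S} {m} u (≈-sym m≈)
      prim : ∀ {d ρ h} → Prime d ρ → h ⊗ ρ ≈ m → Least.Q l ⊗ C h u ∣ C m u
      prim {ρ = ρ} {h} P e with complete P (divides h e)
      ... | π , π∈S , ρ≈π with cm-∈ π∈S (Least.common l)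
      ...   | h′ , e′ , d = ∣-respʳ (≈-trans (Least.Q⊗L l) C≈) (⊗-mono-∣ ∣-refl
                (∣-respˡ (C-congˡ {h′} {h} u (⊗-cancelʳ (Prime.≉[] P)
                    (≈-trans (⊗-congˡ ρ≈π) (≈-trans e′ (≈-sym (≈-trans e m≈)))))) d))

-- Prime divisors of Q and large Zsigmondy primes.

module ZsigmondyPrimes (𝔽 : FiniteField) (2<card : 2 < FiniteField.card 𝔽) where
  open PrimitivePart 𝔽 2<card public
  open A using (solve; _:=_; _:+_; _:*_; _:-_; :-_)
  private module D = Poly 𝔽

  below-⊝ : ∀ {n} p → Below n p → Below n (⊝ p)
  below-⊝ p b i le = trans (sym (at (A.+-identityˡ (⊝ p)) i)) (trans (coeff-⊖ [] p i)
    (trans (K.+-identityˡ _) (trans (cong K.-_ (b i le)) K.-0#≈0#)))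

  opaque
    mon-quotient : ∀ {n d s p} → Mon d p → Mon n (s ⊗ p) → ∃ λ k → Mon k s × k ℕ.+ d ≡ n
    mon-quotient {n} {d} {s} {p} mp msp with ≉[]⇒deg {s}
        (λ s≈ → deg⇒≉[] (Mon⇒Deg msp) (≈-trans (⊗-congʳ s≈) (A.zeroˡ p)))
    ... | k , mkDeg l a with deg-unique (deg-⊗ (mkDeg l a) (Mon⇒Deg mp)) (Mon⇒Deg msp)
    ...   | refl = k , mkMon (trans (sym (K.*-identityʳ _)) (trans (cong (coeff s k K.*_) (sym (Mon.lead≡1 mp)))
                     (trans (sym (coeff-⊗-top k d s p a (Mon.above mp))) (Mon.lead≡1 msp)))) a , refl

  opaque
    multiplicity : ∀ {d π} → Prime d π → ∀ m → ¬ m ≈ [] → ∃₂ λ k a → m ≈ a ⊗ π ^ k × ¬ π ∣ a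
    multiplicity {d} {π} P m m≉ = go _ m (proj₂ (≉[]⇒deg m≉)) ℕP.≤-refl
      where
      go : ∀ N {n} m → Deg n m → n ≤ N → ∃₂ λ k a → m ≈ a ⊗ π ^ k × ¬ π ∣ a
      go N m dm n≤N with π ∣? m
      ... | no π∤m = 0 , m , ≈-sym (A.*-identityʳ m) , π∤m
      ... | yes (divides s e) with ≉[]⇒deg {s}
          (λ s≈ → deg⇒≉[] dm (≈-trans (≈-sym e) (≈-trans (⊗-congʳ s≈) (A.zeroˡ π))))
      ...   | j , ds with deg-unique (deg-resp e (deg-⊗ ds (Mon⇒Deg (Prime.monic P)))) dm
      go zero m dm n≤N | yes (divides s e) | j , ds | refl =
        contradiction (ℕP.≤-trans (Prime.positive P) (ℕP.≤-trans (ℕP.m≤n+m d j) n≤N)) λ ()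
      go (suc N) m dm n≤N | yes (divides s e) | j , ds | refl
        with go N s ds (ℕP.≤-pred (ℕP.≤-trans
            (ℕP.≤-trans (ℕP.≤-reflexive (ℕP.+-comm 1 j)) (ℕP.+-monoʳ-≤ j (Prime.positive P))) n≤N))
      ...   | k , a , e′ , π∤a = suc k , a , ≈-trans (≈-sym e) (≈-trans (⊗-congʳ e′)
                (solve 3 (λ a p π → a :* p :* π := a :* (π :* p)) ≈-refl a (π ^ k) π)) , π∤a

  data PrimeList : List ℕ → List Pol → Set where
    []  : PrimeList [] []
    _∷_ : ∀ {d ds π S} → Prime d π → PrimeList ds S → PrimeList (d ∷ ds) (π ∷ S)

  primes⇒degrees : ∀ {ds S} → PrimeList ds S → Degrees ds S
  primes⇒degrees []       = []
  primes⇒degrees (P ∷ Ps) = Prime.monic P ∷ primes⇒degrees Ps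

  opaque
    prime-∣-∏ : ∀ {d π ds S} → Prime d π → PrimeList ds S → π ∣ ∏ S → ∃ λ ρ → ρ ∈ S × π ≈ ρ
    prime-∣-∏ P [] π∣ = contradiction π∣ (Prime.∤𝟙 P)
    prime-∣-∏ {S = ρ ∷ S} P (R ∷ Ps) π∣ with Prime.euclid P ρ (∏ S) π∣
    ... | inj₁ π∣ρ = ρ , here refl , prime-∣-prime P R π∣ρ
    ... | inj₂ π∣S with prime-∣-∏ P Ps π∣S
    ...   | ρ′ , ρ∈ , e = ρ′ , there ρ∈ , e

  -- `S` lists each prime of `m` once, and `g` collects the repeated factors. The degree of Q
  -- depends only on deg g and the degrees of the primes in `S`.
  record Factorization (n : ℕ) (m : Pol) : Set where
    field
      {k}      : ℕ
      {ds}     : List ℕ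
      {S}      : List Pol
      {g}      : Pol
      monic    : Mon k g
      primes   : PrimeList ds S
      coprimes : AllCoprime S
      complete : Complete S m
      product  : m ≈ g ⊗ ∏ S
      degrees  : k ℕ.+ ℕL.sum ds ≡ n

  private
    sum-repeated : ∀ k d s → k ℕ.+ d ℕ.+ s ≡ k ℕ.+ s ℕ.+ d
    sum-repeated = NS.solve 3 (λ k d s → k NS.:+ d NS.:+ s NS.:= k NS.:+ s NS.:+ d) refl

    sum-new : ∀ k d s → k ℕ.+ (d ℕ.+ s) ≡ k ℕ.+ s ℕ.+ d
    sum-new = NS.solve 3 (λ k d s → k NS.:+ (d NS.:+ s) NS.:= k NS.:+ s NS.:+ d) refl

  multiply : ∀ {n d s π} → Prime d π → Factorization n s → Factorization (n ℕ.+ d) (s ⊗ π)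
  multiply {n} {d} {s} {π} P f with π ∣? ∏ (Factorization.S f)
  ... | yes π∣S = record
    { monic = mon-⊗ monic (Prime.monic P) ; primes = primes ; coprimes = coprimes ; complete = complete′
    ; product = ≈-trans (⊗-congʳ product) (solve 3 (λ g s π → g :* s :* π := g :* π :* s) ≈-refl g (∏ S) π)
    ; degrees = trans (sum-repeated k d (ℕL.sum ds)) (cong (ℕ._+ d) degrees) }
    where
    open Factorization f
    complete′ : Complete S (s ⊗ π)
    complete′ R ρ∣m with Prime.euclid R s π ρ∣m
    ... | inj₁ ρ∣s = complete R ρ∣s
    ... | inj₂ ρ∣π with prime-∣-∏ P primes π∣S
    ...   | π′ , π′∈ , e′ = π′ , π′∈ , ≈-trans (prime-∣-prime R P ρ∣π) e′
  ... | no π∤S = record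
    { monic = monic ; primes = P ∷ primes ; coprimes = all-coprime S (λ ρ∈ → ∈-∤ S ρ∈ π∤S) , coprimes ; complete =
        complete′
    ; product = ≈-trans (⊗-congʳ product) (solve 3 (λ g s π → g :* s :* π := g :* (π :* s)) ≈-refl g (∏ S) π)
    ; degrees = trans (sum-new k d (ℕL.sum ds)) (cong (ℕ._+ d) degrees) }
    where
    open Factorization f
    ∈-∤ : ∀ S {ρ} → ρ ∈ S → ¬ π ∣ ∏ S → ¬ π ∣ ρ
    ∈-∤ (ρ ∷ S) (here refl) π∤ d = π∤ (∣-⊗ʳ (∏ S) d)
    ∈-∤ (ρ ∷ S) (there ρ∈) π∤ d = ∈-∤ S ρ∈ (λ d′ → π∤ (∣-⊗ˡ ρ d′)) d
    all-coprime : ∀ S → (∀ {ρ} → ρ ∈ S → ¬ π ∣ ρ) → All (Coprime π) S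
    all-coprime []      h = []
    all-coprime (ρ ∷ S) h = Coprime-sym (prime-coprime P (h (here refl))) ∷ all-coprime S (λ ρ∈ → h (there ρ∈))
    complete′ : Complete (π ∷ S) (s ⊗ π)
    complete′ R ρ∣m with Prime.euclid R s π ρ∣m
    ... | inj₂ ρ∣π = π , here refl , prime-∣-prime R P ρ∣π
    ... | inj₁ ρ∣s with complete R ρ∣s
    ...   | ρ′ , ρ′∈ , e′ = ρ′ , there ρ′∈ , e′

  factorization-resp : ∀ {n m m′} → m ≈ m′ → Factorization n m → Factorization n m′
  factorization-resp e f = record
    { monic = monic ; primes = primes ; coprimes = coprimes
    ; complete = λ P ρ∣ → complete P (∣-respʳ (≈-sym e) ρ∣)
    ; product = ≈-trans (≈-sym e) product ; degrees = degrees }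
    where open Factorization f

  opaque
    factorize : ∀ {n m} → Mon n m → Factorization n m
    factorize {n} mm = go n mm ℕP.≤-refl
      where
      go : ∀ N {n m} → Mon n m → n ≤ N → Factorization n m
      go N {zero} {m} mm _ = record
        { monic = mm ; primes = [] ; coprimes = tt
        ; complete = λ P ρ∣m → contradiction (∣-respʳ (mon-0 mm) ρ∣m) (Prime.∤𝟙 P)
        ; product = ≈-sym (A.*-identityʳ m) ; degrees = refl }
      go (suc N) {suc n} {m} mm (s≤s n≤N) with prime-divisor (Mon⇒Deg mm) (s≤s z≤n)
      ... | d , π , P , divides s e with mon-quotient (Prime.monic P) (mon-resp (≈-sym e) mm)
      ...   | j , ms , j+d = factorization-resp e
          (subst (λ i → Factorization i (s ⊗ π)) j+d (multiply P (go N ms j≤N)))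
        where
        j≤N : j ≤ N
        j≤N = ℕP.≤-trans (ℕP.≤-pred (subst (j <_) j+d (ℕP.m<m+n j (Prime.positive P)))) n≤N

  record LargeZ (n : ℕ) (m u : Pol) : Set where
    constructor largeZ
    field
      {d}     : ℕ
      {℘}     : Pol
      prime   : Prime d ℘
      ∣C-m    : ℘ ∣ C m u
      ∤C-n    : ∀ {j x} → Deg j x → j < n → ¬ ℘ ∣ C x u
      large   : n < d ⊎ ℘ ⊗ ℘ ∣ C m u

  to-LargeZ : ∀ {m n u ℘} → Mon n m → D.LargeZsigmondy u m ℘ → LargeZ n m u
  to-LargeZ {m} {n} {u} {℘} mm ((mp , ℘∣ , ℘∤) , l) = largeZ (to-Prime mp)
    (∣-respʳ (C-def m u) (to∣ _ _ ℘∣))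
    (λ {j} {x} dx j<n d → ℘∤ x (λ z → deg⇒≉[] dx (coeffwise z))
       (subst (_< D.deg m) (sym (Deg⇒deg dx)) (subst (j <_) (sym (Mon⇒deg mm)) j<n))
       (from∣ (∣-respʳ (≈-sym (C-def x u)) d)))
    ([ (λ lt → inj₁ (subst (_< D.deg ℘) (Mon⇒deg mm) lt))
     , (λ d → inj₂ (∣-respˡ (A.reflexive (sym (⊗-def ℘ ℘))) (∣-respʳ (C-def m u) (to∣ _ _ d)))) ]′ l)

  from-LargeZ : ∀ {m n u} → Mon n m → LargeZ n m u → ∃ λ ℘ → D.LargeZsigmondy u m ℘
  from-LargeZ {m} {n} {u} mm (largeZ {d} {℘} P ℘∣ ℘∤ l) = ℘ ,
    (from-Prime P , from∣ (∣-respʳ (≈-sym (C-def m u)) ℘∣) , not) ,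
    [ (λ lt → inj₁ (subst (D.deg m <_) (sym (Mon⇒deg (Prime.monic P))) (subst (_< d) (sym (Mon⇒deg mm)) lt)))
    , (λ dv → inj₂ (from∣ (∣-respˡ (A.reflexive (⊗-def ℘ ℘)) (∣-respʳ (≈-sym (C-def m u)) dv)))) ]′ l
    where
    not : ∀ x → ¬ D.IsZero x → D.deg x < D.deg m → ¬ (℘ D.∣ D.C x u)
    not x nz lt dv with ≉[]⇒deg {x} (λ e → nz (at e))
    ... | j , dx = ℘∤ dx (subst (_< n) (Deg⇒deg dx) (subst (D.deg x <_) (Mon⇒deg mm) lt))
                     (∣-respʳ (C-def x u) (to∣ _ _ dv))

  module _ {m u e} (Φ : Primitive m u e) where
    open Primitive Φ

    m≉[] : ¬ m ≈ []
    m≉[] m≈ = C≉ (C-zeroˡ u m≈)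

    -- C_ρ(w) = w (ρ + w² s), so Q divides the second factor when w = C_{m/ρ}(u).
    Q∣cofactor : ∀ {d ρ h} → Prime d ρ → h ⊗ ρ ≈ m → ∃ λ s → Q ∣ ρ ⊕ C h u ⊗ (C h u ⊗ s)
    Q∣cofactor {ρ = ρ} {h} P e with C-linear ρ (C h u)
    ... | s , eq = s , ∣-cancelʳ w≉ (∣-respʳ (≈-trans Cm≈ (≈-trans eq (A.*-comm _ _))) (prim P e))
      where
      Cm≈ : C m u ≈ C ρ (C h u)
      Cm≈ = ≈-trans (C-congˡ {m} {ρ ⊗ h} u (≈-trans (≈-sym e) (A.*-comm h ρ))) (C-⊗ ρ h u)
      w≉ : ¬ C h u ≈ []
      w≉ w≈ = C≉ (≈-trans Cm≈ (≈-trans eq (≈-trans (⊗-congʳ w≈) (A.zeroˡ _))))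

    module _ {d ℘ k a} (P : Prime d ℘) (℘∣Q : ℘ ∣ Q) (m≈ : m ≈ a ⊗ ℘ ^ k) (℘∤a : ¬ ℘ ∣ a) where
      open Prime P

      strip : ∀ k → ℘ ∣ C (a ⊗ ℘ ^ k) u → ℘ ∣ C a u
      strip zero    dv = ∣-respʳ (C-congˡ {a ⊗ 𝟙} {a} u (A.*-identityʳ a)) dv
      strip (suc k) dv = strip k (∣-respʳ (solve 2 (λ x y → x :- (x :- y) := y) ≈-refl (C ℘ v) v)
        (∣-⊖ (∣-respʳ (≈-trans (C-congˡ {a ⊗ (℘ ⊗ ℘ ^ k)} {℘ ⊗ (a ⊗ ℘ ^ k)} u
                 (solve 3 (λ a π p → a :* (π :* p) := π :* (a :* p)) ≈-refl a ℘ (℘ ^ k))) (C-⊗ ℘ (a ⊗ ℘ ^ k) u)) dv)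
             (C-prime P v)))
        where v = C (a ⊗ ℘ ^ k) u

      ∣C-a : ℘ ∣ C a u
      ∣C-a = strip k (∣-respʳ (C-congˡ {m} {a ⊗ ℘ ^ k} u m≈) (∣-trans ℘∣Q Q∣))

      -- a is the order of u modulo ℘ in the A-module C(A/℘).
      order-∣ : ∀ {n} → ℘ ∣ C n u → a ∣ n
      order-∣ {n} ℘∣Cn with gcd-of a n
      ... | mkGCD g (divides h e) g∣n s t bz with ≉[]⇒deg {h} h≉
        where
        h≉ : ¬ h ≈ []
        h≉ h≈ = m≉[] (≈-trans m≈ (≈-trans (⊗-congʳ (≈-trans (≈-sym e) (≈-trans (⊗-congʳ h≈) (A.zeroˡ g))))
            (A.zeroˡ _)))
      ...   | zero , dh = ∣-trans (∣-respˡ e (∣-respʳ (A.*-identityˡ g) (⊗-mono-∣ (deg-0-∣𝟙 dh) (∣-refl {g})))) g∣n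
      ...   | suc j , dh with prime-divisor dh (s≤s z≤n)
      -- If g = gcd(a, n) were a proper divisor of a, take a prime ρ of a/g. Then g divides m/ρ, so
      -- ℘ divides w = C_(m/ρ)(u). As Q divides ρ + w^2 x, also ℘ divides ρ and hence a, a
      -- contradiction.
      ...     | i , ρ , R , divides h′ e′ with Q∣cofactor {h = h′ ⊗ g ⊗ ℘ ^ k} R eq
        where
        eq : h′ ⊗ g ⊗ ℘ ^ k ⊗ ρ ≈ m
        eq = ≈-trans (solve 4 (λ h g p ρ → h :* g :* p :* ρ := h :* ρ :* g :* p) ≈-refl h′ g (℘ ^ k) ρ)
          (≈-trans (⊗-congʳ (≈-trans (⊗-congʳ e′) e)) (≈-sym m≈))
      ...       | x , Q∣ρ+ = contradiction ℘∣ρ ℘∤ρ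
        where
        w = C (h′ ⊗ g ⊗ ℘ ^ k) u
        ℘∣Cg : ℘ ∣ C g u
        ℘∣Cg = ∣-respʳ (≈-trans (⊕-cong (≈-sym (C-⊗ s a u)) (≈-sym (C-⊗ t n u)))
                 (≈-trans (≈-sym (C-⊕ˡ (s ⊗ a) (t ⊗ n) u)) (C-congˡ {s ⊗ a ⊕ t ⊗ n} {g} u bz)))
                 (∣-⊕ (∣-trans ∣C-a (∣C s _)) (∣-trans ℘∣Cn (∣C t _)))
        ℘∣w : ℘ ∣ w
        ℘∣w = ∣-trans ℘∣Cg (C-∣ {g} {h′ ⊗ g ⊗ ℘ ^ k} u (∣-⊗ʳ (℘ ^ k) (∣-⊗ˡ h′ ∣-refl)))
        ℘∣ρ : ℘ ∣ ρ
        ℘∣ρ = ∣-respʳ (solve 2 (λ x y → x :+ y :- y := x) ≈-refl ρ (w ⊗ (w ⊗ x)))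
          (∣-⊖ (∣-trans ℘∣Q Q∣ρ+) (∣-⊗ʳ (w ⊗ x) ℘∣w))
        ℘∤ρ : ¬ ℘ ∣ ρ
        ℘∤ρ dv = ℘∤a (∣-trans dv (∣-trans (divides h′ e′) (∣-respʳ e (∣-⊗ʳ g ∣-refl))))

      order-∣-⊖𝟙 : a ∣ ℘ ⊖ 𝟙
      order-∣-⊖𝟙 = order-∣ (C-prime-⊖-𝟙 P u)

      -- For w = C_(m/℘)(u) the polynomial Q divides ℘ + w^2 s, and ℘ divides w. From ℘^2 | Q it
      -- would follow that ℘^2 | ℘.
      square-∤ : 0 < k → ¬ ℘ ⊗ ℘ ∣ Q
      square-∤ 0<k ℘²∣Q = lemma 0<k m≈
        where
        lemma : ∀ {k} → 0 < k → ¬ m ≈ a ⊗ ℘ ^ k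
        lemma {suc k} _ m≈ with Q∣cofactor {h = a ⊗ ℘ ^ k} P
          (≈-trans (solve 3 (λ a p π → a :* p :* π := a :* (π :* p)) ≈-refl a (℘ ^ k) ℘) (≈-sym m≈))
        ... | s , Q∣℘+ = ℕP.<⇒≱ (ℕP.m<m+n d positive)
              (∣⇒deg≤ ℘²∣℘ (deg-⊗ (Mon⇒Deg monic) (Mon⇒Deg monic)) (Mon⇒Deg monic))
          where
          w = C (a ⊗ ℘ ^ k) u
          ℘∣w : ℘ ∣ w
          ℘∣w = ∣-trans ∣C-a (C-∣ {a} {a ⊗ ℘ ^ k} u (∣-⊗ʳ (℘ ^ k) ∣-refl))
          ℘²∣℘ : ℘ ⊗ ℘ ∣ ℘
          ℘²∣℘ = ∣-respʳ (solve 2 (λ x y → x :+ y :- y := x) ≈-refl ℘ (w ⊗ (w ⊗ s)))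
            (∣-⊖ (∣-trans ℘²∣Q Q∣℘+) (∣-respʳ (A.*-assoc w w s) (∣-⊗ʳ s (⊗-mono-∣ ℘∣w ℘∣w))))

    -- If Q does not divide (m + 1) R, a prime ℘ divides Q to a higher power than (m + 1) R.  Either ℘ ∤ m, so m
    -- is the order of u modulo ℘ and m divides ℘ - 1, or ℘ | m, so ℘ divides R and divides Q only once.
    large-zsigmondy : ∀ {n R} → Mon n m → 0 < n → ¬ R ≈ [] →
      (∀ {d ℘} → Prime d ℘ → ℘ ∣ Q → ℘ ∣ m → ℘ ∣ R) → ¬ Q ∣ (m ⊕ 𝟙) ⊗ R → LargeZ n m u
    large-zsigmondy {n} {R} mm 0<n R≉ cover Q∤B with gcd-of Q ((m ⊕ 𝟙) ⊗ R)
    ... | mkGCD G (divides Q′ eQ) (divides B′ eB) s t bz with ≉[]⇒deg {Q′}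
          (λ z → deg⇒≉[] Q-deg (≈-trans (≈-sym eQ) (≈-trans (⊗-congʳ z) (A.zeroˡ G))))
    ...   | zero , dQ′ = contradiction (∣-trans
        (∣-respˡ eQ (∣-respʳ (A.*-identityˡ G) (⊗-mono-∣ (deg-0-∣𝟙 dQ′) (∣-refl {G})))) (divides B′ eB)) Q∤B
    ...   | suc _ , dQ′ with prime-divisor dQ′ (s≤s z≤n)
    ...     | d , ℘ , P , ℘∣Q′ = result
      where
      open Prime P
      ℘∣Q : ℘ ∣ Q
      ℘∣Q = ∣-respʳ eQ (∣-⊗ʳ G ℘∣Q′)
      G≉ : ¬ G ≈ []
      G≉ = ∣-≉[] (divides Q′ eQ) (deg⇒≉[] Q-deg)
      coprime : s ⊗ Q′ ⊕ t ⊗ B′ ≈ 𝟙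
      coprime = ⊗-cancelʳ G≉ (≈-trans
        (solve 5 (λ s q t b g → (s :* q :+ t :* b) :* g := s :* (q :* g) :+ t :* (b :* g)) ≈-refl s Q′ t B′ G)
        (≈-trans (⊕-cong (⊗-congˡ eQ) (⊗-congˡ eB)) (≈-trans bz (≈-sym (A.*-identityˡ G)))))
      ℘∤B′ : ¬ ℘ ∣ B′
      ℘∤B′ dv = ∤𝟙 (∣-respʳ coprime (∣-⊕ (∣-⊗ˡ s ℘∣Q′) (∣-⊗ˡ t dv)))
      ∣B⇒∣G : ℘ ∣ (m ⊕ 𝟙) ⊗ R → ℘ ∣ G
      ∣B⇒∣G dv with euclid B′ G (∣-respʳ (≈-sym eB) dv)
      ... | inj₁ x = contradiction x ℘∤B′
      ... | inj₂ x = x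
      ∣B⇒²∣Q : ℘ ∣ (m ⊕ 𝟙) ⊗ R → ℘ ⊗ ℘ ∣ Q
      ∣B⇒²∣Q dv = ∣-respʳ eQ (⊗-mono-∣ ℘∣Q′ (∣B⇒∣G dv))
      result : LargeZ n m u
      result with ℘ ∣? m
      ... | yes ℘∣m with multiplicity P m m≉[]
      ...   | zero , a , m≈ , ℘∤a = contradiction (∣-respʳ (≈-trans m≈ (A.*-identityʳ a)) ℘∣m) ℘∤a
      ...   | suc k , a , m≈ , ℘∤a = contradiction (∣B⇒²∣Q (∣-⊗ˡ (m ⊕ 𝟙) (cover P ℘∣Q ℘∣m)))
                (square-∤ {k = suc k} P ℘∣Q m≈ ℘∤a (s≤s z≤n))
      result | no ℘∤m = largeZ P (∣-trans ℘∣Q Q∣)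
          (λ dx j<n ℘∣Cx → ℕP.<⇒≱ j<n (∣⇒deg≤ (order-∣ {k = 0} P ℘∣Q m≈m ℘∤m ℘∣Cx) (Mon⇒Deg mm) dx)) large
        where
        m≈m : m ≈ m ⊗ ℘ ^ 0
        m≈m = ≈-sym (A.*-identityʳ m)
        m∣℘-1 : m ∣ ℘ ⊖ 𝟙
        m∣℘-1 = order-∣-⊖𝟙 {k = 0} P ℘∣Q m≈m ℘∤m
        mon-℘-1 : Mon d (℘ ⊖ 𝟙)
        mon-℘-1 = mon-⊕ ℘ (⊝ 𝟙) monic (below-⊝ 𝟙 (below-mono 𝟙 positive (below-length 𝟙)))
        large : n < d ⊎ ℘ ⊗ ℘ ∣ C m u
        large with ℕP.m≤n⇒m<n∨m≡n (∣⇒deg≤ m∣℘-1 (Mon⇒Deg mm) (Mon⇒Deg mon-℘-1))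
        ... | inj₁ n<d = inj₁ n<d
        -- Equal degrees force ℘ = m + 1, which divides (m + 1) R; by the choice of ℘ its square
        -- then divides Q.
        ... | inj₂ refl = inj₂ (∣-trans (∣B⇒²∣Q (∣-⊗ʳ R (∣-reflexive (≈-sym m+1≈)))) Q∣)
          where
          m+1≈ : m ⊕ 𝟙 ≈ ℘
          m+1≈ = ≈-trans (⊕-congʳ (mon-∣-≈ mm mon-℘-1 m∣℘-1)) (⊖⊕-cancel ℘ 𝟙)

-- Exponential against linear growth.

module Growth where
  open import Data.Nat using (_+_; _*_; _^_)
  open ℕP.≤-Reasoning
  open NS using (solve; _:=_; _:+_; _:*_; con)

  n<2^n : ∀ n → n < 2 ^ n
  n<2^n zero    = s≤s z≤n
  n<2^n (suc n) = begin-strict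
    suc n            ≤⟨ n<2^n n ⟩
    2 ^ n            <⟨ ℕP.m<m+n (2 ^ n) (ℕP.m^n>0 2 n) ⟩
    2 ^ n + 2 ^ n    ≡⟨ cong (2 ^ n +_) (ℕP.+-identityʳ _) ⟨
    2 ^ suc n        ∎

  -- Together with deg Q ≥ (q - 1)^n this gives deg Q > 2n for nonconstant u as soon as q ≥ 4.
  2n<3^n : ∀ n → 2 * n < 3 ^ n
  2n<3^n zero = s≤s z≤n
  2n<3^n (suc n) = begin-strict
    2 * suc n              ≡⟨ ℕP.*-distribˡ-+ 2 1 n ⟩
    2 + 2 * n              <⟨ ℕP.+-monoʳ-< 2 (2n<3^n n) ⟩
    2 + 3 ^ n              ≤⟨ ℕP.+-monoˡ-≤ (3 ^ n) (ℕP.*-monoʳ-≤ 2 (ℕP.m^n>0 3 n)) ⟩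
    2 * 3 ^ n + 3 ^ n      ≡⟨ ℕP.+-comm (2 * 3 ^ n) (3 ^ n) ⟩
    3 ^ suc n              ∎

  2n<2^n : ∀ n → 2 * (3 + n) < 2 ^ (3 + n)
  2n<2^n zero = ℕP.≤ᵇ⇒≤ 7 8 _
  2n<2^n (suc n) = begin-strict
    2 * (4 + n)                        ≡⟨ ℕP.*-distribˡ-+ 2 1 (3 + n) ⟩
    2 + 2 * (3 + n)                    <⟨ ℕP.+-monoʳ-< 2 (2n<2^n n) ⟩
    2 + 2 ^ (3 + n)                    ≤⟨ ℕP.+-monoˡ-≤ (2 ^ (3 + n)) (ℕP.^-monoʳ-≤ 2 {1} {3 + n} (s≤s z≤n)) ⟩
    2 ^ (3 + n) + 2 ^ (3 + n)          ≡⟨ cong (2 ^ (3 + n) +_) (ℕP.+-identityʳ _) ⟨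
    2 ^ (4 + n)                        ∎

  -- As q deg Q + 1 ≥ (q - 1)^n when u = 1, this gives deg Q > 2n; here q = suc p.
  Fast : ℕ → ℕ → Set
  Fast p n = 2 * n * suc p + 2 ≤ p ^ n

  -- The right side grows at least by the factor 2, and doubling the left side at n + 1 more than
  -- covers its value at n + 2.
  fast-step : ∀ {p} n → 2 ≤ p → Fast p (suc n) → Fast p (suc (suc n))
  fast-step {p} n 2≤p f = begin
    2 * suc (suc n) * suc p + 2
      ≡⟨ solve 2 (λ n p → con 2 :* (con 2 :+ n) :* (con 1 :+ p) :+ con 2 := con 4 :* (con 1 :+ p) :+ con 2 :* n :*
          (con 1 :+ p) :+ con 2) refl n p ⟩
    4 * suc p + 2 * n * suc p + 2                   ≤⟨ ℕP.m≤m+n _ (2 * n * suc p + 2) ⟩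
    4 * suc p + 2 * n * suc p + 2 + (2 * n * suc p + 2)
      ≡⟨ solve 2 (λ n p → con 4 :* (con 1 :+ p) :+ con 2 :* n :* (con 1 :+ p) :+ con 2 :+
          (con 2 :* n :* (con 1 :+ p) :+ con 2) := con 2 :* (con 2 :* (con 1 :+ n) :* (con 1 :+ p) :+ con 2)) refl n p
          ⟩
    2 * (2 * suc n * suc p + 2)                     ≤⟨ ℕP.*-mono-≤ 2≤p f ⟩
    p ^ suc (suc n)                                 ∎

  fast-from : ∀ {p} n → 2 ≤ p → Fast p (suc n) → ∀ j → Fast p (suc n + j)
  fast-from {p} n 2≤p f zero    = subst (Fast p) (sym (ℕP.+-identityʳ (suc n))) f
  fast-from {p} n 2≤p f (suc j) = subst (Fast p) (sym (ℕP.+-suc (suc n) j))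
      (fast-step (n + j) 2≤p (fast-from n 2≤p f j))

  fast-≥6 : ∀ {p} → 6 ≤ p → Fast p 2
  fast-≥6 {p} 6≤p = begin
    2 * 2 * suc p + 2    ≡⟨ solve 1 (λ p → con 4 :* (con 1 :+ p) :+ con 2 := con 4 :* p :+ con 6) refl p ⟩
    4 * p + 6            ≤⟨ ℕP.+-monoʳ-≤ (4 * p) (ℕP.≤-trans 6≤p (ℕP.m≤n*m p 2)) ⟩
    4 * p + 2 * p        ≡⟨ solve 1 (λ p → con 4 :* p :+ con 2 :* p := con 6 :* (p :* con 1)) refl p ⟩
    6 * (p * 1)          ≤⟨ ℕP.*-monoˡ-≤ (p * 1) 6≤p ⟩
    p * (p * 1)          ∎

  -- A prime of degree δ contributes q^δ - 1 to φ(m); this bounds the factor below by (q - 1)^δ.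
  [1+p]^ : ∀ p δ → 1 + p ^ suc δ ≤ suc p ^ suc δ
  [1+p]^ p zero = ℕP.≤-refl
  [1+p]^ p (suc δ) = begin
    1 + p ^ suc (suc δ)                  ≤⟨ ℕP.+-mono-≤ (ℕP.m≤m+n 1 (p ^ suc δ)) (ℕP.m≤m+n (p * p ^ suc δ) p) ⟩
    1 + p ^ suc δ + (p * p ^ suc δ + p)
      ≡⟨ solve 2 (λ p x → con 1 :+ x :+ (p :* x :+ p) := (con 1 :+ p) :* (con 1 :+ x)) refl p (p ^ suc δ) ⟩
    suc p * (1 + p ^ suc δ)              ≤⟨ ℕP.*-monoʳ-≤ (suc p) ([1+p]^ p δ) ⟩
    suc p ^ suc (suc δ)                  ∎

-- Closed formulas and lower bounds for the degree of Q.

module DegreeBounds where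
  open InclusionExclusion
  open Growth
  open import Data.Nat using (_+_; _*_; _^_; _∸_)

  computeE : (ℕ → ℕ) → List ℕ → ℕ → ℕ
  computeE Dg []       k = Dg k
  computeE Dg (d ∷ ds) k = computeE Dg ds (k + d) ∸ computeE Dg ds k

  E⇒compute : ∀ {Dg} ds {k e} → E Dg ds k e → e ≡ computeE Dg ds k
  E⇒compute []       refl = refl
  E⇒compute (d ∷ ds) {k} {e} (e₁ , e₀ , E₁ , E₀ , eq) =
    trans (sym (ℕP.m+n∸n≡m e e₀)) (cong₂ _∸_ (trans eq (E⇒compute ds E₁)) (E⇒compute ds E₀))

  module _ (p : ℕ) where
    q : ℕ
    q = suc p

    -- The degree of C_g(1) for deg g = k. The value at 0 breaks the pattern q^(k-1), and this is
    -- the source of the term μ(m) in deg Q.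
    D₁ : ℕ → ℕ
    D₁ zero    = 0
    D₁ (suc k) = q ^ k

    Dᵈ : ℕ → ℕ → ℕ
    Dᵈ d k = d * q ^ k

    -- The factor of φ(m) that stems from the distinct primes: φ(m) is `q ^ k * W ds`.
    W : List ℕ → ℕ
    W []       = 1
    W (δ ∷ ds) = W ds * pred (q ^ δ)

    q^≡ : ∀ δ → q ^ δ ≡ suc (pred (q ^ δ))
    q^≡ δ = sym (ℕP.suc-pred (q ^ δ) {{ℕ.>-nonZero (ℕP.m^n>0 q δ)}})

    W-bound : ∀ {ds} → All (0 <_) ds → p ^ ℕL.sum ds ≤ W ds
    W-bound [] = ℕP.≤-refl
    W-bound {suc δ ∷ ds} (_ ∷ ps) = begin
      p ^ (suc δ + ℕL.sum ds)         ≡⟨ ℕP.^-distribˡ-+-* p (suc δ) (ℕL.sum ds) ⟩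
      p ^ suc δ * p ^ ℕL.sum ds
        ≤⟨ ℕP.*-mono-≤ (ℕP.≤-pred (subst (1 + p ^ suc δ ≤_) (q^≡ (suc δ)) ([1+p]^ p δ))) (W-bound ps) ⟩
      pred (q ^ suc δ) * W ds         ≡⟨ ℕP.*-comm (pred (q ^ suc δ)) (W ds) ⟩
      W ds * pred (q ^ suc δ)         ∎
      where open ℕP.≤-Reasoning

    q^kW-bound : ∀ {k ds} → All (0 <_) ds → p ^ (k + ℕL.sum ds) ≤ q ^ k * W ds
    q^kW-bound {k} {ds} ps = subst (_≤ q ^ k * W ds) (sym (ℕP.^-distribˡ-+-* p k (ℕL.sum ds)))
      (ℕP.*-mono-≤ (ℕP.^-monoˡ-≤ k (ℕP.n≤1+n p)) (W-bound ps))

    private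
      step : ∀ {e x x₀ r s} → e + x ≡ x₀ → x₀ ≡ x * s → s ≡ suc r → e ≡ x * r
      step {e} {x} {x₀} {r} eq eq₀ refl = ℕP.+-cancelʳ-≡ x e (x * r) (trans eq (trans eq₀
        (trans (ℕP.*-suc x r) (ℕP.+-comm x (x * r)))))

    E-Dᵈ : ∀ d ds {k e} → E (Dᵈ d) ds k e → e ≡ d * q ^ k * W ds
    E-Dᵈ d []       refl = sym (ℕP.*-identityʳ _)
    E-Dᵈ d (δ ∷ ds) {k} {e} (e₁ , e₀ , E₁ , E₀ , eq) = trans
      (step {x = d * q ^ k * W ds} (trans (cong (e +_) (sym (E-Dᵈ d ds E₀))) eq)
        (trans (E-Dᵈ d ds E₁) (trans (cong (λ z → d * z * W ds) (ℕP.^-distribˡ-+-* q k δ))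
          (NS.solve 4 (λ d a b w → d NS.:* (a NS.:* b) NS.:* w NS.:= d NS.:* a NS.:* w NS.:* b) refl d (q ^ k) (q ^ δ)
              (W ds)))) (q^≡ δ))
      (ℕP.*-assoc (d * q ^ k) (W ds) _)

    E-Dᵈ-bound : ∀ {d ds k e} → All (0 <_) ds → E (Dᵈ d) ds k e → d * p ^ (k + ℕL.sum ds) ≤ e
    E-Dᵈ-bound {d} {ds} {k} ps Ee = subst (d * p ^ (k + ℕL.sum ds) ≤_)
        (trans (sym (ℕP.*-assoc d (q ^ k) (W ds))) (sym (E-Dᵈ d ds Ee)))
      (ℕP.*-monoʳ-≤ d (q^kW-bound {k} ps))

    E-D₁-suc : ∀ ds {k e} → E D₁ ds (suc k) e → q * e ≡ q ^ suc k * W ds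
    E-D₁-suc [] {k} refl = sym (ℕP.*-identityʳ (q ^ suc k))
    E-D₁-suc (δ ∷ ds) {k} {e} (e₁ , e₀ , E₁ , E₀ , eq) = trans
      (step {x = q ^ suc k * W ds} (trans (cong (q * e +_) (sym (E-D₁-suc ds E₀)))
          (trans (sym (ℕP.*-distribˡ-+ q e e₀)) (cong (q *_) eq)))
        (trans (E-D₁-suc ds E₁) (trans (cong (_* W ds) (ℕP.^-distribˡ-+-* q (suc k) δ))
          (NS.solve 3 (λ a b w → a NS.:* b NS.:* w NS.:= a NS.:* w NS.:* b) refl (q ^ suc k) (q ^ δ) (W ds))))
              (q^≡ δ))
      (ℕP.*-assoc (q ^ suc k) (W ds) _)

    -- For squarefree m the difference `even ds` - `odd ds` is μ(m); the two parts are kept apart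
    -- because subtraction on ℕ truncates.
    even odd : List ℕ → ℕ
    even []       = 1
    even (_ ∷ ds) = odd ds
    odd []       = 0
    odd (_ ∷ ds) = even ds

    even≤1 : ∀ ds → even ds ≤ 1
    odd≤1 : ∀ ds → odd ds ≤ 1
    even≤1 []       = ℕP.≤-refl
    even≤1 (_ ∷ ds) = odd≤1 ds
    odd≤1 []       = z≤n
    odd≤1 (_ ∷ ds) = even≤1 ds

    -- The relation q · D₁ k = q^k fails only at k = 0, where the left side is 0 and not 1. For
    -- squarefree m this term occurs once, with sign μ(m), so q deg Q = φ(m) - μ(m).
    E-D₁-zero : ∀ {ds e} → All (0 <_) ds → E D₁ ds 0 e → q * e + even ds ≡ W ds + odd ds
    E-D₁-zero [] refl = cong (_+ 1) (ℕP.*-zeroʳ q)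
    E-D₁-zero {suc δ ∷ ds} {e} (_ ∷ ps) (e₁ , e₀ , E₁ , E₀ , eq) = ℕP.+-cancelˡ-≡ (W ds) _ _ (begin
      W ds + (q * e + odd ds)
        ≡⟨ NS.solve 3 (λ w x o → w NS.:+ (x NS.:+ o) NS.:= x NS.:+ (w NS.:+ o)) refl (W ds) (q * e) (odd ds) ⟩
      q * e + (W ds + odd ds)                  ≡⟨ cong (q * e +_) (E-D₁-zero ps E₀) ⟨
      q * e + (q * e₀ + even ds)
        ≡⟨ NS.solve 4 (λ q e e₀ v → q NS.:* e NS.:+ (q NS.:* e₀ NS.:+ v) NS.:= q NS.:* (e NS.:+ e₀) NS.:+ v) refl q e
            e₀ (even ds) ⟩
      q * (e + e₀) + even ds                   ≡⟨ cong (λ z → q * z + even ds) eq ⟩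
      q * e₁ + even ds                         ≡⟨ cong (_+ even ds) (E-D₁-suc ds E₁) ⟩
      q ^ suc δ * W ds + even ds               ≡⟨ cong (λ z → z * W ds + even ds) (q^≡ (suc δ)) ⟩
      suc r * W ds + even ds
        ≡⟨ NS.solve 3 (λ r w v → (NS.con 1 NS.:+ r) NS.:* w NS.:+ v NS.:= w NS.:+ (w NS.:* r NS.:+ v)) refl r (W ds)
            (even ds) ⟩
      W ds + (W ds * r + even ds)              ∎)
      where
      open ≡-Reasoning
      r = pred (q ^ suc δ)

    E-D₁-bound : ∀ {k ds e} → All (0 <_) ds → E D₁ ds k e → p ^ (k + ℕL.sum ds) ≤ q * e + 1
    E-D₁-bound {zero} {ds} {e} ps Ee = begin
      p ^ ℕL.sum ds         ≤⟨ W-bound ps ⟩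
      W ds                  ≤⟨ ℕP.m≤m+n (W ds) (odd ds) ⟩
      W ds + odd ds         ≡⟨ E-D₁-zero ps Ee ⟨
      q * e + even ds       ≤⟨ ℕP.+-monoʳ-≤ (q * e) (even≤1 ds) ⟩
      q * e + 1             ∎
      where open ℕP.≤-Reasoning
    E-D₁-bound {suc k} {ds} {e} ps Ee = ℕP.≤-trans (q^kW-bound {suc k} ps)
      (ℕP.≤-trans (ℕP.≤-reflexive (sym (E-D₁-suc ds Ee))) (ℕP.m≤m+n (q * e) 1))

    fast⇒large : ∀ {n k ds e} → All (0 <_) ds → E D₁ ds k e → k + ℕL.sum ds ≡ n → Fast p n → 2 * n < e
    fast⇒large {n} {k} {ds} {e} ps Ee refl f = ℕP.*-cancelˡ-< q (2 * n) e (ℕP.+-cancelʳ-≤ 1 _ _ (begin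
      suc (q * (2 * n)) + 1
        ≡⟨ NS.solve 2 (λ p n → NS.con 1 NS.:+ (NS.con 1 NS.:+ p) NS.:* (NS.con 2 NS.:* n) NS.:+ NS.con 1 NS.:= NS.con
            2 NS.:* n NS.:* (NS.con 1 NS.:+ p) NS.:+ NS.con 2) refl p n ⟩
      2 * n * suc p + 2           ≤⟨ f ⟩
      p ^ n                       ≤⟨ E-D₁-bound {k} ps Ee ⟩
      q * e + 1                   ∎))
      where open ℕP.≤-Reasoning

-- Arithmetic in fields with few elements.

module SmallFields (𝔽 : FiniteField) (2<card : 2 < FiniteField.card 𝔽) where
  open FermatLittle 𝔽
  open FieldRing 𝔽
  open FiniteField 𝔽 using (_+_; _*_; -_; _≟_; finite; card; 0≢1)
  open K using (solve; _:=_; _:+_; _:*_; _:-_; :-_; num)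

  integral : ∀ {a b} → a * b ≡ 0# → a ≡ 0# ⊎ b ≡ 0#
  integral {a} {b} e with a ≟ 0# | b ≟ 0#
  ... | yes a≡ | _      = inj₁ a≡
  ... | no _   | yes b≡ = inj₂ b≡
  ... | no a≢  | no b≢  = contradiction e (nonzero-* a≢ b≢)

  injection⇒card≤ : ∀ {N} (f : F → Fin N) → (∀ a b → f a ≡ f b → a ≡ b) → card ≤ N
  injection⇒card≤ f inj = FinP.injective⇒≤ {f = λ i → f (element i)}
    (λ {i} {j} e → trans (sym (Inverse.strictlyInverseˡ finite i))
      (trans (cong (Inverse.to finite) (inj (element i) (element j) e)) (Inverse.strictlyInverseˡ finite j)))

  -- Pigeonhole: a missed value would extend `r` to an injection of N + 1 elements into a field with
  -- N.
  surjective : ∀ {N} → card ≡ N → (r : Fin N → F) → (∀ i j → r i ≡ r j → i ≡ j) → ∀ c → ∃ λ i → r i ≡ c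
  surjective {N} card≡ r inj c with FinP.any? (λ i → r i ≟ c)
  ... | yes found = found
  ... | no none   = contradiction (FinP.injective⇒≤ {f = λ i → Inverse.to finite (r⁺ i)}
                      (λ {i} {j} e → inj⁺ i j (to-injective e)))
                      (ℕP.<⇒≱ (s≤s (ℕP.≤-reflexive card≡)))
    where
    r⁺ : Fin (suc N) → F
    r⁺ zero    = c
    r⁺ (suc i) = r i
    to-injective : ∀ {a b} → Inverse.to finite a ≡ Inverse.to finite b → a ≡ b
    to-injective {a} {b} e = trans (sym (Inverse.strictlyInverseʳ finite a))
      (trans (cong element e) (Inverse.strictlyInverseʳ finite b))
    inj⁺ : ∀ i j → r⁺ i ≡ r⁺ j → i ≡ j
    inj⁺ zero    zero    e = refl
    inj⁺ zero    (suc j) e = contradiction (j , sym e) none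
    inj⁺ (suc i) zero    e = contradiction (i , e) none
    inj⁺ (suc i) (suc j) e = cong suc (inj i j e)

  multiples : ∀ {N} → card ≡ N → (∀ k → 0 < k → k < N → ¬ multiple k 1# ≡ 0#) →
              ∀ c → ∃ λ (i : Fin N) → multiple (toℕ i) 1# ≡ c
  multiples {N} card≡ nz = surjective card≡ (λ i → multiple (toℕ i) 1#)
    (λ i j e → FinP.toℕ-injective (inj (toℕ i) (toℕ j) (FinP.toℕ<n i) (FinP.toℕ<n j) e))
    where
    apart : ∀ i j → i < j → j < N → ¬ multiple i 1# ≡ multiple j 1#
    apart i j i<j j<N e with ℕP.m≤n⇒∃[o]m+o≡n i<j
    ... | o , refl = nz (suc o) (s≤s z≤n)
        (ℕP.≤-trans (s≤s (ℕP.m≤n+m (suc o) i)) (subst (_≤ N) (cong suc (sym (ℕP.+-suc i o))) j<N))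
      (begin
        multiple (suc o) 1#   ≡⟨ solve 2 (λ a b → b := (a :+ b) :- a) refl (multiple i 1#) (multiple (suc o) 1#) ⟩
        multiple i 1# + multiple (suc o) 1# + - multiple i 1#  ≡⟨ cong (_+ - multiple i 1#) (×-homo-+ 1# i (suc o)) ⟨
        multiple (i ℕ.+ suc o) 1# + - multiple i 1#  ≡⟨ cong (λ k → multiple k 1# + - multiple i 1#) (ℕP.+-suc i o) ⟩
        multiple (suc i ℕ.+ o) 1# + - multiple i 1#  ≡⟨ cong (_+ - multiple i 1#) (sym e) ⟩
        multiple i 1# + - multiple i 1#  ≡⟨ K.-‿inverseʳ _ ⟩
        0#                    ∎)
      where
      open ≡-Reasoning
      open Algebra.Properties.Monoid.Mult K.+-monoid using (×-homo-+)
    inj : ∀ i j → i < N → j < N → multiple i 1# ≡ multiple j 1# → i ≡ j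
    inj i j i<N j<N e with ℕP.<-cmp i j
    ... | tri< i<j _ _ = contradiction e (apart i j i<j j<N)
    ... | tri≈ _ e′ _  = e′
    ... | tri> _ _ j<i = contradiction (sym e) (apart j i j<i i<N)

  2# 3# 4# 5# 6# : F
  2# = 1# + 1#
  3# = 2# + 1#
  4# = 3# + 1#
  5# = 4# + 1#
  6# = 5# + 1#

  multiple-2 : multiple 2 1# ≡ 2#
  multiple-2 = solve 0 (num 1 :+ (num 1 :+ num 0) := num 2) refl

  multiple-3 : multiple 3 1# ≡ 3#
  multiple-3 = solve 0 (num 1 :+ (num 1 :+ (num 1 :+ num 0)) := num 3) refl

  multiple-4 : multiple 4 1# ≡ 4#
  multiple-4 = trans (cong (1# +_) multiple-3) (K.+-comm 1# 3#)

  multiple-5 : multiple 5 1# ≡ 5#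
  multiple-5 = trans (cong (1# +_) multiple-4) (K.+-comm 1# 4#)

  1≢0 : ¬ 1# ≡ 0#
  1≢0 e = 0≢1 (sym e)

  module Card3 (card≡3 : card ≡ 3) where
    3≡0 : 3# ≡ 0#
    3≡0 = trans (sym multiple-3) (subst (λ k → multiple k 1# ≡ 0#) card≡3 multiple-card)

    2≢0 : ¬ 2# ≡ 0#
    2≢0 e = 1≢0 (trans (sym (K.+-identityˡ 1#)) (trans (cong (_+ 1#) (sym e)) 3≡0))

    elements : ∀ c → c ≡ 0# ⊎ c ≡ 1# ⊎ c ≡ 2#
    elements c with multiples card≡3 nz c
      where
      nz : ∀ k → 0 < k → k < 3 → ¬ multiple k 1# ≡ 0#
      nz 1 _ _ e = 1≢0 (trans (sym (K.+-identityʳ 1#)) e)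
      nz 2 _ _ e = 2≢0 (trans (sym multiple-2) e)
      nz (suc (suc (suc k))) _ (s≤s (s≤s (s≤s ())))
    ... | 0F , e = inj₁ (sym e)
    ... | 1F , e = inj₂ (inj₁ (trans (sym e) (K.+-identityʳ 1#)))
    ... | 2F , e = inj₂ (inj₂ (trans (sym e) multiple-2))

  module Card4 (card≡4 : card ≡ 4) where
    2≡0 : 2# ≡ 0#
    2≡0 with integral {2#} {2#} (trans (solve 0 (num 2 :* num 2 := num 4) refl)
                 (trans (sym multiple-4) (subst (λ k → multiple k 1# ≡ 0#) card≡4 multiple-card)))
    ... | inj₁ e = e
    ... | inj₂ e = e

    -- By Fermat's theorem w^4 - w = w (w - 1)(w^2 + w + 1) vanishes.
    cube-root : ∀ w → w ≡ 0# ⊎ w ≡ 1# ⊎ w * w + w + 1# ≡ 0#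
    cube-root w with integral {w} {(w + - 1#) * (w * w + w + 1#)} (begin
        w * ((w + - 1#) * (w * w + w + 1#))
          ≡⟨ solve 1 (λ w → w :* ((w :- num 1) :* (w :* w :+ w :+ num 1)) := w :* (w :* (w :* (w :* num 1))) :- w)
              refl w ⟩
        pow 4 w + - w                         ≡⟨ cong (_+ - w) (subst (λ k → pow k w ≡ w) card≡4 (fermat w)) ⟩
        w + - w                               ≡⟨ K.-‿inverseʳ w ⟩
        0#                                    ∎)
      where open ≡-Reasoning
    ... | inj₁ e = inj₁ e
    ... | inj₂ e with integral e
    ...   | inj₁ e′ = inj₂ (inj₁ (trans (solve 1 (λ w → w := (w :- num 1) :+ num 1) refl w)
        (trans (cong (_+ 1#) e′) (K.+-identityˡ 1#))))
    ...   | inj₂ e′ = inj₂ (inj₂ e′)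

  module Card5 (card≡5 : card ≡ 5) where
    5≡0 : 5# ≡ 0#
    5≡0 = trans (sym multiple-5) (subst (λ k → multiple k 1# ≡ 0#) card≡5 multiple-card)

    4≢0 : ¬ 4# ≡ 0#
    4≢0 e = 1≢0 (trans (sym (K.+-identityˡ 1#)) (trans (cong (_+ 1#) (sym e)) 5≡0))

    2≢0 : ¬ 2# ≡ 0#
    2≢0 e = 4≢0 (trans (solve 0 (num 4 := num 2 :* num 2) refl) (trans (cong (2# *_) e) (K.zeroʳ 2#)))

    3≢0 : ¬ 3# ≡ 0#
    3≢0 e = 2≢0 (trans (solve 0 (num 2 := num 5 :- num 3) refl)
        (trans (cong₂ (λ a b → a + - b) 5≡0 e) (K.-‿inverseʳ 0#)))

    elements : ∀ c → c ≡ 0# ⊎ c ≡ 1# ⊎ c ≡ 2# ⊎ c ≡ 3# ⊎ c ≡ 4#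
    elements c with multiples card≡5 nz c
      where
      nz : ∀ k → 0 < k → k < 5 → ¬ multiple k 1# ≡ 0#
      nz 1 _ _ e = 1≢0 (trans (sym (K.+-identityʳ 1#)) e)
      nz 2 _ _ e = 2≢0 (trans (sym multiple-2) e)
      nz 3 _ _ e = 3≢0 (trans (sym multiple-3) e)
      nz 4 _ _ e = 4≢0 (trans (sym multiple-4) e)
      nz (suc (suc (suc (suc (suc k))))) _ (s≤s (s≤s (s≤s (s≤s (s≤s ())))))
    ... | 0F , e = inj₁ (sym e)
    ... | 1F , e = inj₂ (inj₁ (trans (sym e) (K.+-identityʳ 1#)))
    ... | 2F , e = inj₂ (inj₂ (inj₁ (trans (sym e) multiple-2)))
    ... | 3F , e = inj₂ (inj₂ (inj₂ (inj₁ (trans (sym e) multiple-3))))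
    ... | 4F , e = inj₂ (inj₂ (inj₂ (inj₂ (trans (sym e) multiple-4))))

  -- (x + 1)^6 = x^6 + x^4 + x^2 + 1 in characteristic 2, so x^6 = x for all x forces x^2 (x + 1)^2 = 0.
  card≡6⇒2≢0 : card ≡ 6 → ¬ 2# ≡ 0#
  card≡6⇒2≢0 card≡6 2≡0 = ℕP.<⇒≱ 2<card (injection⇒card≤ f inj)
    where
    open ≡-Reasoning
    x⁶ : ∀ x → x * (x * (x * (x * (x * (x * 1#))))) ≡ x
    x⁶ x = subst (λ k → pow k x ≡ x) card≡6 (fermat x)
    rest : F → F
    rest x = 3# * (x * x * x * x * x) + (6# + 1#) * (x * x * x * x) + (6# + 1# + 1# + 1#) * (x * x * x) + (6# + 1#) *
        (x * x) + 3# * x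
    vanish : ∀ x → (x * (x + 1#)) * (x * (x + 1#)) ≡ 0#
    vanish x = begin
      (x * (x + 1#)) * (x * (x + 1#))
        ≡⟨ solve 1 (λ x → let y = x :+ num 1 in (x :* y) :* (x :* y) :=
             y :* (y :* (y :* (y :* (y :* (y :* num 1))))) :- x :* (x :* (x :* (x :* (x :* (x :* num 1))))) :- num 1
             :- num 2 :* (num 3 :* (x :* x :* x :* x :* x) :+ num 7 :* (x :* x :* x :* x) :+ num 9 :* (x :* x :* x) :+
                 num 7 :* (x :* x) :+ num 3 :* x)) refl x ⟩
      (x + 1#) * ((x + 1#) * ((x + 1#) * ((x + 1#) * ((x + 1#) * ((x + 1#) * 1#))))) + -
          (x * (x * (x * (x * (x * (x * 1#)))))) + - 1# + - (2# * rest x)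
        ≡⟨ cong₂ _+_ (cong₂ (λ a b → a + - b + - 1#) (x⁶ (x + 1#)) (x⁶ x)) (cong (λ a → - (a * rest x)) 2≡0) ⟩
      (x + 1#) + - x + - 1# + - (0# * rest x)
        ≡⟨ solve 2 (λ x z → (x :+ num 1) :- x :- num 1 :- num 0 :* z := num 0) refl x (rest x) ⟩
      0# ∎
    zero-or-one : ∀ x → x ≡ 0# ⊎ x + 1# ≡ 0#
    zero-or-one x with integral (vanish x)
    ... | inj₁ e = integral e
    ... | inj₂ e = integral e
    f : F → Fin 2
    f x with zero-or-one x
    ... | inj₁ _ = 0F
    ... | inj₂ _ = 1F
    inj : ∀ a b → f a ≡ f b → a ≡ b
    inj a b e with zero-or-one a | zero-or-one b
    inj a b e | inj₁ u | inj₁ v = trans u (sym v)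
    inj a b () | inj₁ u | inj₂ v
    inj a b () | inj₂ u | inj₁ v
    inj a b e | inj₂ u | inj₂ v = trans (solve 1 (λ a → a := (a :+ num 1) :- num 1) refl a)
      (trans (cong (_+ - 1#) (trans u (sym v))) (solve 1 (λ a → (a :+ num 1) :- num 1 := a) refl b))

-- The lists of the statement as families in one linear polynomial.

module ExceptionalCases (𝔽 : FiniteField) (2<card : 2 < FiniteField.card 𝔽) where
  open ZsigmondyPrimes 𝔽 2<card public
  open SmallFields 𝔽 2<card public
  open FiniteField 𝔽 using (_+_; _*_; -_; card)
  open A using (solve; _:=_; _:+_; _:*_; _:-_; :-_; num)
  private module D = Poly 𝔽

  -- The exceptional cases, with the degree-one polynomial x = T + c left arbitrary.
  data Exception (m u : Pol) : Set where
    exc-I    : ∀ {x} → card ≡ 3 → u ≈ 𝟙 → Mon 1 x → m ≈ (x ⊖ 𝟙) ⊗ x → Exception m u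
    exc-II   : ∀ {x} → card ≡ 4 → u ≈ 𝟙 → Mon 1 x → m ≈ (x ⊖ 𝟙) ⊗ x → Exception m u
    exc-III  : ∀ {x} → card ≡ 3 → u ≈ 𝟙 → Mon 1 x → m ≈ (x ⊖ 𝟙) ⊗ (x ⊗ x) → Exception m u
    exc-IV   : card ≡ 3 → Mon 1 m → u ≈ m → Exception m u
    exc-V    : ∀ {x} → card ≡ 5 → u ≈ 𝟙 → Mon 1 x → m ≈ x ⊗ (x ⊕ 𝟙) → Exception m u
    exc-VI   : u ≈ 𝟙 → Mon 1 m → Exception m u
    exc-VII  : ∀ {x} → card ≡ 3 → u ≈ 𝟙 → Mon 1 x → m ≈ x ⊗ x → Exception m u
    exc-VIII : ∀ {x w} → card ≡ 4 → u ≈ 𝟙 → Mon 1 x → w * w + w + 1# ≡ 0# → m ≈ x ⊗ (x ⊕ ‵ w) → Exception m u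
    exc-IX   : ∀ {x} → card ≡ 3 → u ≈ 𝟙 → Mon 1 x → m ≈ (x ⊖ 𝟙) ⊗ x ⊗ (x ⊕ 𝟙) → Exception m u

  prime-resp : ∀ {n π ρ} → π ≈ ρ → Prime n π → Prime n ρ
  prime-resp e P = mkPrime (mon-resp e monic) positive
    (λ a b d → [ (λ x → inj₁ (∣-respˡ e x)) , (λ x → inj₂ (∣-respˡ e x)) ]′ (euclid a b (∣-respˡ (≈-sym e) d)))
    where open Prime P

  linear-prime : ∀ {x} → Mon 1 x → Prime 1 x
  linear-prime {x} m with prime-divisor (Mon⇒Deg m) (s≤s z≤n)
  ... | k , π , P , π∣x with ℕP.≤-antisym (∣⇒deg≤ π∣x (Mon⇒Deg (Prime.monic P)) (Mon⇒Deg m)) (Prime.positive P)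
  ...   | refl = prime-resp (mon-∣-≈ (Prime.monic P) m π∣x) P

  linear-≈ : ∀ {x} → Mon 1 x → ∀ c → coeff x 0 ≡ c → x ≈ T ⊕ ‵ c
  at (linear-≈ {x} m c e) zero = trans e (sym (trans (coeff-⊕ T (‵ c) 0) (K.+-identityˡ c)))
  at (linear-≈ {x} m c e) (suc zero) = trans (Mon.lead≡1 m) (sym (trans (coeff-⊕ T (‵ c) 1) (K.+-identityʳ 1#)))
  at (linear-≈ {x} m c e) (suc (suc i)) = trans (Mon.above m (suc (suc i)) (s≤s (s≤s z≤n)))
    (sym (trans (coeff-⊕ T (‵ c) (suc (suc i))) (K.+-identityʳ 0#)))

  T⊕‵0 : T ≈ T ⊕ ‵ 0#
  T⊕‵0 = linear-≈ mon-T 0# refl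

  ‵-suc : ∀ c → T ⊕ ‵ c ⊕ 𝟙 ≈ T ⊕ ‵ (c + 1#)
  ‵-suc c = ≈-trans (A.+-assoc T (‵ c) 𝟙) (⊕-congˡ (‵-+ c 1#))

  ‵-cong : ∀ {a b} → a ≡ b → ‵ a ≈ ‵ b
  ‵-cong refl = ≈-refl

  T⊕𝟙 : T ⊕ 𝟙 ≈ T ⊕ ‵ (0# + 1#)
  T⊕𝟙 = ⊕-congˡ (‵-cong (sym (K.+-identityˡ 1#)))

  ⊖𝟙-≈ : ∀ {x y} → x ≈ y ⊕ 𝟙 → x ⊖ 𝟙 ≈ y
  ⊖𝟙-≈ {x} {y} e = ≈-trans (⊖-cong e ≈-refl) (solve 1 (λ y → (y :+ num 1) :- num 1 := y) ≈-refl y)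

  square : ∀ x → x ^ 2 ≈ x ⊗ x
  square x = ⊗-congˡ (A.*-identityʳ x)

  char : ∀ {n} → n ≡ 0# → ‵ n ≈ []
  char = ‵0≈[]

  ‵3≈ : ‵ 3# ≈ 𝟙 ⊕ 𝟙 ⊕ 𝟙
  ‵3≈ = ≈-sym (≈-trans (⊕-congʳ (‵-+ 1# 1#)) (‵-+ 2# 1#))

  module _ (card≡4 : card ≡ 4) where
    open Card4 card≡4

    root-square : ∀ {w} → w * w + w + 1# ≡ 0# → w + 1# ≡ w * w
    root-square {w} e = begin
      w + 1#
        ≡⟨ K.solve 1 (λ w → w K.:+ K.num 1 K.:= (w K.:* w K.:+ w K.:+ K.num 1) K.:+ w K.:* w K.:- K.num 2 K.:*
            (w K.:* w)) refl w ⟩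
      (w * w + w + 1#) + w * w + - (2# * (w * w))  ≡⟨ cong₂ (λ a b → a + w * w + - (b * (w * w))) e 2≡0 ⟩
      0# + w * w + - (0# * (w * w))
        ≡⟨ K.solve 1 (λ x → K.num 0 K.:+ x K.:- K.num 0 K.:* x K.:= x) refl (w * w) ⟩
      w * w                                ∎
      where open ≡-Reasoning

    square-root : ∀ {w} → w * w + w + 1# ≡ 0# → w * w * (w * w) + w * w + 1# ≡ 0#
    square-root {w} e = trans (K.solve 1
        (λ w → w K.:* w K.:* (w K.:* w) K.:+ w K.:* w K.:+ K.num 1 K.:= (w K.:* w K.:+ w K.:+ K.num 1) K.:*
        (w K.:* w K.:- w K.:+ K.num 1)) refl w)
      (trans (cong (_* (w * w + - w + 1#)) e) (K.zeroˡ _))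

    double : ∀ a → a + a ≡ 0#
    double a = trans (K.solve 1 (λ a → a K.:+ a K.:= K.num 2 K.:* a) refl a) (trans (cong (_* a) 2≡0) (K.zeroˡ a))

    two-roots : ∀ {a b} → a * a + a + 1# ≡ 0# → b * b + b + 1# ≡ 0# → a ≡ b ⊎ a + b ≡ 1#
    two-roots {a} {b} ea eb with integral {a + - b} {a + b + 1#} (begin
        (a + - b) * (a + b + 1#)
          ≡⟨ K.solve 2 (λ a b → (a K.:- b) K.:* (a K.:+ b K.:+ K.num 1) K.:= (a K.:* a K.:+ a K.:+ K.num 1) K.:-
              (b K.:* b K.:+ b K.:+ K.num 1)) refl a b ⟩
        (a * a + a + 1#) + - (b * b + b + 1#)       ≡⟨ cong₂ (λ x y → x + - y) ea eb ⟩
        0# + - 0#                                   ≡⟨ K.-‿inverseʳ 0# ⟩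
        0#                                          ∎)
      where open ≡-Reasoning
    ... | inj₁ e = inj₁ (trans (K.solve 2 (λ a b → a K.:= (a K.:- b) K.:+ b) refl a b)
        (trans (cong (_+ b) e) (K.+-identityˡ b)))
    ... | inj₂ e = inj₂ (begin
        a + b
          ≡⟨ K.solve 2 (λ a b → a K.:+ b K.:= (a K.:+ b K.:+ K.num 1) K.:+ K.num 1 K.:- K.num 2) refl a b ⟩
        (a + b + 1#) + 1# + - 2#    ≡⟨ cong₂ (λ x y → x + 1# + - y) e 2≡0 ⟩
        0# + 1# + - 0#              ≡⟨ K.solve 0 (K.num 0 K.:+ K.num 1 K.:- K.num 0 K.:= K.num 1) refl ⟩
        1#                          ∎)
      where open ≡-Reasoning

  cube-minus : ∀ x → (x ⊖ 𝟙) ⊗ x ⊗ (x ⊕ 𝟙) ≈ x ⊗ (x ⊗ (x ⊗ 𝟙)) ⊖ x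
  cube-minus = solve 1 (λ x → (x :- num 1) :* x :* (x :+ num 1) := x :* (x :* (x :* num 1)) :- x) ≈-refl

  module _ (card≡3 : card ≡ 3) where
    open Card3 card≡3

    T³-T : T ^ 3 ⊕ 2# • T ≈ T ^ 3 ⊖ T
    T³-T = begin
      T ^ 3 ⊕ 2# • T                    ≈⟨ ⊕-congˡ (≈-trans (≈-sym (‵-⊗ 2# T)) (⊗-congʳ (≈-sym (‵-+ 1# 1#)))) ⟩
      T ^ 3 ⊕ (𝟙 ⊕ 𝟙) ⊗ T
        ≈⟨ solve 2 (λ y t → y :+ num 2 :* t := y :- t :+ num 3 :* t) ≈-refl (T ^ 3) T ⟩
      T ^ 3 ⊖ T ⊕ (𝟙 ⊕ 𝟙 ⊕ 𝟙) ⊗ T      ≈⟨ ⊕-congˡ (⊗-congʳ (≈-trans (≈-sym ‵3≈) (char 3≡0))) ⟩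
      T ^ 3 ⊖ T ⊕ [] ⊗ T                ≈⟨ ≈-trans (⊕-congˡ (A.zeroˡ T)) (A.+-identityʳ _) ⟩
      T ^ 3 ⊖ T                         ∎
      where open ≈-Reasoning

    -- Cubing is additive and fixes constants when q = 3, so x^3 - x does not change under
    -- translation; every x leads to the single polynomial of the last exceptional case.
    cube-shift : ∀ c → (T ⊕ ‵ c) ^ 3 ⊖ (T ⊕ ‵ c) ≈ T ^ 3 ⊖ T
    cube-shift c = ≈-trans (⊕-congʳ (≈-trans
        (subst (λ n → (T ⊕ ‵ c) ^ n ≈ T ^ n ⊕ ‵ c ^ n) card≡3 (frobenius-⊕ 2<card T (‵ c)))
        (⊕-congˡ (subst (λ n → ‵ c ^ n ≈ ‵ c) card≡3 (‵-^card c)))))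
      (solve 3 (λ y t c → (y :+ c) :- (t :+ c) := y :- t) ≈-refl (T ^ 3) T (‵ c))

  -- Copies of the predicates of the statement over the opaque operations, so that the lemmas about
  -- these apply; `Exceptional-def` identifies the two.
  EC-I EC-II EC-III EC-IV EC-V EC-VI EC-VII EC-VIII EC-IX Exceptional : Pol → Pol → Set
  EC-I m u   = card ≡ 3 × u D.≈ 𝟙 × ∃ λ ℘ → D.DegOneMonicPrime ℘ × m D.≈ (℘ ⊖ 𝟙) ⊗ ℘
  EC-II m u  = card ≡ 4 × u D.≈ 𝟙 × ∃ λ ℘ → D.DegOneMonicPrime ℘ × m D.≈ (℘ ⊖ 𝟙) ⊗ ℘
  EC-III m u = card ≡ 3 × u D.≈ 𝟙 × (m D.≈ (T ⊖ 𝟙) ⊗ T ^ 2 ⊎ m D.≈ T ⊗ (T ⊕ ‵ 1#) ^ 2 ⊎ m D.≈ (T ⊕ ‵ 1#) ⊗ (T ⊕ ‵ 2#)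
      ^ 2)
  EC-IV m u  = card ≡ 3 × u D.≈ m × (m D.≈ T ⊎ m D.≈ T ⊕ ‵ 1# ⊎ m D.≈ T ⊕ ‵ 2#)
  EC-V m u   = card ≡ 5 × u D.≈ 𝟙 × (m D.≈ T ⊗ (T ⊕ ‵ 1#) ⊎ m D.≈ (T ⊕ ‵ 1#) ⊗ (T ⊕ ‵ 2#)
                 ⊎ m D.≈ (T ⊕ ‵ 2#) ⊗ (T ⊕ ‵ 3#) ⊎ m D.≈ (T ⊕ ‵ 3#) ⊗ (T ⊕ ‵ 4#) ⊎ m D.≈ (T ⊕ ‵ 4#) ⊗ T)
  EC-VI m u  = u D.≈ 𝟙 × D.DegOneMonicPrime m
  EC-VII m u = card ≡ 3 × u D.≈ 𝟙 × (m D.≈ T ^ 2 ⊎ m D.≈ (T ⊕ ‵ 1#) ^ 2 ⊎ m D.≈ (T ⊕ ‵ 2#) ^ 2)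
  EC-VIII m u = card ≡ 4 × u D.≈ 𝟙 × ∃ λ w → (w * w + w + 1# ≡ 0#)
                 × (m D.≈ T ⊗ (T ⊕ ‵ w) ⊎ m D.≈ T ⊗ (T ⊕ ‵ (w * w))
                    ⊎ m D.≈ (T ⊕ ‵ 1#) ⊗ (T ⊕ ‵ w) ⊎ m D.≈ (T ⊕ ‵ 1#) ⊗ (T ⊕ ‵ (w * w)))
  EC-IX m u  = card ≡ 3 × u D.≈ 𝟙 × m D.≈ T ^ 3 ⊕ 2# • T
  Exceptional m u = EC-I m u ⊎ EC-II m u ⊎ EC-III m u ⊎ EC-IV m u ⊎ EC-V m u
                    ⊎ EC-VI m u ⊎ EC-VII m u ⊎ EC-VIII m u ⊎ EC-IX m u

  opaque
    unfolding _⊕_ _⊗_ ⊝_ _•_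

    Exceptional-def : ∀ m u → D.Exceptional m u ≡ Exceptional m u
    Exceptional-def m u = refl

  from-I : ∀ {m u} → EC-I m u → Exception m u
  from-I (c , u≈ , ℘ , (mp , d) , e) =
    exc-I c (coeffwise u≈) (subst (λ k → Mon k ℘) d (Monic⇒Mon (proj₁ mp))) (coeffwise e)

  from-II : ∀ {m u} → EC-II m u → Exception m u
  from-II (c , u≈ , ℘ , (mp , d) , e) =
    exc-II c (coeffwise u≈) (subst (λ k → Mon k ℘) d (Monic⇒Mon (proj₁ mp))) (coeffwise e)

  from-III : ∀ {m u} → EC-III m u → Exception m u
  from-III (c , u≈ , inj₁ e) = exc-III c (coeffwise u≈) mon-T (≈-trans (coeffwise e) (⊗-congˡ (square T)))
  from-III (c , u≈ , inj₂ (inj₁ e)) = exc-III c (coeffwise u≈) (mon-T⊕ 1#)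
    (≈-trans (coeffwise e) (⊗-cong (≈-sym (⊖𝟙-≈ ≈-refl)) (square (T ⊕ ‵ 1#))))
  from-III (c , u≈ , inj₂ (inj₂ e)) = exc-III c (coeffwise u≈) (mon-T⊕ 2#)
    (≈-trans (coeffwise e) (⊗-cong (≈-sym (⊖𝟙-≈ (≈-sym (‵-suc 1#)))) (square (T ⊕ ‵ 2#))))

  from-IV : ∀ {m u} → EC-IV m u → Exception m u
  from-IV {m} (c , u≈ , inj₁ e)        = exc-IV c (mon-resp (≈-sym (coeffwise {p = m} {r = T} e)) mon-T)
      (coeffwise u≈)
  from-IV {m} (c , u≈ , inj₂ (inj₁ e)) = exc-IV c (mon-resp (≈-sym (coeffwise {p = m} {r = T ⊕ ‵ 1#} e)) (mon-T⊕ 1#))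
      (coeffwise u≈)
  from-IV {m} (c , u≈ , inj₂ (inj₂ e)) = exc-IV c (mon-resp (≈-sym (coeffwise {p = m} {r = T ⊕ ‵ 2#} e)) (mon-T⊕ 2#))
      (coeffwise u≈)

  private
    consecutive : ∀ {m u y} x → card ≡ 5 → u ≈ 𝟙 → Mon 1 x → m ≈ x ⊗ y → x ⊕ 𝟙 ≈ y → Exception m u
    consecutive x c u≈ mx e f = exc-V c u≈ mx (≈-trans e (⊗-congˡ (≈-sym f)))

  from-V : ∀ {m u} → EC-V m u → Exception m u
  from-V (c , u≈ , inj₁ e) = consecutive T c (coeffwise u≈) mon-T (coeffwise {r = T ⊗ (T ⊕ ‵ 1#)} e) ≈-refl
  from-V (c , u≈ , inj₂ (inj₁ e)) =
    consecutive (T ⊕ ‵ 1#) c (coeffwise u≈) (mon-T⊕ 1#) (coeffwise {r = (T ⊕ ‵ 1#) ⊗ (T ⊕ ‵ 2#)} e) (‵-suc 1#)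
  from-V (c , u≈ , inj₂ (inj₂ (inj₁ e))) =
    consecutive (T ⊕ ‵ 2#) c (coeffwise u≈) (mon-T⊕ 2#) (coeffwise {r = (T ⊕ ‵ 2#) ⊗ (T ⊕ ‵ 3#)} e) (‵-suc 2#)
  from-V (c , u≈ , inj₂ (inj₂ (inj₂ (inj₁ e)))) =
    consecutive (T ⊕ ‵ 3#) c (coeffwise u≈) (mon-T⊕ 3#) (coeffwise {r = (T ⊕ ‵ 3#) ⊗ (T ⊕ ‵ 4#)} e) (‵-suc 3#)
  from-V (c , u≈ , inj₂ (inj₂ (inj₂ (inj₂ e)))) =
    consecutive (T ⊕ ‵ 4#) c (coeffwise u≈) (mon-T⊕ 4#) (coeffwise {r = (T ⊕ ‵ 4#) ⊗ T} e)
      (≈-trans (‵-suc 4#) (≈-trans (⊕-congˡ (‵-cong (Card5.5≡0 c))) (≈-sym T⊕‵0)))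

  from-VI : ∀ {m u} → EC-VI m u → Exception m u
  from-VI {m} (u≈ , mp , d) = exc-VI (coeffwise u≈) (subst (λ k → Mon k m) d (Monic⇒Mon (proj₁ mp)))

  from-VII : ∀ {m u} → EC-VII m u → Exception m u
  from-VII (c , u≈ , inj₁ e)        = exc-VII c (coeffwise u≈) mon-T (≈-trans (coeffwise e) (square T))
  from-VII (c , u≈ , inj₂ (inj₁ e)) = exc-VII c (coeffwise u≈) (mon-T⊕ 1#) (≈-trans (coeffwise e) (square (T ⊕ ‵ 1#)))
  from-VII (c , u≈ , inj₂ (inj₂ e)) = exc-VII c (coeffwise u≈) (mon-T⊕ 2#) (≈-trans (coeffwise e) (square (T ⊕ ‵ 2#)))

  from-VIII : ∀ {m u} → EC-VIII m u → Exception m u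
  from-VIII (c , u≈ , w , r , inj₁ e) = exc-VIII c (coeffwise u≈) mon-T r (coeffwise {r = T ⊗ (T ⊕ ‵ w)} e)
  from-VIII (c , u≈ , w , r , inj₂ (inj₁ e)) =
    exc-VIII c (coeffwise u≈) mon-T (square-root c r) (coeffwise {r = T ⊗ (T ⊕ ‵ (w * w))} e)
  from-VIII (c , u≈ , w , r , inj₂ (inj₂ (inj₁ e))) =
    exc-VIII c (coeffwise u≈) (mon-T⊕ 1#) (square-root c r)
      (≈-trans (coeffwise {r = (T ⊕ ‵ 1#) ⊗ (T ⊕ ‵ w)} e) (⊗-congˡ (≈-sym (≈-trans (A.+-assoc T (‵ 1#) (‵ (w * w)))
        (⊕-congˡ (≈-trans (‵-+ 1# (w * w)) (‵-cong eq)))))))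
    where
    eq : 1# + w * w ≡ w
    eq = trans (cong (1# +_) (sym (root-square c r)))
      (trans (K.solve 1 (λ w → K.num 1 K.:+ (w K.:+ K.num 1) K.:= w K.:+ K.num 2) refl w)
      (trans (cong (w +_) (Card4.2≡0 c)) (K.+-identityʳ w)))
  from-VIII (c , u≈ , w , r , inj₂ (inj₂ (inj₂ e))) =
    exc-VIII c (coeffwise u≈) (mon-T⊕ 1#) r
      (≈-trans (coeffwise {r = (T ⊕ ‵ 1#) ⊗ (T ⊕ ‵ (w * w))} e) (⊗-congˡ (≈-sym (≈-trans (A.+-assoc T (‵ 1#) (‵ w))
        (⊕-congˡ (≈-trans (‵-+ 1# w) (‵-cong (trans (K.+-comm 1# w) (root-square c r)))))))))

  from-IX : ∀ {m u} → EC-IX m u → Exception m u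
  from-IX (c , u≈ , e) =
    exc-IX c (coeffwise u≈) mon-T (≈-trans (coeffwise {r = T ^ 3 ⊕ 2# • T} e)
        (≈-trans (T³-T c) (≈-sym (cube-minus T))))

  to-III : ∀ {m u x} → card ≡ 3 → u ≈ 𝟙 → Mon 1 x → m ≈ (x ⊖ 𝟙) ⊗ (x ⊗ x) → EC-III m u
  to-III {m} {u} {x} c u≈ mx e with Card3.elements c (coeff x 0)
  ... | inj₁ x0 = c , at u≈ , inj₁ (at (≈-trans e (⊗-cong
          (⊖-cong (≈-trans (linear-≈ mx 0# x0) (≈-sym T⊕‵0)) ≈-refl)
          (≈-trans (⊗-cong (≈-trans (linear-≈ mx 0# x0) (≈-sym T⊕‵0)) (≈-trans (linear-≈ mx 0# x0) (≈-sym T⊕‵0)))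
              (≈-sym (square T))))))
  ... | inj₂ (inj₁ x1) = c , at u≈ , inj₂ (inj₁ (at (≈-trans e (⊗-cong (⊖𝟙-≈ (linear-≈ mx 1# x1))
          (≈-trans (⊗-cong (linear-≈ mx 1# x1) (linear-≈ mx 1# x1)) (≈-sym (square (T ⊕ ‵ 1#))))))))
  ... | inj₂ (inj₂ x2) = c , at u≈ , inj₂
      (inj₂ (at (≈-trans e (⊗-cong (⊖𝟙-≈ (≈-trans (linear-≈ mx 2# x2) (≈-sym (‵-suc 1#))))
          (≈-trans (⊗-cong (linear-≈ mx 2# x2) (linear-≈ mx 2# x2)) (≈-sym (square (T ⊕ ‵ 2#))))))))

  to-IV : ∀ {m u} → card ≡ 3 → Mon 1 m → u ≈ m → EC-IV m u
  to-IV {m} c mm u≈ with Card3.elements c (coeff m 0)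
  ... | inj₁ x0        = c , at u≈ , inj₁ (at (≈-trans (linear-≈ mm 0# x0) (≈-sym T⊕‵0)))
  ... | inj₂ (inj₁ x1) = c , at u≈ , inj₂ (inj₁ (at (linear-≈ mm 1# x1)))
  ... | inj₂ (inj₂ x2) = c , at u≈ , inj₂ (inj₂ (at (linear-≈ mm 2# x2)))

  private
    shifted : ∀ {m x} w → Mon 1 x → m ≈ x ⊗ (x ⊕ ‵ w) → ∀ b → coeff x 0 ≡ b → m ≈ (T ⊕ ‵ b) ⊗ (T ⊕ ‵ (b + w))
    shifted w mx e b xb = ≈-trans e (⊗-cong (linear-≈ mx b xb)
      (≈-trans (⊕-congʳ (linear-≈ mx b xb)) (≈-trans (A.+-assoc T (‵ b) (‵ w)) (⊕-congˡ (‵-+ b w)))))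

    squared : ∀ {m x} → Mon 1 x → m ≈ x ⊗ x → ∀ b → coeff x 0 ≡ b → m ≈ (T ⊕ ‵ b) ^ 2
    squared mx e b xb = ≈-trans e (≈-trans (⊗-cong (linear-≈ mx b xb) (linear-≈ mx b xb)) (≈-sym (square (T ⊕ ‵ b))))

  to-V : ∀ {m u x} → card ≡ 5 → u ≈ 𝟙 → Mon 1 x → m ≈ x ⊗ (x ⊕ 𝟙) → EC-V m u
  to-V {m} {u} {x} c u≈ mx e with Card5.elements c (coeff x 0)
  ... | inj₁ x0 = c , at u≈ , inj₁ (at (≈-trans (shifted 1# mx e 0# x0) (⊗-cong (≈-sym T⊕‵0) (≈-sym T⊕𝟙))))
  ... | inj₂ (inj₁ x1) = c , at u≈ , inj₂ (inj₁ (at (shifted 1# mx e 1# x1)))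
  ... | inj₂ (inj₂ (inj₁ x2)) = c , at u≈ , inj₂ (inj₂ (inj₁ (at (shifted 1# mx e 2# x2))))
  ... | inj₂ (inj₂ (inj₂ (inj₁ x3))) = c , at u≈ , inj₂ (inj₂ (inj₂ (inj₁ (at (shifted 1# mx e 3# x3)))))
  ... | inj₂ (inj₂ (inj₂ (inj₂ x4))) = c , at u≈ , inj₂ (inj₂ (inj₂ (inj₂ (at (≈-trans (shifted 1# mx e 4# x4)
      (⊗-cong (≈-refl {T ⊕ ‵ 4#}) (≈-trans (⊕-congˡ (‵-cong (Card5.5≡0 c))) (≈-sym T⊕‵0))))))))

  to-VII : ∀ {m u x} → card ≡ 3 → u ≈ 𝟙 → Mon 1 x → m ≈ x ⊗ x → EC-VII m u
  to-VII {m} {u} {x} c u≈ mx e with Card3.elements c (coeff x 0)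
  ... | inj₁ x0        = c , at u≈ , inj₁ (at (≈-trans (squared mx e 0# x0) (^-cong 2 (≈-sym T⊕‵0))))
  ... | inj₂ (inj₁ x1) = c , at u≈ , inj₂ (inj₁ (at (squared mx e 1# x1)))
  ... | inj₂ (inj₂ x2) = c , at u≈ , inj₂ (inj₂ (at (squared mx e 2# x2)))

  -- The constant term b of x is 0, 1 or a root of w^2 + w + 1. In the last case b = w turns the
  -- factor x + w into T + 2w = T, and b + w = 1 turns it into T + 1. The listed forms with w^2
  -- arise from w^2 = w + 1.
  to-VIII : ∀ {m u x w} → card ≡ 4 → u ≈ 𝟙 → Mon 1 x → w * w + w + 1# ≡ 0# → m ≈ x ⊗ (x ⊕ ‵ w) → EC-VIII m u
  to-VIII {m} {u} {x} {w} c u≈ mx r e with Card4.cube-root c (coeff x 0)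
  ... | inj₁ x0 = c , at u≈ , w , r , inj₁ (at (≈-trans (shifted w mx e 0# x0)
          (⊗-cong (≈-sym T⊕‵0) (⊕-congˡ {T} (‵-cong (K.+-identityˡ w))))))
  ... | inj₂ (inj₁ x1) = c , at u≈ , w , r , inj₂ (inj₂ (inj₂ (at (≈-trans (shifted w mx e 1# x1)
          (⊗-cong (≈-refl {T ⊕ ‵ 1#}) (⊕-congˡ {T} (‵-cong (trans (K.+-comm 1# w) (root-square c r)))))))))
  ... | inj₂ (inj₂ xr) with two-roots c xr r
  ...   | inj₁ x≡w = c , at u≈ , w , r , inj₁
      (at (≈-trans (shifted w mx e w x≡w) (≈-trans (A.*-comm (T ⊕ ‵ w) (T ⊕ ‵ (w + w)))
            (⊗-cong {r = T ⊕ ‵ w} (≈-trans (⊕-congˡ {T} (‵-cong (double c w))) (≈-sym T⊕‵0)) ≈-refl))))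
  ...   | inj₂ x+w = c , at u≈ , coeff x 0 , xr , inj₂ (inj₂ (inj₁ (at (≈-trans (shifted w mx e (coeff x 0) refl)
            (≈-trans (A.*-comm (T ⊕ ‵ (coeff x 0)) (T ⊕ ‵ (coeff x 0 + w)))
            (⊗-cong {r = T ⊕ ‵ (coeff x 0)} (⊕-congˡ {T} (‵-cong x+w)) ≈-refl))))))

  to-IX : ∀ {m u x} → card ≡ 3 → u ≈ 𝟙 → Mon 1 x → m ≈ (x ⊖ 𝟙) ⊗ x ⊗ (x ⊕ 𝟙) → EC-IX m u
  to-IX {m} {u} {x} c u≈ mx e = c , at u≈ , at {m} {T ^ 3 ⊕ 2# • T} (≈-trans e (≈-trans (cube-minus x)
    (≈-trans (⊖-cong (^-cong 3 (linear-≈ mx _ refl)) (linear-≈ mx _ refl))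
        (≈-trans (cube-shift c (coeff x 0)) (≈-sym (T³-T c))))))

  to-Exceptional : ∀ {m u} → Exception m u → Exceptional m u
  to-Exceptional (exc-I c u≈ mx e)      = inj₁ (c , at u≈ , _ , (from-Prime (linear-prime mx) , Mon⇒deg mx) , at e)
  to-Exceptional (exc-II c u≈ mx e)     = inj₂
      (inj₁ (c , at u≈ , _ , (from-Prime (linear-prime mx) , Mon⇒deg mx) , at e))
  to-Exceptional (exc-III c u≈ mx e)    = inj₂ (inj₂ (inj₁ (to-III c u≈ mx e)))
  to-Exceptional (exc-IV c mm u≈)       = inj₂ (inj₂ (inj₂ (inj₁ (to-IV c mm u≈))))
  to-Exceptional (exc-V c u≈ mx e)      = inj₂ (inj₂ (inj₂ (inj₂ (inj₁ (to-V c u≈ mx e)))))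
  to-Exceptional (exc-VI u≈ mm)         = inj₂
      (inj₂ (inj₂ (inj₂ (inj₂ (inj₁ (at u≈ , from-Prime (linear-prime mm) , Mon⇒deg mm))))))
  to-Exceptional (exc-VII c u≈ mx e)    = inj₂ (inj₂ (inj₂ (inj₂ (inj₂ (inj₂ (inj₁ (to-VII c u≈ mx e)))))))
  to-Exceptional (exc-VIII c u≈ mx r e) = inj₂ (inj₂ (inj₂ (inj₂ (inj₂ (inj₂ (inj₂ (inj₁ (to-VIII c u≈ mx r e))))))))
  to-Exceptional (exc-IX c u≈ mx e)     = inj₂ (inj₂ (inj₂ (inj₂ (inj₂ (inj₂ (inj₂ (inj₂ (to-IX c u≈ mx e))))))))

  from-Exceptional : ∀ {m u} → Exceptional m u → Exception m u
  from-Exceptional = [ from-I , [ from-II , [ from-III , [ from-IV , [ from-V , [ from-VI , [ from-VII , [ from-VIII ,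
      from-IX ]′ ]′ ]′ ]′ ]′ ]′ ]′ ]′

-- The exceptional cases have no large Zsigmondy prime.

module Obstructions (𝔽 : FiniteField) (2<card : 2 < FiniteField.card 𝔽) where
  open ExceptionalCases 𝔽 2<card public
  open FiniteField 𝔽 using (_+_; _*_; card)
  open A using (solve; _:=_; _:+_; _:*_; _:-_; :-_; num)

  C-‵ : ∀ c v → C (‵ c) v ≈ ‵ c ⊗ v
  C-‵ c v = A.+-identityʳ _

  C-T : ∀ v → C T v ≈ CT v
  C-T v = ≈-trans (⊕-cong (≈-trans (⊗-congʳ (‵0≈[] refl)) (A.zeroˡ v)) (C-𝟙 (CT v))) (A.+-identityˡ _)

  C-degree-one : ∀ {x} → Mon 1 x → ∀ v → C x v ≈ x ⊗ v ⊕ v ^ card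
  C-degree-one {x} mx v = begin
    C x v                               ≈⟨ C-congˡ {x} {T ⊕ ‵ (coeff x 0)} v x≈ ⟩
    C (T ⊕ ‵ (coeff x 0)) v             ≈⟨ C-⊕ˡ T (‵ (coeff x 0)) v ⟩
    C T v ⊕ C (‵ (coeff x 0)) v         ≈⟨ ⊕-cong (C-T v) (C-‵ (coeff x 0) v) ⟩
    T ⊗ v ⊕ v ^ card ⊕ ‵ (coeff x 0) ⊗ v
      ≈⟨ solve 4 (λ t v c y → t :* v :+ y :+ c :* v := (t :+ c) :* v :+ y) ≈-refl T v (‵ (coeff x 0)) (v ^ card) ⟩
    (T ⊕ ‵ (coeff x 0)) ⊗ v ⊕ v ^ card  ≈⟨ ⊕-congʳ (⊗-congʳ x≈) ⟨
    x ⊗ v ⊕ v ^ card                    ∎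
    where
    open ≈-Reasoning
    x≈ = linear-≈ mx (coeff x 0) refl

  C-degree-one-𝟙 : ∀ {x} → Mon 1 x → C x 𝟙 ≈ x ⊕ 𝟙
  C-degree-one-𝟙 {x} mx = ≈-trans (C-degree-one mx 𝟙) (⊕-cong (A.*-identityʳ x) (𝟙-^ card))

  mon-⊕𝟙 : ∀ {n p} → 0 < n → Mon n p → Mon n (p ⊕ 𝟙)
  mon-⊕𝟙 {p = p} 0<n mp = mon-⊕ p 𝟙 mp (below-mono 𝟙 0<n (below-length 𝟙))

  mon-⊖𝟙 : ∀ {n p} → 0 < n → Mon n p → Mon n (p ⊖ 𝟙)
  mon-⊖𝟙 {p = p} 0<n mp = mon-⊕ p (⊝ 𝟙) mp (below-⊝ 𝟙 (below-mono 𝟙 0<n (below-length 𝟙)))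

  C-predecessor : ∀ {x} → Mon 1 x → C (x ⊖ 𝟙) 𝟙 ≈ x
  C-predecessor {x} mx = ≈-trans (C-degree-one-𝟙 (mon-⊖𝟙 (s≤s z≤n) mx)) (⊖⊕-cancel x 𝟙)

  C-product : ∀ {m a b v w} → m ≈ a ⊗ b → C b v ≈ w → C m v ≈ C a w
  C-product {m} {a} {b} {v} e f = ≈-trans (C-congˡ {m} {a ⊗ b} v e) (≈-trans (C-⊗ a b v) (C-congʳ a f))

  largeZ-resp : ∀ {n m u u′} → u ≈ u′ → LargeZ n m u → LargeZ n m u′
  largeZ-resp {m = m} e (largeZ P ℘∣ ℘∤ l) = largeZ P (∣-respʳ (C-congʳ m e) ℘∣)
    (λ {_} {x} dx lt d → ℘∤ dx lt (∣-respʳ (≈-sym (C-congʳ x e)) d))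
    ([ inj₁ , (λ d → inj₂ (∣-respʳ (C-congʳ m e) d)) ]′ l)

  module _ {n m u} (mm : Mon n m) (0<n : 0 < n) (Z : LargeZ n m u) where
    open LargeZ Z
    open Prime prime

    -- Both m and ℘ - 1 annihilate u modulo ℘, hence so does their gcd. By primitivity its degree is
    -- at least n, and it divides ℘ - 1.
    degree-≥ : n ≤ d
    degree-≥ with gcd-of m (℘ ⊖ 𝟙)
    ... | mkGCD g g∣m g∣℘-1 s t bz with ≉[]⇒deg {g} (∣-≉[] g∣m (deg⇒≉[] (Mon⇒Deg mm)))
    ...   | j , dg with j ℕP.<? n
    ...     | no j≮n  = ℕP.≤-trans (ℕP.≮⇒≥ j≮n) (∣⇒deg≤ g∣℘-1 dg (Mon⇒Deg (mon-⊖𝟙 positive monic)))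
    ...     | yes j<n = contradiction (∣-respʳ eq
        (∣-⊕ (∣-trans ∣C-m (∣C s _)) (∣-trans (C-prime-⊖-𝟙 prime u) (∣C t _)))) (∤C-n dg j<n)
      where
      eq : C s (C m u) ⊕ C t (C (℘ ⊖ 𝟙) u) ≈ C g u
      eq = ≈-trans (⊕-cong (≈-sym (C-⊗ s m u)) (≈-sym (C-⊗ t (℘ ⊖ 𝟙) u)))
        (≈-trans (≈-sym (C-⊕ˡ (s ⊗ m) (t ⊗ (℘ ⊖ 𝟙)) u)) (C-congˡ {s ⊗ m ⊕ t ⊗ (℘ ⊖ 𝟙)} {g} u bz))

    ∤-⊗ : ∀ {a b} → ¬ ℘ ∣ a → ¬ ℘ ∣ b → ¬ ℘ ∣ a ⊗ b
    ∤-⊗ {a} {b} ∤a ∤b dv = [ ∤a , ∤b ]′ (euclid a b dv)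

    -- A prime not dividing k divides R, so deg ℘ ≤ deg R. If this is at most n, largeness requires
    -- ℘^2 | C_m(u), hence ℘^2 | R, although 2 deg ℘ > n.
    not-large : ∀ {r k R} → C m u ≈ k ⊗ R → ¬ ℘ ∣ k → Deg r R → ¬ r ≤ n
    not-large {r} {k} {R} e ℘∤k dR r≤n with euclid k R (∣-respʳ e ∣C-m)
    ... | inj₁ ℘∣k = ℘∤k ℘∣k
    ... | inj₂ ℘∣R@(divides R′ eR) with large
    ...   | inj₁ n<d = ℕP.<⇒≱ n<d (ℕP.≤-trans (∣⇒deg≤ ℘∣R (Mon⇒Deg monic) dR) r≤n)
    ...   | inj₂ ℘²∣ with euclid k R′ (∣-cancelʳ ≉[]
        (∣-respʳ (≈-trans e (≈-trans (⊗-congˡ (≈-sym eR)) (≈-sym (A.*-assoc k R′ ℘)))) ℘²∣))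
    ...     | inj₁ ℘∣k = ℘∤k ℘∣k
    ...     | inj₂ ℘∣R′ = ℕP.<⇒≱ (ℕP.m<m+n d positive) (ℕP.≤-trans
              (∣⇒deg≤ (∣-respʳ eR (⊗-mono-∣ ℘∣R′ (∣-refl {℘}))) (deg-⊗ (Mon⇒Deg monic) (Mon⇒Deg monic)) dR)
              (ℕP.≤-trans r≤n degree-≥))

  module _ {n m} (mm : Mon n m) (1<n : 1 < n) (Z : LargeZ n m 𝟙) where
    open LargeZ Z

    -- Every monic linear x is a value at smaller degree, x = C_(x-1)(1).
    ∤-degree-one : ∀ {x} → Mon 1 x → ¬ ℘ ∣ x
    ∤-degree-one {x} mx dv = ∤C-n (Mon⇒Deg (mon-⊖𝟙 (s≤s z≤n) mx)) 1<n
      (∣-respʳ (≈-sym (C-predecessor mx)) dv)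

  -- The ring solver does not know the characteristic. Identities valid only modulo 3 (below: modulo
  -- 2) are proved over the integers with an explicit correction 3 t, and `t` is the cofactor passed
  -- in.
  three : card ≡ 3 → ∀ {p r} t → p ≈ r ⊕ (𝟙 ⊕ 𝟙 ⊕ 𝟙) ⊗ t → p ≈ r
  three c {r = r} t e = ≈-trans e (≈-trans
      (⊕-congˡ (≈-trans (⊗-congʳ (≈-trans (≈-sym ‵3≈) (char (Card3.3≡0 c)))) (A.zeroˡ t))) (A.+-identityʳ r))

  two : card ≡ 4 → ∀ {p r} t → p ≈ r ⊕ (𝟙 ⊕ 𝟙) ⊗ t → p ≈ r
  two c {r = r} t e = ≈-trans e (≈-trans
      (⊕-congˡ (≈-trans (⊗-congʳ (≈-trans (‵-+ 1# 1#) (char (Card4.2≡0 c)))) (A.zeroˡ t))) (A.+-identityʳ r))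

  C-x : ∀ {N x} → card ≡ N → Mon 1 x → ∀ v → C x v ≈ x ⊗ v ⊕ v ^ N
  C-x {N} c mx v = ≈-trans (C-degree-one mx v) (⊕-congˡ (A.reflexive (cong (v ^_) c)))

  C-consecutive : ∀ {N x} → card ≡ N → Mon 1 x → C (x ⊗ (x ⊖ 𝟙)) 𝟙 ≈ x ⊗ x ⊕ x ^ N
  C-consecutive {N} {x} c mx = ≈-trans (C-product {x ⊗ (x ⊖ 𝟙)} {x} {x ⊖ 𝟙} ≈-refl (C-predecessor mx)) (C-x c mx x)

  C-square : ∀ {x} → card ≡ 3 → Mon 1 x → C (x ⊗ x) 𝟙 ≈ (x ⊕ 𝟙) ⊗ (x ⊗ x ⊕ 𝟙)
  C-square {x} c mx = three c ((x ⊕ 𝟙) ⊗ x) (≈-trans (C-product {x ⊗ x} {x} {x} ≈-refl (C-degree-one-𝟙 mx))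
    (≈-trans (C-x c mx (x ⊕ 𝟙))
      (solve 1 (λ x → let z = x :+ num 1 in x :* z :+ z :* (z :* (z :* num 1))
         := z :* (x :* x :+ num 1) :+ num 3 :* (z :* x)) ≈-refl x)))

  private
    1≤ : 0 < 1
    1≤ = s≤s z≤n

    1<2 : 1 < 2
    1<2 = s≤s (s≤s z≤n)

    1<3 : 1 < 3
    1<3 = s≤s (s≤s z≤n)

  -- In each case C_m(u) = k R, where every prime factor of k already divides some C_x(u) with deg x
  -- < n, and R is 1 or m + 1, of degree at most n. The index m is split into linear factors,
  -- applied one after another.
  no-large-zsigmondy : ∀ {m u n} → Exception m u → Mon n m → ¬ LargeZ n m u
  no-large-zsigmondy {m} {u} (exc-I {x} c u≈ mx e) mm Z₀ with deg-unique (Mon⇒Deg mm)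
      (deg-resp (≈-sym e) (Mon⇒Deg (mon-⊗ (mon-⊖𝟙 1≤ mx) mx)))
  ... | refl = not-large mm (s≤s z≤n) Z {k = x ⊗ x ⊗ (x ⊕ 𝟙)} {R = 𝟙} eq
    (∤-⊗ mm (s≤s z≤n) Z (∤-⊗ mm (s≤s z≤n) Z ∤x ∤x) (∤-degree-one mm 1<2 Z (mon-⊕𝟙 1≤ mx))) (Mon⇒Deg mon-𝟙) z≤n
    where
    Z = largeZ-resp u≈ Z₀
    ∤x = ∤-degree-one mm 1<2 Z mx
    eq : C m 𝟙 ≈ x ⊗ x ⊗ (x ⊕ 𝟙) ⊗ 𝟙
    eq = ≈-trans (C-congˡ {m} {x ⊗ (x ⊖ 𝟙)} 𝟙 (≈-trans e (A.*-comm _ x))) (≈-trans (C-consecutive c mx)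
      (solve 1 (λ x → x :* x :+ x :* (x :* (x :* num 1)) := x :* x :* (x :+ num 1) :* num 1) ≈-refl x))
  no-large-zsigmondy {m} {u} (exc-II {x} c u≈ mx e) mm Z₀ with deg-unique (Mon⇒Deg mm)
      (deg-resp (≈-sym e) (Mon⇒Deg (mon-⊗ (mon-⊖𝟙 1≤ mx) mx)))
  ... | refl = not-large mm (s≤s z≤n) Z {k = x ⊗ x ⊗ ((x ⊕ 𝟙) ⊗ (x ⊕ 𝟙))} {R = 𝟙} eq
    (∤-⊗ mm (s≤s z≤n) Z (∤-⊗ mm (s≤s z≤n) Z ∤x ∤x) (∤-⊗ mm (s≤s z≤n) Z ∤x+1 ∤x+1)) (Mon⇒Deg mon-𝟙) z≤n
    where
    Z = largeZ-resp u≈ Z₀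
    ∤x = ∤-degree-one mm 1<2 Z mx
    ∤x+1 = ∤-degree-one mm 1<2 Z (mon-⊕𝟙 1≤ mx)
    eq : C m 𝟙 ≈ x ⊗ x ⊗ ((x ⊕ 𝟙) ⊗ (x ⊕ 𝟙)) ⊗ 𝟙
    eq = two c (⊝ (x ⊗ x ⊗ x)) (≈-trans (C-congˡ {m} {x ⊗ (x ⊖ 𝟙)} 𝟙 (≈-trans e (A.*-comm _ x)))
        (≈-trans (C-consecutive c mx)
      (solve 1 (λ x → x :* x :+ x :* (x :* (x :* (x :* num 1))) := x :* x :* ((x :+ num 1) :* (x :+ num 1)) :* num
          1 :+ num 2 :* (:- (x :* x :* x))) ≈-refl x)))
  no-large-zsigmondy {m} {u} (exc-III {x} c u≈ mx e) mm Z₀ with deg-unique (Mon⇒Deg mm)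
      (deg-resp (≈-sym e) (Mon⇒Deg (mon-⊗ (mon-⊖𝟙 1≤ mx) (mon-⊗ mx mx))))
  ... | refl = not-large mm (s≤s z≤n) Z {k = x ⊗ (x ⊗ x) ⊗ ((x ⊕ 𝟙) ⊗ (x ⊗ x ⊕ 𝟙))} {R = (x ⊖ 𝟙) ⊗ (x ⊗ x) ⊕ 𝟙} eq
    (∤-⊗ mm (s≤s z≤n) Z (∤-⊗ mm (s≤s z≤n) Z ∤x (∤-⊗ mm (s≤s z≤n) Z ∤x ∤x))
      -- The factor (x + 1)(x^2 + 1) is C_(x^2)(1), and x^2 has degree 2 < 3; it is excluded as a
      -- whole.
      (λ d → LargeZ.∤C-n Z (Mon⇒Deg (mon-⊗ mx mx)) (s≤s (s≤s (s≤s z≤n))) (∣-respʳ (≈-sym (C-square c mx)) d)))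
    (Mon⇒Deg (mon-⊕𝟙 (s≤s z≤n) (mon-⊗ (mon-⊖𝟙 1≤ mx) (mon-⊗ mx mx)))) ℕP.≤-refl
    where
    Z = largeZ-resp u≈ Z₀
    ∤x = ∤-degree-one mm 1<3 Z mx
    v = x ⊗ x ⊕ x ^ 3
    eq : C m 𝟙 ≈ x ⊗ (x ⊗ x) ⊗ ((x ⊕ 𝟙) ⊗ (x ⊗ x ⊕ 𝟙)) ⊗ ((x ⊖ 𝟙) ⊗ (x ⊗ x) ⊕ 𝟙)
    eq = three c (x ⊗ x ⊗ x ⊗ (x ⊕ 𝟙) ⊗ (x ⊗ x ⊗ x ⊗ x)) (≈-trans
      (C-product {m} {x} {x ⊗ (x ⊖ 𝟙)} (≈-trans e (solve 2 (λ y x → y :* (x :* x) := x :* (x :* y)) ≈-refl (x ⊖ 𝟙) x))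
          (C-consecutive c mx))
      (≈-trans (C-x c mx v) (solve 1 (λ x →
        let o = num 1 ; v = x :* x :+ x :* (x :* (x :* o)) in
        x :* v :+ v :* (v :* (v :* o)) := x :* (x :* x) :* ((x :+ o) :* (x :* x :+ o)) :* ((x :- o) :* (x :* x) :+ o)
          :+ num 3 :* (x :* x :* x :* (x :+ o) :* (x :* x :* x :* x))) ≈-refl x)))
  no-large-zsigmondy {m} {u} (exc-IV c mm₁ u≈) mm Z₀ with deg-unique (Mon⇒Deg mm) (Mon⇒Deg mm₁)
  ... | refl = not-large mm 1≤ Z {k = m ⊗ m} {R = m ⊕ 𝟙} eq (∤-⊗ mm 1≤ Z ∤m ∤m) (Mon⇒Deg (mon-⊕𝟙 1≤ mm)) ℕP.≤-refl
    where
    Z = largeZ-resp u≈ Z₀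
    ∤m : ¬ LargeZ.℘ Z ∣ m
    ∤m d = LargeZ.∤C-n Z (Mon⇒Deg mon-𝟙) (s≤s z≤n) (∣-respʳ (≈-sym (C-𝟙 m)) d)
    eq : C m m ≈ m ⊗ m ⊗ (m ⊕ 𝟙)
    eq = ≈-trans (C-x c mm m) (solve 1 (λ x → x :* x :+ x :* (x :* (x :* num 1)) := x :* x :* (x :+ num 1)) ≈-refl m)
  no-large-zsigmondy {m} {u} (exc-V {x} c u≈ mx e) mm Z₀ with deg-unique (Mon⇒Deg mm)
      (deg-resp (≈-sym e) (Mon⇒Deg (mon-⊗ mx (mon-⊕𝟙 1≤ mx))))
  ... | refl = not-large mm (s≤s z≤n) Z {k = z ⊗ z ⊗ (z ⊕ 𝟙)} {R = x ⊗ z ⊕ 𝟙} eq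
    (∤-⊗ mm (s≤s z≤n) Z (∤-⊗ mm (s≤s z≤n) Z ∤z ∤z) (∤-degree-one mm 1<2 Z (mon-⊕𝟙 1≤ (mon-⊕𝟙 1≤ mx))))
    (Mon⇒Deg (mon-⊕𝟙 (s≤s z≤n) (mon-⊗ mx (mon-⊕𝟙 1≤ mx)))) ℕP.≤-refl
    where
    Z = largeZ-resp u≈ Z₀
    z = x ⊕ 𝟙
    ∤z = ∤-degree-one mm 1<2 Z (mon-⊕𝟙 1≤ mx)
    eq : C m 𝟙 ≈ z ⊗ z ⊗ (z ⊕ 𝟙) ⊗ (x ⊗ z ⊕ 𝟙)
    eq = ≈-trans (C-product {m} {z} {x} (≈-trans e (A.*-comm x z)) (C-degree-one-𝟙 mx))
        (≈-trans (C-x c (mon-⊕𝟙 1≤ mx) z)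
      (solve 1 (λ x → let o = num 1 ; z = x :+ o in
         z :* z :+ z :* (z :* (z :* (z :* (z :* o)))) := z :* z :* (z :+ o) :* (x :* z :+ o)) ≈-refl x))
  no-large-zsigmondy {m} {u} (exc-VI u≈ mm₁) mm Z₀ with deg-unique (Mon⇒Deg mm) (Mon⇒Deg mm₁)
  ... | refl = not-large mm 1≤ Z {k = 𝟙} {R = m ⊕ 𝟙} (≈-trans (C-degree-one-𝟙 mm) (≈-sym (A.*-identityˡ _)))
    (Prime.∤𝟙 (LargeZ.prime Z)) (Mon⇒Deg (mon-⊕𝟙 1≤ mm)) ℕP.≤-refl
    where Z = largeZ-resp u≈ Z₀
  no-large-zsigmondy {m} {u} (exc-VII {x} c u≈ mx e) mm Z₀ with deg-unique (Mon⇒Deg mm)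
      (deg-resp (≈-sym e) (Mon⇒Deg (mon-⊗ mx mx)))
  ... | refl = not-large mm (s≤s z≤n) Z {k = x ⊕ 𝟙} {R = x ⊗ x ⊕ 𝟙}
      (≈-trans (C-congˡ {m} {x ⊗ x} 𝟙 e) (C-square c mx))
    (∤-degree-one mm 1<2 Z (mon-⊕𝟙 1≤ mx)) (Mon⇒Deg (mon-⊕𝟙 (s≤s z≤n) (mon-⊗ mx mx))) ℕP.≤-refl
    where Z = largeZ-resp u≈ Z₀
  no-large-zsigmondy {m} {u} (exc-VIII {x} {w} c u≈ mx r e) mm Z₀ with deg-unique (Mon⇒Deg mm)
      (deg-resp (≈-sym e) (Mon⇒Deg (mon-⊗ mx (mon-⊕ x (‵ w) mx (below-length (‵ w))))))
  ... | refl = not-large mm (s≤s z≤n) Z {k = (x ⊕ 𝟙) ⊗ (x ⊕ ‵ w ⊕ 𝟙)} {R = x ⊗ (x ⊕ ‵ w) ⊕ 𝟙} eq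
    (∤-⊗ mm (s≤s z≤n) Z (∤-degree-one mm 1<2 Z (mon-⊕𝟙 1≤ mx)) (∤-degree-one mm 1<2 Z (mon-⊕𝟙 1≤ mx+w)))
    (Mon⇒Deg (mon-⊕𝟙 (s≤s z≤n) (mon-⊗ mx mx+w))) ℕP.≤-refl
    where
    Z = largeZ-resp u≈ Z₀
    mx+w : Mon 1 (x ⊕ ‵ w)
    mx+w = mon-⊕ x (‵ w) mx (below-length (‵ w))
    root : ‵ w ⊗ ‵ w ⊕ ‵ w ⊕ 𝟙 ≈ []
    root = ≈-trans (⊕-congʳ (⊕-congʳ (≈-sym (‵-* w w))))
        (≈-trans (⊕-congʳ (‵-+ (w * w) w)) (≈-trans (‵-+ (w * w + w) 1#) (‵0≈[] r)))
    z = x ⊕ 𝟙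
    eq : C m 𝟙 ≈ z ⊗ (x ⊕ ‵ w ⊕ 𝟙) ⊗ (x ⊗ (x ⊕ ‵ w) ⊕ 𝟙)
    eq = two c (z ⊗ ((𝟙 ⊖ ‵ w) ⊗ (x ⊗ x) ⊕ (𝟙 ⊕ 𝟙) ⊗ x)) (≈-trans
      (C-product {m} {x ⊕ ‵ w} {x} (≈-trans e (A.*-comm x _)) (C-degree-one-𝟙 mx)) (≈-trans (C-x c mx+w z)
      (≈-trans (solve 2 (λ x w → let o = num 1 ; z = x :+ o in
         (x :+ w) :* z :+ z :* (z :* (z :* (z :* o))) := (z :* (x :+ w :+ o) :* (x :* (x :+ w) :+ o)
           :+ num 2 :* (z :* ((o :- w) :* (x :* x) :+ num 2 :* x))) :- (w :* w :+ w :+ o) :* (z :* x)) ≈-refl x (‵ w))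
      (≈-trans (⊕-congˡ (A.-‿cong (≈-trans (⊗-congʳ root) (A.zeroˡ (z ⊗ x)))))
          (≈-trans (⊕-congˡ A.-0#≈0#) (A.+-identityʳ _))))))
  no-large-zsigmondy {m} {u} (exc-IX {x} c u≈ mx e) mm Z₀ with deg-unique (Mon⇒Deg mm)
      (deg-resp (≈-sym e) (Mon⇒Deg (mon-⊗ (mon-⊗ (mon-⊖𝟙 1≤ mx) mx) (mon-⊕𝟙 1≤ mx))))
  ... | refl = not-large mm (s≤s z≤n) Z {k = x ⊗ x ⊗ (z ⊗ z) ⊗ (y ⊗ y)} {R = y ⊗ x ⊗ z ⊕ 𝟙} eq
    (∤-⊗ mm (s≤s z≤n) Z (∤-⊗ mm (s≤s z≤n) Z (sq mx) (sq (mon-⊕𝟙 1≤ mx))) (sq (mon-⊖𝟙 1≤ mx)))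
    (Mon⇒Deg (mon-⊕𝟙 (s≤s z≤n) (mon-⊗ (mon-⊗ (mon-⊖𝟙 1≤ mx) mx) (mon-⊕𝟙 1≤ mx)))) ℕP.≤-refl
    where
    Z = largeZ-resp u≈ Z₀
    y = x ⊖ 𝟙
    z = x ⊕ 𝟙
    v = x ⊗ x ⊕ x ^ 3
    sq : ∀ {x} → Mon 1 x → ¬ LargeZ.℘ Z ∣ x ⊗ x
    sq mx = ∤-⊗ mm (s≤s z≤n) Z (∤-degree-one mm 1<3 Z mx) (∤-degree-one mm 1<3 Z mx)
    eq : C m 𝟙 ≈ x ⊗ x ⊗ (z ⊗ z) ⊗ (y ⊗ y) ⊗ (y ⊗ x ⊗ z ⊕ 𝟙)
    eq = three c (x ⊗ x ⊗ (z ⊗ z) ⊗ (x ⊗ x ⊗ x ⊗ x ⊖ x ⊗ x ⊕ x)) (≈-trans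
      (C-product {m} {z} {x ⊗ y} (≈-trans e (solve 3 (λ y x z → y :* x :* z := z :* (x :* y)) ≈-refl y x z))
          (C-consecutive c mx))
      (≈-trans (C-x c (mon-⊕𝟙 1≤ mx) v) (solve 1 (λ x →
        let o = num 1 ; v = x :* x :+ x :* (x :* (x :* o)) ; z = x :+ o ; y = x :- o in
        z :* v :+ v :* (v :* (v :* o)) := x :* x :* (z :* z) :* (y :* y) :* (y :* x :* z :+ o)
          :+ num 3 :* (x :* x :* (z :* z) :* (x :* x :* x :* x :- x :* x :+ x))) ≈-refl x)))

-- Criteria for the existence of a large Zsigmondy prime.

module Existence (𝔽 : FiniteField) (2<card : 2 < FiniteField.card 𝔽) where
  open Obstructions 𝔽 2<card public
  open DegreeBounds
  open Growth
  open FiniteField 𝔽 using (_+_; _*_; -_; card)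
  open A using (solve; _:=_; _:+_; _:*_; _:-_; :-_; num)

  infix 4 _≈?_
  _≈?_ : ∀ p r → Dec (p ≈ r)
  p ≈? r with zero? (p ⊖ r)
  ... | yes z = yes (⊖-≈[] z)
  ... | no nz = no (λ e → nz (≈-⊖ e))

  by-degree : ∀ {m u e n r R} (Φ : Primitive m u e) → Mon n m → 0 < n → Mon r R →
    (∀ {d ℘} → Prime d ℘ → ℘ ∣ Primitive.Q Φ → ℘ ∣ m → ℘ ∣ R) → n ℕ.+ r < e → LargeZ n m u
  by-degree Φ mm 0<n mR cover lt = large-zsigmondy Φ mm 0<n (deg⇒≉[] (Mon⇒Deg mR)) cover
    (λ d → ℕP.<⇒≱ lt (∣⇒deg≤ d (Primitive.Q-deg Φ) (Mon⇒Deg (mon-⊗ (mon-⊕𝟙 0<n mm) mR))))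

  -- The crudest choice R = m: a prime of Q dividing m divides R trivially.
  by-double : ∀ {m u e n} → Primitive m u e → Mon n m → 0 < n → 2 ℕ.* n < e → LargeZ n m u
  by-double {e = e} {n} Φ mm 0<n lt = by-degree Φ mm 0<n mm (λ _ _ d → d)
    (subst (_< e) (cong (n ℕ.+_) (ℕP.+-identityʳ n)) lt)

  by-one : ∀ {m u e n} (Φ : Primitive m u e) → Mon n m → 0 < n →
    (∀ {d ℘} → Prime d ℘ → ℘ ∣ Primitive.Q Φ → ¬ ℘ ∣ m) → n < e → LargeZ n m u
  by-one {e = e} {n} Φ mm 0<n none lt = by-degree Φ mm 0<n mon-𝟙
    (λ P q d → contradiction d (none P q)) (subst (_< e) (sym (ℕP.+-identityʳ n)) lt)

  mon-∏-sum : ∀ {ds S} → PrimeList ds S → Mon (ℕL.sum ds) (∏ S)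
  mon-∏-sum []       = mon-𝟙
  mon-∏-sum (P ∷ Ps) = mon-⊗ (Prime.monic P) (mon-∏-sum Ps)

  positives : ∀ {ds S} → PrimeList ds S → All (0 <_) ds
  positives []       = []
  positives (P ∷ Ps) = Prime.positive P ∷ positives Ps

  ∈⇒∣∏ : ∀ {S π} → π ∈ S → π ∣ ∏ S
  ∈⇒∣∏ {π ∷ S} (here refl) = ∣-⊗ʳ (∏ S) ∣-refl
  ∈⇒∣∏ {ρ ∷ S} (there π∈)  = ∣-⊗ˡ ρ (∈⇒∣∏ π∈)

  by-radical : ∀ {m u e n ds S} → PrimeList ds S → Complete S m → Primitive m u e → Mon n m → 0 < n →
    n ℕ.+ ℕL.sum ds < e → LargeZ n m u
  by-radical {m} {S = S} primes complete Φ mm 0<n lt = by-degree Φ mm 0<n (mon-∏-sum primes) cover lt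
    where
    cover : ∀ {d ℘} → Prime d ℘ → ℘ ∣ Primitive.Q Φ → ℘ ∣ m → ℘ ∣ ∏ S
    cover P _ d with complete P d
    ... | π , π∈ , e = ∣-respˡ (≈-sym e) (∈⇒∣∏ π∈)

  coprime-∤ : ∀ {d x y} → Prime d x → Coprime x y → ¬ x ∣ y
  coprime-∤ {x = x} {y} P (s , t , e) d = Prime.∤𝟙 P (∣-respʳ e (∣-⊕ (∣-⊗ˡ s ∣-refl) (∣-⊗ˡ t d)))

  once : ∀ {m u e d x a} (Φ : Primitive m u e) → Prime d x → m ≈ a ⊗ x → ¬ x ∣ a → x ∣ Primitive.Q Φ →
         a ∣ x ⊖ 𝟙 × x ∣ C a u
  once {x = x} Φ P e x∤a x∣Q = order-∣-⊖𝟙 Φ {k = 1} P x∣Q e′ x∤a , ∣C-a Φ {k = 1} P x∣Q e′ x∤a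
    where e′ = ≈-trans e (⊗-congˡ (≈-sym (A.*-identityʳ x)))

  module TwoLinear {m u e x y} (Φ : Primitive m u e) (mx : Mon 1 x) (my : Mon 1 y) (cop : Coprime x y)
                   (m≈ : m ≈ x ⊗ y) (split : ∀ {d ℘} → Prime d ℘ → ℘ ∣ m → ℘ ≈ x ⊎ ℘ ≈ y) where
    open Primitive Φ

    mm : Mon 2 m
    mm = mon-resp (≈-sym m≈) (mon-⊗ mx my)

    -- The order of u modulo x is m/x = y, so y divides x - 1; both are monic of degree one.
    x∣Q⇒ : x ∣ Q → x ≈ y ⊕ 𝟙
    x∣Q⇒ d = ≈-trans (≈-sym (⊖⊕-cancel x 𝟙)) (⊕-congʳ (≈-sym (mon-∣-≈ my (mon-⊖𝟙 (s≤s z≤n) mx)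
      (proj₁ (once Φ (linear-prime mx) (≈-trans m≈ (A.*-comm x y)) (coprime-∤ (linear-prime mx) cop) d)))))

    y∣Q⇒ : y ∣ Q → y ≈ x ⊕ 𝟙
    y∣Q⇒ d = ≈-trans (≈-sym (⊖⊕-cancel y 𝟙)) (⊕-congʳ (≈-sym (mon-∣-≈ mx (mon-⊖𝟙 (s≤s z≤n) my)
      (proj₁ (once Φ (linear-prime my) m≈ (coprime-∤ (linear-prime my) (Coprime-sym cop)) d)))))

    neither : ¬ x ≈ y ⊕ 𝟙 → ¬ y ≈ x ⊕ 𝟙 → 2 < e → LargeZ 2 m u
    neither x≉ y≉ = by-one Φ mm (s≤s z≤n) λ P q d →
      [ (λ e → x≉ (x∣Q⇒ (∣-respˡ e q))) , (λ e → y≉ (y∣Q⇒ (∣-respˡ e q))) ]′ (split P d)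

    -- If both factors divided Q, then x = y + 1 and y = x + 1, so 2 = 0. One linear factor
    -- therefore suffices as R, and deg((m + 1) R) = 3.
    at-most-one : ¬ 2# ≡ 0# → 3 < e → LargeZ 2 m u
    at-most-one 2≢0 lt with x ≈? y ⊕ 𝟙
    ... | no x≉ = by-degree Φ mm (s≤s z≤n) my (λ P q d →
            [ (λ e → contradiction (x∣Q⇒ (∣-respˡ e q)) x≉) , ∣-reflexive ]′ (split P d)) lt
    ... | yes x≈ = by-degree Φ mm (s≤s z≤n) mx (λ P q d →
            [ ∣-reflexive , (λ e → contradiction (y∣Q⇒ (∣-respˡ e q)) y≉) ]′ (split P d)) lt
      where
      y≉ : ¬ y ≈ x ⊕ 𝟙
      y≉ y≈ = 2≢0 (trans (sym (at (‵-+ 1# 1#) 0)) (at (begin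
        𝟙 ⊕ 𝟙                       ≈⟨ solve 2 (λ x y → num 2 := y :+ num 1 :- x :+ (x :+ num 1 :- y)) ≈-refl x y ⟩
        y ⊕ 𝟙 ⊖ x ⊕ (x ⊕ 𝟙 ⊖ y)     ≈⟨ ⊕-cong (≈-⊖ (≈-sym x≈)) (≈-⊖ (≈-sym y≈)) ⟩
        [] ⊕ []                     ≈⟨ A.+-identityʳ [] ⟩
        []                          ∎) 0))
        where open ≈-Reasoning

  exception-resp : ∀ {m u u′} → u ≈ u′ → Exception m u → Exception m u′
  exception-resp e (exc-I c u≈ mx f)      = exc-I c (≈-trans (≈-sym e) u≈) mx f
  exception-resp e (exc-II c u≈ mx f)     = exc-II c (≈-trans (≈-sym e) u≈) mx f
  exception-resp e (exc-III c u≈ mx f)    = exc-III c (≈-trans (≈-sym e) u≈) mx f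
  exception-resp e (exc-IV c mm u≈)       = exc-IV c mm (≈-trans (≈-sym e) u≈)
  exception-resp e (exc-V c u≈ mx f)      = exc-V c (≈-trans (≈-sym e) u≈) mx f
  exception-resp e (exc-VI u≈ mm)         = exc-VI (≈-trans (≈-sym e) u≈) mm
  exception-resp e (exc-VII c u≈ mx f)    = exc-VII c (≈-trans (≈-sym e) u≈) mx f
  exception-resp e (exc-VIII c u≈ mx r f) = exc-VIII c (≈-trans (≈-sym e) u≈) mx r f
  exception-resp e (exc-IX c u≈ mx f)     = exc-IX c (≈-trans (≈-sym e) u≈) mx f

  difference : ∀ {x y} → Mon 1 x → Mon 1 y → y ≈ x ⊕ ‵ (coeff y 0 + - coeff x 0)
  difference {x} {y} mx my = ≈-sym (begin
    x ⊕ ‵ (b + - a)             ≈⟨ ⊕-congʳ (linear-≈ mx a refl) ⟩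
    T ⊕ ‵ a ⊕ ‵ (b + - a)       ≈⟨ A.+-assoc T (‵ a) _ ⟩
    T ⊕ (‵ a ⊕ ‵ (b + - a))
      ≈⟨ ⊕-congˡ (≈-trans (‵-+ a (b + - a)) (‵-cong (K.solve 2 (λ a b → a K.:+ (b K.:- a) K.:= b) refl a b))) ⟩
    T ⊕ ‵ b                     ≈⟨ linear-≈ my b refl ⟨
    y                           ∎)
    where
    open ≈-Reasoning
    a = coeff x 0
    b = coeff y 0

  coprime-≉ : ∀ {x y} → Mon 1 x → Coprime x y → ¬ x ≈ y
  coprime-≉ mx cop e = coprime-∤ (linear-prime mx) cop (∣-reflexive e)

  difference≢0 : ∀ {x y} → Mon 1 x → Mon 1 y → Coprime x y → ¬ coeff y 0 + - coeff x 0 ≡ 0#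
  difference≢0 {x} {y} mx my cop e = coprime-≉ mx cop (≈-sym (≈-trans (difference mx my)
    (≈-trans (⊕-congˡ (‵0≈[] e)) (A.+-identityʳ x))))

  module UnitBase (p : ℕ) (card≡ : card ≡ suc p) where

    mon-C₁ : ∀ {k g} → Mon k g → Mon (D₁ p k) (C g 𝟙)
    mon-C₁ {zero} {g} mg = mon-resp (≈-sym (≈-trans (C-congˡ {g} {𝟙} 𝟙 (mon-0 mg)) (C-𝟙 𝟙))) mon-𝟙
    mon-C₁ {suc k} {g} mg = subst (λ q → Mon (q ℕ.^ k) (C g 𝟙)) card≡ (mon-C-𝟙 mg)

    part : ∀ {n m} (f : Factorization n m) → Primitive m 𝟙 (computeE (D₁ p) (Factorization.ds f) (Factorization.k f))
    part {m = m} f with primitive-part 𝟙 (D₁ p) mon-C₁ monic (primes⇒degrees primes) coprimes complete product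
      where open Factorization f
    ... | e , Ee , Φ = subst (Primitive m 𝟙) (E⇒compute (Factorization.ds f) Ee) Φ

    fast : ∀ {n m} → Mon n m → 0 < n → Fast p n → LargeZ n m 𝟙
    fast {n} {m} mm 0<n f with factorize mm
    ... | φ with primitive-part 𝟙 (D₁ p) mon-C₁ monic (primes⇒degrees primes) coprimes complete product
      where open Factorization φ
    ...   | e , Ee , Φ = by-double Φ mm 0<n
        (fast⇒large p {k = Factorization.k φ} (positives (Factorization.primes φ)) Ee (Factorization.degrees φ) f)

  -- The part a of m prime to ℘ is constant, as π is the only prime available. But then ℘ divides
  -- C_1(1) = 1; this is particular to u = 1.
  prime-power : ∀ {n m π e} (Φ : Primitive m 𝟙 e) → Mon n m → Complete (π ∷ []) m →
                ∀ {d ℘} → Prime d ℘ → ℘ ∣ Primitive.Q Φ → ¬ ℘ ∣ m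
  prime-power {m = m} Φ mm complete {℘ = ℘} P ℘∣Q ℘∣m with multiplicity P m (deg⇒≉[] (Mon⇒Deg mm))
  ... | k , a , m≈ , ℘∤a with ≉[]⇒deg {a} (λ a≈ → ℘∤a (∣-respʳ (≈-sym a≈) ∣-zero))
  ...   | zero , da = Prime.∤𝟙 P (∣-trans (∣C-a Φ {k = k} P ℘∣Q m≈ ℘∤a)
      (∣-respʳ (C-𝟙 𝟙) (C-∣ {a} {𝟙} 𝟙 (deg-0-∣𝟙 da))))
  ...   | suc j , da with prime-divisor da (s≤s z≤n)
  ...     | _ , ρ , R , ρ∣a with complete P ℘∣m | complete R (∣-respʳ (≈-sym m≈) (∣-⊗ʳ (℘ ^ k) ρ∣a))
  ...       | _ , here refl , ℘≈ | _ , here refl , ρ≈ = ℘∤a (∣-respˡ (≈-trans ρ≈ (≈-sym ℘≈)) ρ∣a)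

  module SquareTimesLinear {m x y} (Φ : Primitive m 𝟙 4) (mx : Mon 1 x) (my : Mon 1 y) (cop : Coprime x y)
                           (m≈ : m ≈ x ⊗ x ⊗ y) (split : ∀ {d ℘} → Prime d ℘ → ℘ ∣ m → ℘ ≈ x ⊎ ℘ ≈ y) where
    open Primitive Φ

    -- Here deg Q = φ(m)/3 = 12/3 = 4. If x divides Q, its order gives y | x - 1, so y = x - 1 and m
    -- is exceptional; if y divides Q, then x^2 | y - 1, impossible by degree. So R = 1, and 3 < 4.
    large : card ≡ 3 → ¬ Exception m 𝟙 → LargeZ 3 m 𝟙
    large c ¬exc = by-one Φ (mon-resp (≈-sym m≈) (mon-⊗ (mon-⊗ mx mx) my)) (s≤s z≤n)
      (λ P q d → [ (λ e → x∤ (∣-respˡ e q)) , (λ e → y∤ (∣-respˡ e q)) ]′ (split P d)) ℕP.≤-refl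
      where
      Px = linear-prime mx
      Py = linear-prime my
      x∤ : ¬ x ∣ Q
      x∤ x∣Q = ¬exc (exc-III c ≈-refl mx (≈-trans m≈ (≈-trans (A.*-comm (x ⊗ x) y) (⊗-congʳ
        (mon-∣-≈ my (mon-⊖𝟙 (s≤s z≤n) mx) (order-∣-⊖𝟙 Φ {k = 2} Px x∣Q
          (≈-trans m≈ (solve 2 (λ x y → x :* x :* y := y :* (x :* (x :* num 1))) ≈-refl x y)) (coprime-∤ Px cop)))))))
      y∤x² : ¬ y ∣ x ⊗ x
      y∤x² d = [ coprime-∤ Py (Coprime-sym cop) , coprime-∤ Py (Coprime-sym cop) ]′ (Prime.euclid Py x x d)
      y∤ : ¬ y ∣ Q
      y∤ y∣Q = ℕP.<⇒≱ (s≤s (s≤s z≤n)) (∣⇒deg≤ (proj₁ (once Φ Py m≈ y∤x² y∣Q)) (Mon⇒Deg (mon-⊗ mx mx))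
          (Mon⇒Deg (mon-⊖𝟙 (s≤s z≤n) my)))

  -- The index 5 is (φ(m) - μ(m))/3 = (16 - 1)/3 for q = 3. If y divided Q it would divide C_x(1) =
  -- x + 1, which has smaller degree. So R = x, and deg((m + 1) R) = 4 < 5.
  linear-quadratic : ∀ {m x y} (Φ : Primitive m 𝟙 5) → Mon 1 x → Prime 2 y → Coprime y x → m ≈ x ⊗ y →
                     (∀ {d ℘} → Prime d ℘ → ℘ ∣ m → ℘ ≈ x ⊎ ℘ ≈ y) → LargeZ 3 m 𝟙
  linear-quadratic {m} {x} {y} Φ mx Py cop m≈ split =
    by-degree Φ (mon-resp (≈-sym m≈) (mon-⊗ mx (Prime.monic Py))) (s≤s z≤n) mx
      (λ P q d → [ ∣-reflexive , (λ e → contradiction (∣-respˡ e q) y∤) ]′ (split P d)) ℕP.≤-refl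
    where
    y∤ : ¬ y ∣ Primitive.Q Φ
    y∤ y∣Q = ℕP.<⇒≱ (s≤s (s≤s z≤n)) (∣⇒deg≤
        (∣-respʳ (C-degree-one-𝟙 mx) (proj₂ (once Φ Py m≈ (coprime-∤ Py cop) y∣Q)))
      (Mon⇒Deg (Prime.monic Py)) (Mon⇒Deg (mon-⊕𝟙 (s≤s z≤n) mx)))

  module PositiveDegreeBase (p : ℕ) (card≡ : card ≡ suc p) (2≤p : 2 ≤ p) where

    mon-Cᵈ : ∀ {d u} → 0 < d → Mon d u → ∀ {k g} → Mon k g → Mon (Dᵈ p d k) (C g u)
    mon-Cᵈ {d} {u} 0<d mu {k} {g} mg = subst (λ q → Mon (d ℕ.* q ℕ.^ k) (C g u)) card≡ (mon-C 0<d mg mu)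

    primitive-degree : ∀ {d u n m} → 0 < d → Mon d u → (f : Factorization n m) →
      ∃ λ e → E (Dᵈ p d) (Factorization.ds f) (Factorization.k f) e × Primitive m u e
    primitive-degree {d} {u} 0<d mu f =
      primitive-part u (Dᵈ p d) (mon-Cᵈ 0<d mu) monic (primes⇒degrees primes) coprimes complete product
      where open Factorization f

    degree-bound : ∀ {d u n m} → 0 < d → Mon d u → (f : Factorization n m) →
      ∃ λ e → d ℕ.* p ℕ.^ n ≤ e × Primitive m u e
    degree-bound {d} {n = n} 0<d mu f with primitive-degree 0<d mu f
    ... | e , Ee , Φ = e , subst (λ j → d ℕ.* p ℕ.^ j ≤ e) (Factorization.degrees f)
          (E-Dᵈ-bound p {d} {Factorization.ds f} {Factorization.k f} (positives (Factorization.primes f)) Ee) , Φ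

    generic : ∀ {d u n m} → 0 < d → Mon d u → Mon n m → 0 < n → 2 ℕ.* n < d ℕ.* p ℕ.^ n → LargeZ n m u
    generic 0<d mu mm 0<n lt with degree-bound 0<d mu (factorize mm)
    ... | e , le , Φ = by-double Φ mm 0<n (ℕP.≤-trans lt le)

    -- If m itself divides Q, the order of u modulo m is 1, so m divides C_1(u) = u and the two are
    -- equal. Otherwise R = 1, and deg Q ≥ q - 1 > 1.
    linear : ∀ {u m} → Mon 1 u → Mon 1 m → ¬ u ≈ m → LargeZ 1 m u
    linear {u} {m} mu mm u≉m with degree-bound (s≤s z≤n) mu (factorize mm)
    ... | e , le , Φ = by-one Φ mm (s≤s z≤n)
          (λ {d} {℘} P q ℘∣m → u≉m (≈-sym (mon-∣-≈ mm mu (m∣u (∣-respˡ (prime-∣-prime P (linear-prime mm) ℘∣m) q)))))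
          (ℕP.≤-trans 2≤p (ℕP.≤-trans (ℕP.≤-reflexive (sym (trans (ℕP.+-identityʳ _) (ℕP.*-identityʳ p)))) le))
      where
      m∣u : m ∣ Primitive.Q Φ → m ∣ u
      m∣u q = ∣-respʳ (C-𝟙 u) (proj₂ (once Φ (linear-prime mm) (≈-sym (A.*-identityˡ m)) (Prime.∤𝟙 (linear-prime mm))
          q))

-- Deciding a property of all degree patterns of a given total degree.

module Compositions where
  ∧-elim : ∀ {a b} → True (a ∧ b) → True a × True b
  ∧-elim {true} t = tt , t

  ∨-elim : ∀ {a b} → True (a ∨ b) → True a ⊎ True b
  ∨-elim {true}  t = inj₁ tt
  ∨-elim {false} t = inj₂ t

  pairs : ℕ → (ℕ → ℕ → Bool) → Bool
  pairs zero    P = P 0 0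
  pairs (suc n) P = P 0 (suc n) ∧ pairs n (λ a b → P (suc a) b)

  pairs-sound : ∀ n P → True (pairs n P) → ∀ a b → a ℕ.+ b ≡ n → True (P a b)
  pairs-sound zero    P t zero    zero refl = t
  pairs-sound (suc n) P t zero    _    refl = proj₁ (∧-elim t)
  pairs-sound (suc n) P t (suc a) b    e    =
    pairs-sound n _ (proj₂ (∧-elim {P 0 (suc n)} t)) a b (ℕP.suc-injective e)

  -- Evaluates P at every pair of k and a list of positive degrees with total n, so that numerical
  -- conditions on all factorization types are settled by computation. The first list entry is
  -- written `suc a`, which leaves b for the rest; `fuel` bounds the number of entries.
  check : ℕ → ℕ → (ℕ → List ℕ → Bool) → Bool
  check zero       n       P = P n []
  check (suc fuel) zero    P = P 0 []
  check (suc fuel) (suc n) P = P (suc n) [] ∧ pairs n (λ a b → check fuel b (λ k ds → P k (suc a ∷ ds)))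

  private
    check-[] : ∀ fuel n P → True (check fuel n P) → True (P n [])
    check-[] zero       n       P t = t
    check-[] (suc fuel) zero    P t = t
    check-[] (suc fuel) (suc n) P t = proj₁ (∧-elim t)

    rotate : ∀ k a s → k ℕ.+ (suc a ℕ.+ s) ≡ suc (a ℕ.+ (k ℕ.+ s))
    rotate = NS.solve 3 (λ k a s → k NS.:+ (NS.con 1 NS.:+ a NS.:+ s) NS.:= NS.con 1 NS.:+ (a NS.:+ (k NS.:+ s))) refl

    check-sound′ : ∀ fuel n P → n ≤ fuel → True (check fuel n P) →
                   ∀ k ds → All (0 <_) ds → k ℕ.+ ℕL.sum ds ≡ n → True (P k ds)
    check-sound′ fuel n P n≤ t k [] _ e = subst (λ j → True (P j [])) (trans (sym e) (ℕP.+-identityʳ k))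
        (check-[] fuel n P t)
    check-sound′ fuel n P n≤ t k (suc a ∷ ds) (_ ∷ ps) e with trans (sym (rotate k a (ℕL.sum ds))) e
    check-sound′ (suc fuel) (suc n) P (s≤s n≤) t k (suc a ∷ ds) (_ ∷ ps) e | e′ =
      check-sound′ fuel b _ (ℕP.≤-trans (ℕP.≤-trans (ℕP.m≤n+m b a) (ℕP.≤-reflexive (ℕP.suc-injective e′))) n≤)
        (pairs-sound n _ (proj₂ (∧-elim {P (suc n) []} t)) a b (ℕP.suc-injective e′)) k ds ps refl
      where b = k ℕ.+ ℕL.sum ds
    check-sound′ zero    zero    P n≤ t k (suc a ∷ ds) ps e | ()
    check-sound′ (suc _) zero    P n≤ t k (suc a ∷ ds) ps e | ()

  check-sound : ∀ n P → True (check n n P) → ∀ {k ds} → All (0 <_) ds → k ℕ.+ ℕL.sum ds ≡ n → True (P k ds)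
  check-sound n P t ps e = check-sound′ n n P ℕP.≤-refl t _ _ ps e

-- The remaining small degrees, chiefly for q = 3.

module Classification (𝔽 : FiniteField) (2<card : 2 < FiniteField.card 𝔽) where
  open Existence 𝔽 2<card public
  open DegreeBounds
  open Growth
  open Compositions
  open FiniteField 𝔽 using (_+_; -_; card)
  open A using (solve; _:=_; _:+_; _:*_; _:-_; :-_; num)

  split₂ : ∀ {m x y} → Complete (x ∷ y ∷ []) m → ∀ {d ℘} → Prime d ℘ → ℘ ∣ m → ℘ ≈ x ⊎ ℘ ≈ y
  split₂ complete P d with complete P d
  ... | _ , here refl , e         = inj₁ e
  ... | _ , there (here refl) , e = inj₂ e

  swap : ∀ {m x y} → (∀ {d ℘} → Prime d ℘ → ℘ ∣ m → ℘ ≈ x ⊎ ℘ ≈ y) →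
         ∀ {d ℘} → Prime d ℘ → ℘ ∣ m → ℘ ≈ y ⊎ ℘ ≈ x
  swap split P d = [ inj₂ , inj₁ ]′ (split P d)

  no-prime : ∀ {m} → Complete [] m → ∀ {d ℘} → Prime d ℘ → ¬ ℘ ∣ m
  no-prime complete P d with complete P d
  ... | _ , () , _

  two-factors : ∀ {m g x y} → Mon 0 g → m ≈ g ⊗ (x ⊗ (y ⊗ 𝟙)) → m ≈ x ⊗ y
  two-factors {x = x} {y} mg e = ≈-trans e (≈-trans (⊗-congʳ (mon-0 mg))
    (solve 2 (λ x y → num 1 :* (x :* (y :* num 1)) := x :* y) ≈-refl x y))

  plus-one : ∀ {x y} → Mon 1 x → Mon 1 y → coeff y 0 + - coeff x 0 ≡ 1# → y ≈ x ⊕ 𝟙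
  plus-one mx my e = ≈-trans (difference mx my) (⊕-congˡ (‵-cong e))

  plus-two : card ≡ 3 → ∀ {x y} → Mon 1 x → Mon 1 y → coeff y 0 + - coeff x 0 ≡ 2# → y ≈ x ⊖ 𝟙
  plus-two c {x} mx my e = three c 𝟙 (≈-trans (difference mx my)
      (≈-trans (⊕-congˡ (≈-trans (‵-cong e) (≈-sym (‵-+ 1# 1#))))
    (solve 1 (λ x → x :+ num 2 := (x :- num 1) :+ num 3 :* num 1) ≈-refl x)))

  -- Over three elements the nonzero difference of the constant terms is 1 or -1, so the two linear
  -- factors are always consecutive.
  exceptions-3 : ∀ {m x y} → card ≡ 3 → Mon 1 x → Mon 1 y → Coprime x y → m ≈ x ⊗ y → Exception m 𝟙
  exceptions-3 {m} {x} {y} c mx my cop m≈ with Card3.elements c (coeff y 0 + - coeff x 0)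
  ... | inj₁ e = contradiction e (difference≢0 mx my cop)
  ... | inj₂ (inj₁ e) = exc-I c ≈-refl my (≈-trans m≈ (⊗-congʳ (≈-sym (⊖𝟙-≈ (plus-one mx my e)))))
  ... | inj₂ (inj₂ e) = exc-I c ≈-refl mx (≈-trans m≈ (≈-trans (A.*-comm x y) (⊗-congʳ (plus-two c mx my e))))

  -- A difference 1 of the constant terms gives consecutive factors, and any other nonzero
  -- difference is a root of w^2 + w + 1.
  exceptions-4 : ∀ {m x y} → card ≡ 4 → Mon 1 x → Mon 1 y → Coprime x y → m ≈ x ⊗ y → Exception m 𝟙
  exceptions-4 {m} {x} {y} c mx my cop m≈ with Card4.cube-root c (coeff y 0 + - coeff x 0)
  ... | inj₁ e = contradiction e (difference≢0 mx my cop)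
  ... | inj₂ (inj₁ e) = exc-II c ≈-refl my (≈-trans m≈ (⊗-congʳ (≈-sym (⊖𝟙-≈ (plus-one mx my e)))))
  ... | inj₂ (inj₂ r) = exc-VIII c ≈-refl mx r (≈-trans m≈ (⊗-congˡ (difference mx my)))

  -- Three distinct monic linear polynomials over three elements are all of them, so up to order the
  -- other two are x + 1 and x - 1.
  exceptions-3-cubic : ∀ {m x y z} → card ≡ 3 → Mon 1 x → Mon 1 y → Mon 1 z → Coprime x y → Coprime x z → Coprime y z
      →
    m ≈ x ⊗ (y ⊗ z) → Exception m 𝟙
  exceptions-3-cubic {m} {x} {y} {z} c mx my mz xy xz yz m≈
    with Card3.elements c (coeff y 0 + - coeff x 0) | Card3.elements c (coeff z 0 + - coeff x 0)
  ... | inj₁ e | _ = contradiction e (difference≢0 mx my xy)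
  ... | inj₂ _ | inj₁ e = contradiction e (difference≢0 mx mz xz)
  ... | inj₂ (inj₁ e) | inj₂ (inj₁ e′) = contradiction
      (≈-trans (difference mx my) (≈-trans (⊕-congˡ (‵-cong (trans e (sym e′)))) (≈-sym (difference mx mz))))
      (coprime-≉ my yz)
  ... | inj₂ (inj₂ e) | inj₂ (inj₂ e′) = contradiction
      (≈-trans (difference mx my) (≈-trans (⊕-congˡ (‵-cong (trans e (sym e′)))) (≈-sym (difference mx mz))))
      (coprime-≉ my yz)
  ... | inj₂ (inj₁ e) | inj₂ (inj₂ e′) = exc-IX c ≈-refl mx
      (≈-trans m≈ (≈-trans (⊗-congˡ (⊗-cong (plus-one mx my e) (plus-two c mx mz e′)))
          (solve 1 (λ x → x :* ((x :+ num 1) :* (x :- num 1)) := (x :- num 1) :* x :* (x :+ num 1)) ≈-refl x)))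
  ... | inj₂ (inj₂ e) | inj₂ (inj₁ e′) = exc-IX c ≈-refl mx
      (≈-trans m≈ (≈-trans (⊗-congˡ (⊗-cong (plus-two c mx my e) (plus-one mx mz e′)))
          (solve 1 (λ x → x :* ((x :- num 1) :* (x :+ num 1)) := (x :- num 1) :* x :* (x :+ num 1)) ≈-refl x)))

  lone : ∀ {m x a e} (Φ : Primitive m 𝟙 e) → Mon 1 x → Mon 3 a → m ≈ a ⊗ x → ¬ x ∣ a → ¬ x ∣ Primitive.Q Φ
  lone Φ mx ma m≈ x∤a d = ℕP.<⇒≱ (s≤s (s≤s z≤n))
    (∣⇒deg≤ (proj₁ (once Φ (linear-prime mx) m≈ x∤a d)) (Mon⇒Deg ma) (Mon⇒Deg (mon-⊖𝟙 (s≤s z≤n) mx)))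

  ∤-triple : ∀ {d x a b c} → Prime d x → Coprime x a → Coprime x b → Coprime x c → ¬ x ∣ a ⊗ (b ⊗ c)
  ∤-triple {a = a} {b} {c} P xa xb xc d =
    [ coprime-∤ P xa , (λ d′ → [ coprime-∤ P xb , coprime-∤ P xc ]′ (Prime.euclid P b c d′)) ]′
        (Prime.euclid P a (b ⊗ c) d)

  module Card≡3 (c : card ≡ 3) where
    open UnitBase 2 c using (part)

    private
      e₁ : List ℕ → ℕ → ℕ
      e₁ = computeE (D₁ 2)

      -- For each degree pattern: either deg Q is numerically large enough for the choice of R
      -- available there, or the pattern is named for separate treatment. The clauses `false` stand
      -- for lists with too many positive entries for the total degree.
      P₂ P₃ P₄ Pᵈ : ℕ → List ℕ → Bool
      P₂ k []             = 2 <ᵇ e₁ [] k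
      P₂ k ds@(d ∷ [])    = (2 <ᵇ e₁ ds k) ∨ ((k ≡ᵇ 1) ∧ (d ≡ᵇ 1))
      P₂ k (d ∷ d′ ∷ [])  = (k ≡ᵇ 0) ∧ (d ≡ᵇ 1) ∧ (d′ ≡ᵇ 1)
      P₂ k _              = false
      P₃ k []             = 3 <ᵇ e₁ [] k
      P₃ k ds@(_ ∷ [])    = 3 <ᵇ e₁ ds k
      P₃ k (d ∷ d′ ∷ [])  = ((k ≡ᵇ 0) ∧ (d ≡ᵇ 1) ∧ (d′ ≡ᵇ 2)) ∨ ((k ≡ᵇ 0) ∧ (d ≡ᵇ 2) ∧ (d′ ≡ᵇ 1)) ∨
          ((k ≡ᵇ 1) ∧ (d ≡ᵇ 1) ∧ (d′ ≡ᵇ 1))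
      P₃ k (d ∷ d′ ∷ d″ ∷ []) = (k ≡ᵇ 0) ∧ (d ≡ᵇ 1) ∧ (d′ ≡ᵇ 1) ∧ (d″ ≡ᵇ 1)
      P₃ k _              = false
      P₄ k []             = 4 <ᵇ e₁ [] k
      P₄ k ds@(_ ∷ [])    = 4 <ᵇ e₁ ds k
      P₄ k ds@(_ ∷ _ ∷ [])     = 4 ℕ.+ ℕL.sum ds <ᵇ e₁ ds k
      P₄ k ds@(_ ∷ _ ∷ _ ∷ []) = 4 ℕ.+ ℕL.sum ds <ᵇ e₁ ds k
      P₄ k (d ∷ d′ ∷ d″ ∷ d‴ ∷ []) = (k ≡ᵇ 0) ∧ (d ≡ᵇ 1) ∧ (d′ ≡ᵇ 1) ∧ (d″ ≡ᵇ 1) ∧ (d‴ ≡ᵇ 1)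
      P₄ k _              = false
      Pᵈ k ds@(_ ∷ _ ∷ _ ∷ _) = false
      Pᵈ k (d ∷ d′ ∷ [])  = (k ≡ᵇ 0) ∧ (d ≡ᵇ 1) ∧ (d′ ≡ᵇ 1)
      Pᵈ k ds             = 2 ℕ.+ ℕL.sum ds <ᵇ computeE (Dᵈ 2 1) ds k

      eq₃ : ∀ {a b a′ b′ a″ b″} → True ((a ≡ᵇ b) ∧ (a′ ≡ᵇ b′) ∧ (a″ ≡ᵇ b″)) → a ≡ b × a′ ≡ b′ × a″ ≡ b″
      eq₃ {a} {b} {a′} {b′} {a″} {b″} t with ∧-elim t
      ... | t₁ , t′ with ∧-elim t′
      ...   | t₂ , t₃ = ℕP.≡ᵇ⇒≡ a b t₁ , ℕP.≡ᵇ⇒≡ a′ b′ t₂ , ℕP.≡ᵇ⇒≡ a″ b″ t₃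

    degree-2 : ∀ {m} → Mon 2 m → ¬ Exception m 𝟙 → LargeZ 2 m 𝟙
    degree-2 {m} mm ¬exc = go monic primes coprimes complete product
        (check-sound 2 P₂ tt (positives primes) degrees) (part φ)
      where
      φ = factorize mm
      open Factorization φ
      go : ∀ {k ds S g} → Mon k g → PrimeList ds S → AllCoprime S → Complete S m → m ≈ g ⊗ ∏ S →
           True (P₂ k ds) → Primitive m 𝟙 (e₁ ds k) → LargeZ 2 m 𝟙
      go {k} mg [] _ comp m≈ t Φ = by-one Φ mm (s≤s z≤n) (λ P _ → no-prime comp P) (ℕP.<ᵇ⇒< _ _ t)
      go {k} {d ∷ []} {x ∷ []} {g} mg (P ∷ []) _ comp m≈ t Φ with ∨-elim t
      ... | inj₁ t′ = by-one Φ mm (s≤s z≤n) (prime-power Φ mm comp) (ℕP.<ᵇ⇒< _ _ t′)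
      ... | inj₂ t′ with ∧-elim {k ≡ᵇ 1} t′
      ...   | t₁ , t₂ with ℕP.≡ᵇ⇒≡ k 1 t₁ | ℕP.≡ᵇ⇒≡ d 1 t₂
      ...     | refl | refl with comp (linear-prime mg) (∣-respʳ (≈-sym m≈) (∣-⊗ʳ (x ⊗ 𝟙) ∣-refl))
      ...       | _ , here refl , g≈ = contradiction (exc-VII c ≈-refl (Prime.monic P)
                    (≈-trans m≈ (⊗-cong g≈ (A.*-identityʳ x)))) ¬exc
      go {k} {d ∷ d′ ∷ []} mg (P ∷ P′ ∷ []) ((cop ∷ []) , _) comp m≈ t Φ with eq₃ {k} {0} {d} {1} {d′} {1} t
      ... | refl , refl , refl = contradiction
            (exceptions-3 c (Prime.monic P) (Prime.monic P′) cop (two-factors mg m≈)) ¬exc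
      go mg (_ ∷ _ ∷ _ ∷ _) _ _ _ () _

    degree-3 : ∀ {m} → Mon 3 m → ¬ Exception m 𝟙 → LargeZ 3 m 𝟙
    degree-3 {m} mm ¬exc = go monic primes coprimes complete product
        (check-sound 3 P₃ tt (positives primes) degrees) (part φ)
      where
      φ = factorize mm
      open Factorization φ
      go : ∀ {k ds S g} → Mon k g → PrimeList ds S → AllCoprime S → Complete S m → m ≈ g ⊗ ∏ S →
           True (P₃ k ds) → Primitive m 𝟙 (e₁ ds k) → LargeZ 3 m 𝟙
      go mg [] _ comp m≈ t Φ = by-one Φ mm (s≤s z≤n) (λ P _ → no-prime comp P) (ℕP.<ᵇ⇒< _ _ t)
      go mg (P ∷ []) _ comp m≈ t Φ = by-one Φ mm (s≤s z≤n) (prime-power Φ mm comp) (ℕP.<ᵇ⇒< _ _ t)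
      go {k} {d ∷ d′ ∷ []} {x ∷ y ∷ []} {g} mg (P ∷ P′ ∷ []) ((cop ∷ []) , _) comp m≈ t Φ
        with ∨-elim {(k ≡ᵇ 0) ∧ (d ≡ᵇ 1) ∧ (d′ ≡ᵇ 2)} t
      ... | inj₁ t′ with eq₃ {k} {0} {d} {1} {d′} {2} t′
      ...   | refl , refl , refl =
              linear-quadratic Φ (Prime.monic P) P′ (Coprime-sym cop) (two-factors mg m≈) (split₂ comp)
      go {k} {d ∷ d′ ∷ []} {x ∷ y ∷ []} {g} mg (P ∷ P′ ∷ []) ((cop ∷ []) , _) comp m≈ t Φ
        | inj₂ t′ with ∨-elim {(k ≡ᵇ 0) ∧ (d ≡ᵇ 2) ∧ (d′ ≡ᵇ 1)} t′
      ...   | inj₁ t″ with eq₃ {k} {0} {d} {2} {d′} {1} t″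
      ...     | refl , refl , refl = linear-quadratic Φ (Prime.monic P′) P cop
                (≈-trans (two-factors mg m≈) (A.*-comm x y)) (swap (split₂ comp))
      go {k} {d ∷ d′ ∷ []} {x ∷ y ∷ []} {g} mg (P ∷ P′ ∷ []) ((cop ∷ []) , _) comp m≈ t Φ
        | inj₂ t′ | inj₂ t″ with eq₃ {k} {1} {d} {1} {d′} {1} t″
      ...     | refl , refl , refl with split₂ comp (linear-prime mg) (∣-respʳ (≈-sym m≈) (∣-⊗ʳ (x ⊗ (y ⊗ 𝟙)) ∣-refl))
      ...       | inj₁ g≈x = SquareTimesLinear.large Φ (Prime.monic P) (Prime.monic P′) cop
                    (≈-trans m≈ (≈-trans (⊗-congʳ g≈x) (solve 2 (λ x y → x :* (x :* (y :* num 1)) := x :* x :* y)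
                        ≈-refl x y)))
                    (split₂ comp) c ¬exc
      ...       | inj₂ g≈y = SquareTimesLinear.large Φ (Prime.monic P′) (Prime.monic P) (Coprime-sym cop)
                    (≈-trans m≈ (≈-trans (⊗-congʳ g≈y) (solve 2 (λ x y → y :* (x :* (y :* num 1)) := y :* y :* x)
                        ≈-refl x y)))
                    (swap (split₂ comp)) c ¬exc
      go {k} {d ∷ d′ ∷ d″ ∷ []} {x ∷ y ∷ z ∷ []} mg (P ∷ P′ ∷ P″ ∷ []) ((xy ∷ xz ∷ []) , (yz ∷ []) , _) comp m≈ t Φ
        with ∧-elim {k ≡ᵇ 0} t
      ... | t₀ , t′ with ℕP.≡ᵇ⇒≡ k 0 t₀ | eq₃ {d} {1} {d′} {1} {d″} {1} t′
      ...   | refl | refl , refl , refl = contradiction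
              (exceptions-3-cubic c (Prime.monic P) (Prime.monic P′) (Prime.monic P″) xy xz yz
                (≈-trans m≈ (≈-trans (⊗-congʳ (mon-0 mg))
                  (solve 3 (λ x y z → num 1 :* (x :* (y :* (z :* num 1))) := x :* (y :* z)) ≈-refl x y z)))) ¬exc
      go mg (_ ∷ _ ∷ _ ∷ _ ∷ _) _ _ _ () _

    degree-4 : ∀ {m} → Mon 4 m → LargeZ 4 m 𝟙
    degree-4 {m} mm = go monic primes coprimes complete product
        (check-sound 4 P₄ tt (positives primes) degrees) (part φ)
      where
      φ = factorize mm
      open Factorization φ
      go : ∀ {k ds S g} → Mon k g → PrimeList ds S → AllCoprime S → Complete S m → m ≈ g ⊗ ∏ S →
           True (P₄ k ds) → Primitive m 𝟙 (e₁ ds k) → LargeZ 4 m 𝟙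
      go mg [] _ comp m≈ t Φ = by-one Φ mm (s≤s z≤n) (λ P _ → no-prime comp P) (ℕP.<ᵇ⇒< _ _ t)
      go mg (P ∷ []) _ comp m≈ t Φ = by-one Φ mm (s≤s z≤n) (prime-power Φ mm comp) (ℕP.<ᵇ⇒< _ _ t)
      go mg Ps@(_ ∷ _ ∷ []) _ comp m≈ t Φ = by-radical Ps comp Φ mm (s≤s z≤n) (ℕP.<ᵇ⇒< _ _ t)
      go mg Ps@(_ ∷ _ ∷ _ ∷ []) _ comp m≈ t Φ = by-radical Ps comp Φ mm (s≤s z≤n) (ℕP.<ᵇ⇒< _ _ t)
      go {k} {d ∷ d′ ∷ d″ ∷ d‴ ∷ []} {w ∷ x ∷ y ∷ z ∷ []} {g} mg (P ∷ P′ ∷ P″ ∷ P‴ ∷ [])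
         ((wx ∷ wy ∷ wz ∷ []) , (xy ∷ xz ∷ []) , (yz ∷ []) , _) comp m≈ t Φ with ∧-elim {k ≡ᵇ 0} t
      ... | t₀ , t′ with ∧-elim {d ≡ᵇ 1} t′
      ...   | t₁ , t″ with ℕP.≡ᵇ⇒≡ k 0 t₀ | ℕP.≡ᵇ⇒≡ d 1 t₁ | eq₃ {d′} {1} {d″} {1} {d‴} {1} t″
      -- Here deg Q = (16 - 1)/3 = 5. The cofactor of each linear factor has degree 3 and cannot
      -- divide x - 1, so R = 1 suffices.
      ...     | refl | refl | refl , refl , refl = by-one Φ mm (s≤s z≤n) none ℕP.≤-refl
        where
        open Prime P using () renaming (monic to mw)
        open Prime P′ using () renaming (monic to mx)
        open Prime P″ using () renaming (monic to my)
        open Prime P‴ using () renaming (monic to mz)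
        m≈′ : m ≈ 𝟙 ⊗ (w ⊗ (x ⊗ (y ⊗ (z ⊗ 𝟙))))
        m≈′ = ≈-trans m≈ (⊗-congʳ (mon-0 mg))
        none : ∀ {d ℘} → Prime d ℘ → ℘ ∣ Primitive.Q Φ → ¬ ℘ ∣ m
        none R q ℘∣m with comp R ℘∣m
        ... | _ , here refl , e = lone Φ mw (mon-⊗ mx (mon-⊗ my mz))
              (≈-trans m≈′ (solve 4 (λ w x y z → num 1 :* (w :* (x :* (y :* (z :* num 1)))) := x :* (y :* z) :* w)
                  ≈-refl w x y z))
              (∤-triple P wx wy wz) (∣-respˡ e q)
        ... | _ , there (here refl) , e = lone Φ mx (mon-⊗ mw (mon-⊗ my mz))
              (≈-trans m≈′ (solve 4 (λ w x y z → num 1 :* (w :* (x :* (y :* (z :* num 1)))) := w :* (y :* z) :* x)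
                  ≈-refl w x y z))
              (∤-triple P′ (Coprime-sym wx) xy xz) (∣-respˡ e q)
        ... | _ , there (there (here refl)) , e = lone Φ my (mon-⊗ mw (mon-⊗ mx mz))
              (≈-trans m≈′ (solve 4 (λ w x y z → num 1 :* (w :* (x :* (y :* (z :* num 1)))) := w :* (x :* z) :* y)
                  ≈-refl w x y z))
              (∤-triple P″ (Coprime-sym wy) (Coprime-sym xy) yz) (∣-respˡ e q)
        ... | _ , there (there (there (here refl))) , e = lone Φ mz (mon-⊗ mw (mon-⊗ mx my))
              (≈-trans m≈′ (solve 4 (λ w x y z → num 1 :* (w :* (x :* (y :* (z :* num 1)))) := w :* (x :* y) :* z)
                  ≈-refl w x y z))
              (∤-triple P‴ (Coprime-sym wz) (Coprime-sym xz) (Coprime-sym yz)) (∣-respˡ e q)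
      go mg (_ ∷ _ ∷ _ ∷ _ ∷ _ ∷ _) _ _ _ () _

    degree-2-linear : ∀ {m u} → Mon 1 u → Mon 2 m → LargeZ 2 m u
    degree-2-linear {m} {u} mu mm with PositiveDegreeBase.primitive-degree 2 c (s≤s (s≤s z≤n)) (s≤s z≤n) mu φ
      where φ = factorize mm
    ... | e , Ee , Φ = go monic primes coprimes complete product (check-sound 2 Pᵈ tt (positives primes) degrees)
          (subst (Primitive m u) (E⇒compute ds Ee) Φ)
      where
      φ = factorize mm
      open Factorization φ
      go : ∀ {k ds S g} → Mon k g → PrimeList ds S → AllCoprime S → Complete S m → m ≈ g ⊗ ∏ S →
           True (Pᵈ k ds) → Primitive m u (computeE (Dᵈ 2 1) ds k) → LargeZ 2 m u
      go mg Ps@[] _ comp m≈ t Φ = by-radical Ps comp Φ mm (s≤s z≤n) (ℕP.<ᵇ⇒< _ _ t)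
      go mg Ps@(_ ∷ []) _ comp m≈ t Φ = by-radical Ps comp Φ mm (s≤s z≤n) (ℕP.<ᵇ⇒< _ _ t)
      go {k} {d ∷ d′ ∷ []} mg (P ∷ P′ ∷ []) ((cop ∷ []) , _) comp m≈ t Φ with eq₃ {k} {0} {d} {1} {d′} {1} t
      -- Now deg Q = φ(m) = 4, just above the 3 that `at-most-one` asks for.
      ... | refl , refl , refl = TwoLinear.at-most-one Φ (Prime.monic P) (Prime.monic P′) cop
            (two-factors mg m≈) (split₂ comp) (Card3.2≢0 c) ℕP.≤-refl
      go mg (_ ∷ _ ∷ _ ∷ _) _ _ _ () _

-- Assembly over all q and all degrees.

module Main (𝔽 : FiniteField) (2<card : 2 < FiniteField.card 𝔽) where
  open Classification 𝔽 2<card public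
  open DegreeBounds
  open Growth
  open Compositions
  open FiniteField 𝔽 using (card)

  private
    P₂ : ℕ → ℕ → List ℕ → Bool
    P₂ p k []            = 2 <ᵇ computeE (D₁ p) [] k
    P₂ p k ds@(_ ∷ [])   = 2 <ᵇ computeE (D₁ p) ds k
    P₂ p k (d ∷ d′ ∷ []) = (k ≡ᵇ 0) ∧ (d ≡ᵇ 1) ∧ (d′ ≡ᵇ 1)
    P₂ p k _             = false

  -- For the values of q used, every quadratic m except a product of two distinct linear factors has
  -- deg Q > 2 and no prime shared with Q. Only the exceptional product depends on q and is passed
  -- in as `two-linear`.
  degree-2-by : ∀ {m} p → card ≡ suc p → True (check 2 2 (P₂ p)) → Mon 2 m →
    (∀ {x y} → Primitive m 𝟙 (computeE (D₁ p) (1 ∷ 1 ∷ []) 0) → Mon 1 x → Mon 1 y → Coprime x y → m ≈ x ⊗ y →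
       (∀ {d ℘} → Prime d ℘ → ℘ ∣ m → ℘ ≈ x ⊎ ℘ ≈ y) → LargeZ 2 m 𝟙) → LargeZ 2 m 𝟙
  degree-2-by {m} p c ok mm two-linear = go monic primes coprimes complete product
      (check-sound 2 (P₂ p) ok (positives primes) degrees) (UnitBase.part p c φ)
    where
    φ = factorize mm
    open Factorization φ
    go : ∀ {k ds S g} → Mon k g → PrimeList ds S → AllCoprime S → Complete S m → m ≈ g ⊗ ∏ S →
         True (P₂ p k ds) → Primitive m 𝟙 (computeE (D₁ p) ds k) → LargeZ 2 m 𝟙
    go mg [] _ comp m≈ t Φ = by-one Φ mm (s≤s z≤n) (λ P _ → no-prime comp P) (ℕP.<ᵇ⇒< _ _ t)
    go mg (P ∷ []) _ comp m≈ t Φ = by-one Φ mm (s≤s z≤n) (prime-power Φ mm comp) (ℕP.<ᵇ⇒< _ _ t)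
    go {k} {d ∷ d′ ∷ []} mg (P ∷ P′ ∷ []) ((cop ∷ []) , _) comp m≈ t Φ with ∧-elim {k ≡ᵇ 0} t
    ... | t₀ , t′ with ∧-elim {d ≡ᵇ 1} t′
    ...   | t₁ , t₂ with ℕP.≡ᵇ⇒≡ k 0 t₀ | ℕP.≡ᵇ⇒≡ d 1 t₁ | ℕP.≡ᵇ⇒≡ d′ 1 t₂
    ...     | refl | refl | refl = two-linear Φ (Prime.monic P) (Prime.monic P′) cop (two-factors mg m≈) (split₂ comp)
    go mg (_ ∷ _ ∷ _ ∷ _) _ _ _ () _

  data CardCases (N : ℕ) : Set where
    is-3 : N ≡ 3 → CardCases N
    is-4 : N ≡ 4 → CardCases N
    is-5 : N ≡ 5 → CardCases N
    is-6 : N ≡ 6 → CardCases N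
    ≥-7  : ∀ {p} → 6 ≤ p → N ≡ suc p → CardCases N

  card-cases : ∀ {N} → 2 < N → CardCases N
  card-cases {3} _ = is-3 refl
  card-cases {4} _ = is-4 refl
  card-cases {5} _ = is-5 refl
  card-cases {6} _ = is-6 refl
  card-cases {suc (suc (suc (suc (suc (suc (suc N))))))} _ = ≥-7 (ℕP.m≤m+n 6 N) refl
  card-cases {1} (s≤s ())
  card-cases {2} (s≤s (s≤s ()))

  exists-𝟙 : ∀ {n m} → 0 < n → Mon n m → ¬ Exception m 𝟙 → LargeZ n m 𝟙
  exists-𝟙 {1} _ mm ¬exc = contradiction (exc-VI ≈-refl mm) ¬exc
  exists-𝟙 {suc (suc n)} {m} _ mm ¬exc with card-cases 2<card
  exists-𝟙 {2} _ mm ¬exc | is-3 c = Card≡3.degree-2 c mm ¬exc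
  exists-𝟙 {3} _ mm ¬exc | is-3 c = Card≡3.degree-3 c mm ¬exc
  exists-𝟙 {4} _ mm ¬exc | is-3 c = Card≡3.degree-4 c mm
  -- The growth condition is met with equality at degree 5, where 2 · 5 · 3 + 2 = 32 = 2^5; this is
  -- why degrees up to 4 need their own arguments.
  exists-𝟙 {suc (suc (suc (suc (suc j))))} _ mm ¬exc | is-3 c =
    UnitBase.fast 2 c mm (s≤s z≤n) (fast-from 4 (ℕP.≤ᵇ⇒≤ 2 2 tt) (ℕP.≤ᵇ⇒≤ 32 32 tt) j)
  exists-𝟙 {2} _ mm ¬exc | is-4 c = degree-2-by 3 c tt mm
    λ _ mx my cop m≈ _ → contradiction (exceptions-4 c mx my cop m≈) ¬exc
  exists-𝟙 {suc (suc (suc j))} _ mm ¬exc | is-4 c =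
    UnitBase.fast 3 c mm (s≤s z≤n) (fast-from 2 (ℕP.≤ᵇ⇒≤ 2 3 tt) (ℕP.≤ᵇ⇒≤ 26 27 tt) j)
  exists-𝟙 {2} {m} _ mm ¬exc | is-5 c = degree-2-by 4 c tt mm
    λ {x} {y} Φ mx my cop m≈ split → TwoLinear.neither Φ mx my cop m≈ split
      (λ x≈ → ¬exc (exc-V c ≈-refl my (≈-trans m≈ (≈-trans (A.*-comm x y) (⊗-congˡ x≈)))))
      (λ y≈ → ¬exc (exc-V c ≈-refl mx (≈-trans m≈ (⊗-congˡ y≈))))
      (ℕP.≤ᵇ⇒≤ 3 3 tt)
  exists-𝟙 {suc (suc (suc j))} _ mm ¬exc | is-5 c =
    UnitBase.fast 4 c mm (s≤s z≤n) (fast-from 2 (ℕP.≤ᵇ⇒≤ 2 4 tt) (ℕP.≤ᵇ⇒≤ 32 64 tt) j)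
  exists-𝟙 {2} _ mm ¬exc | is-6 c = degree-2-by 5 c tt mm
    λ Φ mx my cop m≈ split → TwoLinear.at-most-one Φ mx my cop m≈ split (card≡6⇒2≢0 c) (ℕP.≤ᵇ⇒≤ 4 4 tt)
  exists-𝟙 {suc (suc (suc j))} _ mm ¬exc | is-6 c =
    UnitBase.fast 5 c mm (s≤s z≤n) (fast-from 2 (ℕP.≤ᵇ⇒≤ 2 5 tt) (ℕP.≤ᵇ⇒≤ 38 125 tt) j)
  exists-𝟙 {suc (suc j)} _ mm ¬exc | ≥-7 {p} 6≤p c =
    UnitBase.fast p c mm (s≤s z≤n) (fast-from 1 (ℕP.≤-trans (ℕP.≤ᵇ⇒≤ 2 6 tt) 6≤p) (fast-≥6 6≤p) j)

  exists-≥4 : ∀ {n m d u p} → 0 < d → Mon d u → 0 < n → Mon n m → 3 ≤ p → card ≡ suc p → LargeZ n m u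
  exists-≥4 {n} {d = d} {p = p} 0<d mu 0<n mm 3≤p c = PositiveDegreeBase.generic p c (ℕP.≤-trans (ℕP.≤ᵇ⇒≤ 2 3 tt) 3≤p)
      0<d mu mm 0<n
    (ℕP.≤-trans (2n<3^n n) (ℕP.≤-trans (ℕP.^-monoˡ-≤ n 3≤p)
      (ℕP.≤-trans (ℕP.≤-reflexive (sym (ℕP.*-identityˡ (p ℕ.^ n)))) (ℕP.*-monoˡ-≤ (p ℕ.^ n) 0<d))))

  exists-positive : ∀ {n m d u} → 0 < d → Mon d u → 0 < n → Mon n m → ¬ Exception m u → LargeZ n m u
  exists-positive {n} {m} {d} {u} 0<d mu 0<n mm ¬exc with card-cases 2<card
  ... | is-4 c = exists-≥4 0<d mu 0<n mm (ℕP.≤ᵇ⇒≤ 3 3 tt) c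
  ... | is-5 c = exists-≥4 0<d mu 0<n mm (ℕP.≤ᵇ⇒≤ 3 4 tt) c
  ... | is-6 c = exists-≥4 0<d mu 0<n mm (ℕP.≤ᵇ⇒≤ 3 5 tt) c
  ... | ≥-7 6≤p c = exists-≥4 0<d mu 0<n mm (ℕP.≤-trans (ℕP.≤ᵇ⇒≤ 3 6 tt) 6≤p) c
  exists-positive {n} {m} {suc (suc d)} {u} 0<d mu 0<n mm ¬exc | is-3 c =
    PositiveDegreeBase.generic 2 c ℕP.≤-refl 0<d mu mm 0<n
      (ℕP.≤-trans (ℕP.*-monoʳ-< 2 (n<2^n n)) (ℕP.*-monoˡ-≤ (2 ℕ.^ n) (s≤s (s≤s (z≤n {d})))))
  exists-positive {1} {m} {1} {u} 0<d mu 0<n mm ¬exc | is-3 c =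
    PositiveDegreeBase.linear 2 c ℕP.≤-refl mu mm (λ u≈m → ¬exc (exc-IV c mm u≈m))
  exists-positive {2} {m} {1} {u} 0<d mu 0<n mm ¬exc | is-3 c = Card≡3.degree-2-linear c mu mm
  exists-positive {suc (suc (suc n))} {m} {1} {u} 0<d mu 0<n mm ¬exc | is-3 c =
    PositiveDegreeBase.generic 2 c ℕP.≤-refl 0<d mu mm 0<n
      (ℕP.≤-trans (2n<2^n n) (ℕP.≤-reflexive (sym (ℕP.*-identityˡ (2 ℕ.^ suc (suc (suc n)))))))

  -- For m = 1 no nonzero n has smaller degree and C_1(u) = u, so any prime divisor of u is large.
  exists-degree-0 : ∀ {m d u} → 0 < d → Mon d u → Mon 0 m → LargeZ 0 m u
  exists-degree-0 {m} {u = u} 0<d mu mm with prime-divisor (Mon⇒Deg mu) 0<d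
  ... | k , π , P , π∣u = largeZ P (∣-respʳ (≈-sym (≈-trans (C-congˡ {m} {𝟙} u (mon-0 mm)) (C-𝟙 u))) π∣u)
        (λ _ ()) (inj₁ (Prime.positive P))

  exists : ∀ {n m d u} → Mon n m → Mon d u → 0 < n ⊎ 0 < d → ¬ Exception m u → LargeZ n m u
  exists {zero}          mm mu (inj₂ 0<d) _    = exists-degree-0 0<d mu mm
  exists {suc n} {d = suc d} mm mu _      ¬exc = exists-positive (s≤s z≤n) mu (s≤s z≤n) mm ¬exc
  exists {suc n} {d = zero}  mm mu _      ¬exc = largeZ-resp (≈-sym (mon-0 mu))
    (exists-𝟙 (s≤s z≤n) mm (λ exc → ¬exc (exception-resp (≈-sym (mon-0 mu)) exc)))

theorem6p16 : (𝔽 : FiniteField) → 2 < FiniteField.card 𝔽 →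
    let open Poly 𝔽 in
    (m u : Pol) → Monic m → Monic u → (0 < deg m ⊎ 0 < deg u) →
    (∃ λ ℘ → LargeZsigmondy u m ℘) ⇔ (¬ Exceptional m u)
theorem6p16 𝔽 2<card m u monic-m monic-u positive = mk⇔
  (λ { (℘ , Z) exc → no-large-zsigmondy (from-Exceptional (subst (λ X → X) (Exceptional-def m u) exc)) mm
      (to-LargeZ mm Z) })
  (λ ¬exc → from-LargeZ mm (exists mm (Monic⇒Mon monic-u) positive
     (λ exc → ¬exc (subst (λ X → X) (sym (Exceptional-def m u)) (to-Exceptional exc)))))
  where
  open Main 𝔽 2<card
  mm = Monic⇒Mon monic-m
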